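{- Let $\triangle(q)=\sum_{n=0}^\infty q^{n(n+1)/2}$. For every integer $m\ge 1$ we have the identity of power series \[ q^{\frac{m^2}{2}}\,\triangle(q)^{4m^2}=\frac{2^m(2m)!}{\prod_{j=1}^m(2j)!^2}\sum_{\substack{x_j,y_j\in \frac12+\mathbb{Z}_{\ge 0}\\ 1\le j\le m}} f(\vec{\bm x})\,q^{2\sum_{j=1}^m x_jy_j}, \] where \[ f(\vec{\bm x})=\prod_{j=1}^m (x_j+y_j)\cdot\prod_{1\le i<j\le m}\Big((x_i-y_i)^2-(x_j-y_j)^2\Big)\Big((x_i+y_i)^2-(x_j+y_j)^2\Big). \]
   Context: Here $\vec{\bm x}$ denotes the tuple $(x_1,\dots,x_m,y_1,\dots,y_m)$ of summation variables; the sum runs over all $x_1,\dots,x_m,y_1,\dots,y_m\in\{1/2,3/2,5/2,\dots\}$. -}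

module Defs where

open import Data.Nat as ℕ using (ℕ; zero; suc; _!; _^_; _<ᵇ_; _≡ᵇ_; NonZero)
open import Data.Nat.Properties using (_!≢0; m*n≢0)
open import Data.Fin using (Fin; toℕ)
open import Data.Vec using (Vec; []; _∷_; lookup)
open import Data.Bool using (if_then_else_)
open import Data.Integer using (+_)
open import Data.Rational using (ℚ; 0ℚ; 1ℚ; _+_; _*_; _-_; ½; _/_; _≟_)
open import Relation.Nullary using (does)

-- Formal power series in a variable t with coefficients in ℚ,
-- given by their coefficient sequence.  We use t = q^(1/2), so that
-- half-integer powers of q (which occur on both sides) are integer powers of t:
-- the coefficient at index k is the coefficient of q^(k/2).
PS : Set
PS = ℕ → ℚ

sumTo : ℕ → (ℕ → ℚ) → ℚ
sumTo zero    g = g 0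
sumTo (suc n) g = sumTo n g + g (suc n)

prodFin : (n : ℕ) → (Fin n → ℚ) → ℚ
prodFin zero    g = 1ℚ
prodFin (suc n) g = g Data.Fin.zero * prodFin n (λ i → g (Data.Fin.suc i))

_⊛_ : PS → PS → PS
(f ⊛ g) n = sumTo n (λ k → f k * g (n ℕ.∸ k))

_^ₚ_ : PS → ℕ → PS
(f ^ₚ zero)  n = if n ≡ᵇ 0 then 1ℚ else 0ℚ
(f ^ₚ suc e) = f ⊛ (f ^ₚ e)

shift : ℕ → PS → PS
shift s f n = if n ℕ.<ᵇ s then 0ℚ else f (n ℕ.∸ s)

-- △(q) = Σ_{n≥0} q^{n(n+1)/2}, as a series in t = q^(1/2):
-- coefficient of t^k is #{ n ∈ ℕ | n(n+1) = k } (any such n satisfies n ≤ k).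
triangle : PS
triangle k = sumTo k (λ n → if (n ℕ.* suc n) ≡ᵇ k then 1ℚ else 0ℚ)

lhs : ℕ → PS
lhs m = shift (m ℕ.* m) (triangle ^ₚ (4 ℕ.* (m ℕ.* m)))

sumBox : (m : ℕ) → ℕ → (Vec ℕ m → ℚ) → ℚ
sumBox zero    N g = g []
sumBox (suc m) N g = sumTo N (λ a → sumBox m N (λ v → g (a ∷ v)))

fromℕ : ℕ → ℚ
fromℕ n = + n / 1

half : ℕ → ℚ
half a = fromℕ a + ½

fpoly : (m : ℕ) → (Fin m → ℚ) → (Fin m → ℚ) → ℚ
fpoly m x y =
  prodFin m (λ j → x j + y j) *
  prodFin m (λ i → prodFin m (λ j →
    if toℕ i ℕ.<ᵇ toℕ j
    then (sq (x i - y i) - sq (x j - y j)) * (sq (x i + y i) - sq (x j + y j))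
    else 1ℚ))
  where
  sq : ℚ → ℚ
  sq z = z * z

dot : (m : ℕ) → (Fin m → ℚ) → (Fin m → ℚ) → ℚ
dot zero    x y = 0ℚ
dot (suc m) x y = x Data.Fin.zero * y Data.Fin.zero
                  + dot m (λ i → x (Data.Fin.suc i)) (λ i → y (Data.Fin.suc i))

denom : ℕ → ℕ
denom zero    = 1
denom (suc m) = ((2 ℕ.* suc m) !) ℕ.* ((2 ℕ.* suc m) !) ℕ.* denom m

denom≢0 : ∀ m → NonZero (denom m)
denom≢0 zero    = _
denom≢0 (suc m) =
  let instance _ = (2 ℕ.* suc m) !≢0
               _ = m*n≢0 ((2 ℕ.* suc m) !) ((2 ℕ.* suc m) !)
               _ = denom≢0 m
  in m*n≢0 (((2 ℕ.* suc m) !) ℕ.* ((2 ℕ.* suc m) !)) (denom m)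

const : ℕ → ℚ
const m = (+ (2 ^ m ℕ.* (2 ℕ.* m) !) / denom m) {{denom≢0 m}}

-- Right-hand side: const · Σ_{x_j,y_j ∈ 1/2+ℤ≥0} f(x,y) q^{2 Σ x_j y_j}.
-- Coefficient of t^N = q^{N/2} collects the tuples with 2Σ x_j y_j = N/2,
-- i.e. 4 Σ x_j y_j = N.  Any such tuple has x_j = a_j + 1/2 with a_j ≤ N
-- (since 4(a+1/2)(b+1/2) ≥ 2a+1), so summing over the box a_j,b_j ≤ N is
-- the full (finite) sum for this coefficient.
rhs : ℕ → PS
rhs m N = const m * sumBox m N (λ a → sumBox m N (λ b →
  let x = λ j → half (lookup a j)
      y = λ j → half (lookup b j)
  in if does (fromℕ 4 * dot m x y ≟ fromℕ N) then fpoly m x y else 0ℚ))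

{-# OPTIONS --safe #-}

-- Put s = x + y and d = x - y. Then f is the product of Π sⱼ with the Vandermonde products in the
-- sⱼ² and in the dⱼ², so by Andréief's formula the sum is m! times the determinant of the moments
-- Σ s^(2i+1) d^(2j) q^(2xy), 0 ≤ i, j < m. Their generating function G(u, v) = 2 Σ sinh(su) cosh(dv) q^(2xy) is
-- given by Kronecker's identity, G(u, v) θ₄(u + v) θ₄(u - v) = C θ₁(2u); and since
-- θ₄(u + v) θ₄(u - v) = e(u) e(v) - o(u) o(v) for the even and odd parts e, o of Σ exp(nu) t^(n²), t = q^(1/2),
-- this is c(u) / (a(u) a(v) - b(u) b(v)) with b = O(u²). Expanding the quotient as a geometric series
-- writes the matrix of moments as a lower times an upper triangular matrix, whose diagonal
-- entries multiply to (2k)! (2k + 1)! (t Δ⁴)^(2k+1) by Jacobi's derivative formula. The latter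
-- follows from Landen's transformation q → q², which leaves the quotient of its two sides unchanged.
-- Everything takes place modulo t^(N+1), where all theta series are finite sums.

module Submission where

open import Defs
open import Level using (0ℓ)
open import Algebra.Bundles using (CommutativeRing)
open import Algebra.Solver.Ring.AlmostCommutativeRing using (fromCommutativeRing; _-Raw-AlmostCommutative⟶_)
import Algebra.Solver.Ring
import Algebra.Properties.Ring
open import Data.Nat as ℕ using (ℕ; zero; suc; z≤n; s≤s; _≤_; _!; NonZero)
import Data.Nat.Properties as ℕₚ
open import Data.Integer as ℤ using (ℤ; +_; -[1+_]; ∣_∣)
import Data.Integer.Properties as ℤₚ
open import Data.Integer.Tactic.RingSolver using (solve-∀)
open import Data.Fin as Fin using (Fin; toℕ)
open import Data.Vec using (Vec; []; _∷_; lookup)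
open import Data.Bool using (if_then_else_)
open import Data.Rational as ℚ using (ℚ; 0ℚ; 1ℚ; ½)
import Data.Rational.Properties as ℚₚ
open import Data.Rational.Unnormalised as ℚᵘ using (mkℚᵘ; *≡*)
import Data.Rational.Unnormalised.Properties as ℚᵘₚ
import Data.Nat.Tactic.RingSolver
import Data.Maybe
open import Data.Product using (∃; _×_; _,_; proj₁; proj₂)
import Data.Product.Properties as ×ₚ
open import Data.Sum using (_⊎_; inj₁; inj₂)
import Data.Sum.Properties as ⊎ₚ
open import Data.Empty using (⊥-elim)
open import Data.List using (List; []; _∷_; _++_; map; deduplicate; cartesianProduct; upTo)
import Data.List.Properties as Lₚ
open import Data.List.Membership.Propositional using (_∈_; _∉_)
import Data.List.Membership.Propositional.Properties as ∈ₚ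
open import Data.List.Relation.Unary.Any using (here; there)
open import Data.List.Relation.Unary.All using (All; []; _∷_)
import Data.List.Relation.Unary.All as All
open import Data.List.Relation.Unary.AllPairs using ([]; _∷_)
open import Data.List.Relation.Unary.Unique.Propositional using (Unique)
import Data.List.Relation.Unary.Unique.Propositional.Properties as Uₚ
import Data.List.Relation.Unary.Unique.DecPropositional.Properties as DUₚ
open import Relation.Nullary using (¬_; Dec; yes; no; does)
open import Relation.Binary.Definitions using (DecidableEquality)
open import Relation.Binary.Consequences using (dec⇒weaklyDec)
open import Relation.Binary.PropositionalEquality as ≡ using (_≡_; _≢_)
open import Function using (_∘_; id)

-- Two obstacles shape the proof. First, neither e nor o vanishes at u = 0, so the quotient is
-- formed with a = e(0) e - o(0) o and b = e(0) o - o(0) e: then a(u) a(v) - b(u) b(v) = (e(0)² -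
-- o(0)²) (e(u) e(v) - o(u) o(v)), while b is even and b(0) = 0. Only a(0) and the first
-- coefficients of b and c enter the diagonal; they are theta constants, and θ₄ cancels from the
-- result. Second, there is no analysis: t is nilpotent. Landen's substitution lowers the nilpotency
-- bound, so finitely many steps reach t = 0, and the induction carries along that the theta
-- constants are not zero divisors. Kronecker's identity is proved coefficientwise instead of by
-- comparing poles: for r ≠ s the coefficient of exp ((r + s + 1) u + (r - s) v) is periodic in the
-- exponent of t with period 4 (r - s) and vanishes at nonpositive exponents, hence everywhere. The
-- terms with r = s give the right side. The constant of the theorem balances m! and the diagonal
-- factorials.

module RingTools (R : CommutativeRing 0ℓ 0ℓ) where
  open CommutativeRing R
  open Algebra.Properties.Ring ring using (-‿distribˡ-*; -‿distribʳ-*; -‿involutive; -‿+-comm; -0#≈0#)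
  open import Relation.Binary.Reasoning.Setoid setoid

  -- The separate case of 1 avoids a trailing `+ 0#`: the solver constants 0 and 1 are then `0#` and
  -- `1#` by definition.
  fromℕ′ : ℕ → Carrier
  fromℕ′ zero          = 0#
  fromℕ′ (suc zero)    = 1#
  fromℕ′ (suc (suc n)) = 1# + fromℕ′ (suc n)

  fromℤ : ℤ → Carrier
  fromℤ (+ n)    = fromℕ′ n
  fromℤ -[1+ n ] = - fromℕ′ (suc n)

  fromℕ′-suc : ∀ n → fromℕ′ (suc n) ≈ 1# + fromℕ′ n
  fromℕ′-suc zero    = sym (+-identityʳ 1#)
  fromℕ′-suc (suc n) = refl

  fromℕ′-+ : ∀ m n → fromℕ′ (m ℕ.+ n) ≈ fromℕ′ m + fromℕ′ n
  fromℕ′-+ zero    n = sym (+-identityˡ _)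
  fromℕ′-+ (suc m) n = begin
    fromℕ′ (suc (m ℕ.+ n))     ≈⟨ fromℕ′-suc (m ℕ.+ n) ⟩
    1# + fromℕ′ (m ℕ.+ n)      ≈⟨ +-congˡ (fromℕ′-+ m n) ⟩
    1# + (fromℕ′ m + fromℕ′ n) ≈⟨ +-assoc _ _ _ ⟨
    (1# + fromℕ′ m) + fromℕ′ n ≈⟨ +-congʳ (fromℕ′-suc m) ⟨
    fromℕ′ (suc m) + fromℕ′ n  ∎

  fromℕ′-* : ∀ m n → fromℕ′ (m ℕ.* n) ≈ fromℕ′ m * fromℕ′ n
  fromℕ′-* zero    n = sym (zeroˡ _)
  fromℕ′-* (suc m) n = begin
    fromℕ′ (n ℕ.+ m ℕ.* n)                ≈⟨ fromℕ′-+ n (m ℕ.* n) ⟩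
    fromℕ′ n + fromℕ′ (m ℕ.* n)           ≈⟨ +-cong (sym (*-identityˡ _)) (fromℕ′-* m n) ⟩
    1# * fromℕ′ n + fromℕ′ m * fromℕ′ n   ≈⟨ distribʳ _ _ _ ⟨
    (1# + fromℕ′ m) * fromℕ′ n            ≈⟨ *-congʳ (fromℕ′-suc m) ⟨
    fromℕ′ (suc m) * fromℕ′ n             ∎

  fromℤ-neg : ∀ i → fromℤ (ℤ.- i) ≈ - fromℤ i
  fromℤ-neg (+ zero)   = sym -0#≈0#
  fromℤ-neg (+ suc n)  = refl
  fromℤ-neg -[1+ n ]   = sym (-‿involutive _)

  private
    cancel-1 : ∀ a b → a - b ≈ (1# + a) - (1# + b)
    cancel-1 a b = sym (begin
      (1# + a) + - (1# + b)       ≈⟨ +-congˡ (-‿+-comm 1# b) ⟨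
      (1# + a) + (- 1# + - b)     ≈⟨ +-congʳ (+-comm 1# a) ⟩
      (a + 1#) + (- 1# + - b)     ≈⟨ +-assoc a 1# _ ⟩
      a + (1# + (- 1# + - b))     ≈⟨ +-congˡ (+-assoc 1# _ _) ⟨
      a + ((1# + - 1#) + - b)     ≈⟨ +-congˡ (+-congʳ (-‿inverseʳ 1#)) ⟩
      a + (0# + - b)              ≈⟨ +-congˡ (+-identityˡ _) ⟩
      a - b                       ∎)

  fromℤ-⊖ : ∀ m n → fromℤ (m ℤ.⊖ n) ≈ fromℕ′ m - fromℕ′ n
  fromℤ-⊖ zero    zero    = sym (-‿inverseʳ 0#)
  fromℤ-⊖ zero    (suc n) = sym (+-identityˡ _)
  fromℤ-⊖ (suc m) zero    = sym (trans (+-congˡ -0#≈0#) (+-identityʳ _))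
  fromℤ-⊖ (suc m) (suc n) = begin
    fromℤ (suc m ℤ.⊖ suc n)             ≡⟨ ≡.cong fromℤ (ℤₚ.[1+m]⊖[1+n]≡m⊖n m n) ⟩
    fromℤ (m ℤ.⊖ n)                     ≈⟨ fromℤ-⊖ m n ⟩
    fromℕ′ m - fromℕ′ n                 ≈⟨ cancel-1 _ _ ⟩
    (1# + fromℕ′ m) - (1# + fromℕ′ n)   ≈⟨ +-cong (fromℕ′-suc m) (-‿cong (fromℕ′-suc n)) ⟨
    fromℕ′ (suc m) - fromℕ′ (suc n)     ∎

  fromℤ-+ : ∀ i j → fromℤ (i ℤ.+ j) ≈ fromℤ i + fromℤ j
  fromℤ-+ (+ m)    (+ n)    = fromℕ′-+ m n
  fromℤ-+ (+ m)    -[1+ n ] = fromℤ-⊖ m (suc n)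
  fromℤ-+ -[1+ m ] (+ n)    = trans (fromℤ-⊖ n (suc m)) (+-comm _ _)
  fromℤ-+ -[1+ m ] -[1+ n ] = begin
    - fromℕ′ (suc (suc (m ℕ.+ n)))           ≡⟨ ≡.cong (λ k → - fromℕ′ (suc k)) (ℕₚ.+-suc m n) ⟨
    - fromℕ′ (suc m ℕ.+ suc n)               ≈⟨ -‿cong (fromℕ′-+ (suc m) (suc n)) ⟩
    - (fromℕ′ (suc m) + fromℕ′ (suc n))      ≈⟨ -‿+-comm _ _ ⟨
    - fromℕ′ (suc m) - fromℕ′ (suc n)        ∎

  private
    fromℤ-*⁺ : ∀ m j → fromℤ (+ m ℤ.* j) ≈ fromℕ′ m * fromℤ j
    fromℤ-*⁺ m (+ n)    = trans (reflexive (≡.cong fromℤ (≡.sym (ℤₚ.pos-* m n)))) (fromℕ′-* m n)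
    fromℤ-*⁺ m -[1+ n ] = begin
      fromℤ (+ m ℤ.* -[1+ n ])           ≡⟨ ≡.cong fromℤ (ℤₚ.neg-distribʳ-* (+ m) (+ suc n)) ⟨
      fromℤ (ℤ.- (+ m ℤ.* + suc n))      ≈⟨ fromℤ-neg (+ m ℤ.* + suc n) ⟩
      - fromℤ (+ m ℤ.* + suc n)          ≈⟨ -‿cong (fromℤ-*⁺ m (+ suc n)) ⟩
      - (fromℕ′ m * fromℕ′ (suc n))      ≈⟨ -‿distribʳ-* _ _ ⟩
      fromℕ′ m * - fromℕ′ (suc n)        ∎

  fromℤ-* : ∀ i j → fromℤ (i ℤ.* j) ≈ fromℤ i * fromℤ j
  fromℤ-* (+ m)    j = fromℤ-*⁺ m j
  fromℤ-* -[1+ m ] j = begin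
    fromℤ (-[1+ m ] ℤ.* j)         ≡⟨ ≡.cong fromℤ (ℤₚ.neg-distribˡ-* (+ suc m) j) ⟨
    fromℤ (ℤ.- (+ suc m ℤ.* j))    ≈⟨ fromℤ-neg (+ suc m ℤ.* j) ⟩
    - fromℤ (+ suc m ℤ.* j)        ≈⟨ -‿cong (fromℤ-*⁺ (suc m) j) ⟩
    - (fromℕ′ (suc m) * fromℤ j)   ≈⟨ -‿distribˡ-* _ _ ⟩
    - fromℕ′ (suc m) * fromℤ j     ∎

  private
    morphism : CommutativeRing.rawRing ℤₚ.+-*-commutativeRing -Raw-AlmostCommutative⟶ fromCommutativeRing R
    morphism = record
      { ⟦_⟧ = fromℤ ; +-homo = fromℤ-+ ; *-homo = fromℤ-* ; -‿homo = fromℤ-neg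
      ; 0-homo = refl ; 1-homo = refl }

  module Solver = Algebra.Solver.Ring (CommutativeRing.rawRing ℤₚ.+-*-commutativeRing)
    (fromCommutativeRing R) morphism
    (λ i j → Data.Maybe.map (λ eq → reflexive (≡.cong fromℤ eq)) (dec⇒weaklyDec ℤ._≟_ i j))

  pow : Carrier → ℕ → Carrier
  pow x zero    = 1#
  pow x (suc n) = x * pow x n

  pow-cong : ∀ {x y} n → x ≈ y → pow x n ≈ pow y n
  pow-cong zero    x≈y = refl
  pow-cong (suc n) x≈y = *-cong x≈y (pow-cong n x≈y)

  pow-+ : ∀ x m n → pow x (m ℕ.+ n) ≈ pow x m * pow x n
  pow-+ x zero    n = sym (*-identityˡ _)
  pow-+ x (suc m) n = trans (*-congˡ (pow-+ x m n)) (sym (*-assoc _ _ _))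

  pow-* : ∀ x y n → pow (x * y) n ≈ pow x n * pow y n
  pow-* x y zero    = sym (*-identityˡ _)
  pow-* x y (suc n) = trans (*-congˡ (pow-* x y n))
    (Solver.solve 4 (λ a b c d → (a :* b) :* (c :* d) := (a :* c) :* (b :* d)) refl x y (pow x n) (pow y n))
    where open Solver using (_:*_; _:=_)

-- Sums over finite supports

record DecEq (I : Set) : Set where
  constructor decEq
  infix 4 _==_
  field _==_ : DecidableEquality I
open DecEq {{...}} public

instance
  DecEq-ℕ : DecEq ℕ
  DecEq-ℕ = decEq ℕ._≟_

  DecEq-ℤ : DecEq ℤ
  DecEq-ℤ = decEq ℤ._≟_

  DecEq-× : {I J : Set} {{_ : DecEq I}} {{_ : DecEq J}} → DecEq (I × J)
  DecEq-× = decEq (×ₚ.≡-dec _==_ _==_)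

  DecEq-⊎ : {I J : Set} {{_ : DecEq I}} {{_ : DecEq J}} → DecEq (I ⊎ J)
  DecEq-⊎ = decEq (⊎ₚ.≡-dec _==_ _==_)

module Summation (R : CommutativeRing 0ℓ 0ℓ) where
  open CommutativeRing R
  open RingTools R using (module Solver)
  open Algebra.Properties.Ring ring using (-‿+-comm; -0#≈0#; -‿distribˡ-*)
  open import Relation.Binary.Reasoning.Setoid setoid

  +-interchange : ∀ a b c d → (a + b) + (c + d) ≈ (a + c) + (b + d)
  +-interchange = solve 4 (λ a b c d → (a :+ b) :+ (c :+ d) := (a :+ c) :+ (b :+ d)) refl
    where open Solver

  ΣL : {I : Set} → (I → Carrier) → List I → Carrier
  ΣL f []       = 0#
  ΣL f (x ∷ xs) = f x + ΣL f xs

  module _ {I : Set} where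
    ΣL-cong∈ : {f g : I → Carrier} (xs : List I) → (∀ {i} → i ∈ xs → f i ≈ g i) → ΣL f xs ≈ ΣL g xs
    ΣL-cong∈ []       f≈g = refl
    ΣL-cong∈ (x ∷ xs) f≈g = +-cong (f≈g (here ≡.refl)) (ΣL-cong∈ xs (f≈g ∘ there))

    ΣL-cong : {f g : I → Carrier} (xs : List I) → (∀ i → f i ≈ g i) → ΣL f xs ≈ ΣL g xs
    ΣL-cong xs f≈g = ΣL-cong∈ xs (λ {i} _ → f≈g i)

    ΣL-zero : {f : I → Carrier} (xs : List I) → (∀ {i} → i ∈ xs → f i ≈ 0#) → ΣL f xs ≈ 0#
    ΣL-zero []       f≈0 = refl
    ΣL-zero (x ∷ xs) f≈0 = trans (+-cong (f≈0 (here ≡.refl)) (ΣL-zero xs (f≈0 ∘ there))) (+-identityʳ _)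

    ΣL-+ : (f g : I → Carrier) (xs : List I) → ΣL (λ i → f i + g i) xs ≈ ΣL f xs + ΣL g xs
    ΣL-+ f g []       = sym (+-identityʳ _)
    ΣL-+ f g (x ∷ xs) = trans (+-congˡ (ΣL-+ f g xs)) (+-interchange _ _ _ _)

    ΣL-*ˡ : (c : Carrier) (f : I → Carrier) (xs : List I) → ΣL (λ i → c * f i) xs ≈ c * ΣL f xs
    ΣL-*ˡ c f []       = sym (zeroʳ c)
    ΣL-*ˡ c f (x ∷ xs) = trans (+-congˡ (ΣL-*ˡ c f xs)) (sym (distribˡ _ _ _))

    ΣL-*ʳ : (c : Carrier) (f : I → Carrier) (xs : List I) → ΣL (λ i → f i * c) xs ≈ ΣL f xs * c
    ΣL-*ʳ c f []       = sym (zeroˡ c)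
    ΣL-*ʳ c f (x ∷ xs) = trans (+-congˡ (ΣL-*ʳ c f xs)) (sym (distribʳ _ _ _))

    ΣL-++ : (f : I → Carrier) (xs ys : List I) → ΣL f (xs ++ ys) ≈ ΣL f xs + ΣL f ys
    ΣL-++ f []       ys = sym (+-identityˡ _)
    ΣL-++ f (x ∷ xs) ys = trans (+-congˡ (ΣL-++ f xs ys)) (sym (+-assoc _ _ _))

  module _ {I J : Set} where
    ΣL-map : (f : J → Carrier) (φ : I → J) (xs : List I) → ΣL f (map φ xs) ≡ ΣL (f ∘ φ) xs
    ΣL-map f φ []       = ≡.refl
    ΣL-map f φ (x ∷ xs) = ≡.cong (λ s → f (φ x) + s) (ΣL-map f φ xs)

    ΣL-swap : (f : I → J → Carrier) (xs : List I) (ys : List J) →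
              ΣL (λ i → ΣL (f i) ys) xs ≈ ΣL (λ j → ΣL (λ i → f i j) xs) ys
    ΣL-swap f []       ys = sym (ΣL-zero ys (λ _ → refl))
    ΣL-swap f (x ∷ xs) ys = trans (+-congˡ (ΣL-swap f xs ys)) (sym (ΣL-+ (f x) _ ys))

  module _ {I J : Set} where
    ΣL-× : (f : I × J → Carrier) (xs : List I) (ys : List J) →
           ΣL f (cartesianProduct xs ys) ≈ ΣL (λ i → ΣL (λ j → f (i , j)) ys) xs
    ΣL-× f []       ys = refl
    ΣL-× f (x ∷ xs) ys = trans (ΣL-++ f (map (x ,_) ys) _)
                               (+-cong (reflexive (ΣL-map f (x ,_) ys)) (ΣL-× f xs ys))

  pick : {P : Set} → Dec P → Carrier → Carrier
  pick (yes _) a = a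
  pick (no  _) a = 0#

  pick-yes : {P : Set} (d : Dec P) {a : Carrier} → P → pick d a ≈ a
  pick-yes (yes _) p = refl
  pick-yes (no ¬p) p = ⊥-elim (¬p p)

  pick-no : {P : Set} (d : Dec P) {a : Carrier} → ¬ P → pick d a ≈ 0#
  pick-no (yes p) ¬p = ⊥-elim (¬p p)
  pick-no (no _)  ¬p = refl

  pick-⇔ : {P Q : Set} (d : Dec P) (e : Dec Q) {a b : Carrier} → (P → Q) → (Q → P) → (P → a ≈ b) → pick d a ≈ pick e b
  pick-⇔ (yes p) e pq qp ab = trans (ab p) (sym (pick-yes e (pq p)))
  pick-⇔ (no ¬p) e pq qp ab = sym (pick-no e (¬p ∘ qp))

  pick-*ˡ : {P : Set} (d : Dec P) (c a : Carrier) → pick d (c * a) ≈ c * pick d a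
  pick-*ˡ (yes _) c a = refl
  pick-*ˡ (no  _) c a = sym (zeroʳ c)

  -- f vanishes outside a finite set, and s is the sum of its values over any finite set
  -- containing the support.
  record HasSum {I : Set} (f : I → Carrier) (s : Carrier) : Set where
    constructor hasSum
    field
      supp   : List I
      unique : Unique supp
      vanish : ∀ i → i ∉ supp → f i ≈ 0#
      total  : ΣL f supp ≈ s

  open HasSum

  module _ {I : Set} {{_ : DecEq I}} where
    open import Data.List.Membership.DecPropositional {A = I} _==_ using (_∈?_)

    ΣL-pick : (g : I → Carrier) (x : I) (ys : List I) → Unique ys → (x ∉ ys → g x ≈ 0#) →
              ΣL (λ y → pick (x == y) (g x)) ys ≈ g x
    ΣL-pick g x []       _          out = sym (out λ ())
    ΣL-pick g x (y ∷ ys) (y∉ ∷ uys) out with x == y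
    ... | yes ≡.refl = trans (+-congˡ (ΣL-zero ys λ {z} z∈ → pick-no (x == z) (λ x≡z → All.lookup y∉ z∈ x≡z)))
                             (+-identityʳ _)
    ... | no x≢y     = trans (+-identityˡ _)
                             (ΣL-pick g x ys uys (λ x∉ → out λ { (here p) → x≢y p ; (there q) → x∉ q }))

    ΣL-pickʳ : (g : I → Carrier) (x : I) (ys : List I) → Unique ys → (x ∉ ys → g x ≈ 0#) →
               ΣL (λ y → pick (y == x) (g y)) ys ≈ g x
    ΣL-pickʳ g x ys uys out = trans
      (ΣL-cong ys (λ y → pick-⇔ (y == x) (x == y) ≡.sym ≡.sym (λ y≡x → reflexive (≡.cong g y≡x))))
      (ΣL-pick g x ys uys out)

    -- Both sides are the double sum over `xs` and `ys` of `f` on the diagonal; an index missing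
    -- from one list contributes 0 in the other.
    ΣL-covering : (f : I → Carrier) (xs ys : List I) → Unique xs → Unique ys →
                  (∀ i → i ∉ xs → f i ≈ 0#) → (∀ i → i ∉ ys → f i ≈ 0#) → ΣL f xs ≈ ΣL f ys
    ΣL-covering f xs ys uxs uys vx vy = begin
      ΣL f xs                                             ≈⟨ ΣL-cong xs (λ x → ΣL-pick f x ys uys (vy x)) ⟨
      ΣL (λ x → ΣL (λ y → pick (x == y) (f x)) ys) xs     ≈⟨ ΣL-swap _ xs ys ⟩
      ΣL (λ y → ΣL (λ x → pick (x == y) (f x)) xs) ys     ≈⟨ ΣL-cong ys (λ y → ΣL-pickʳ f y xs uxs (vx y)) ⟩
      ΣL f ys                                             ∎

    HasSum-unique : {f : I → Carrier} {s s′ : Carrier} → HasSum f s → HasSum f s′ → s ≈ s′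
    HasSum-unique h h′ = trans (sym (total h)) (trans
      (ΣL-covering _ (supp h) (supp h′) (unique h) (unique h′) (vanish h) (vanish h′)) (total h′))

    fromSupport : (f : I → Carrier) (xs : List I) → (∀ i → i ∉ xs → f i ≈ 0#) →
                  HasSum f (ΣL f (deduplicate _==_ xs))
    fromSupport f xs v = hasSum _ (DUₚ.deduplicate-! _==_ xs)
      (λ i i∉ → v i (i∉ ∘ ∈ₚ.∈-deduplicate⁺ _==_)) refl

    HasSum-pick : (a : I) (c : Carrier) → HasSum (λ i → pick (i == a) c) c
    HasSum-pick a c = hasSum (a ∷ []) ([] ∷ [])
      (λ i i∉ → pick-no (i == a) (λ i≡a → i∉ (here i≡a)))
      (trans (+-identityʳ _) (pick-yes (a == a) ≡.refl))

    HasSum-+ : {f g : I → Carrier} {s r : Carrier} → HasSum f s → HasSum g r → HasSum (λ i → f i + g i) (s + r)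
    HasSum-+ {f} {g} {s} {r} hf hg = hasSum zs uzs
      (λ i i∉ → trans (+-cong (vf i i∉) (vg i i∉)) (+-identityʳ _))
      (trans (ΣL-+ f g zs) (+-cong
        (trans (ΣL-covering f zs _ uzs (unique hf) vf (vanish hf)) (total hf))
        (trans (ΣL-covering g zs _ uzs (unique hg) vg (vanish hg)) (total hg))))
      where
      zs  = deduplicate _==_ (supp hf ++ supp hg)
      uzs = DUₚ.deduplicate-! _==_ (supp hf ++ supp hg)
      vf : ∀ i → i ∉ zs → f i ≈ 0#
      vf i i∉ = vanish hf i (λ i∈ → i∉ (∈ₚ.∈-deduplicate⁺ _==_ (∈ₚ.∈-++⁺ˡ i∈)))
      vg : ∀ i → i ∉ zs → g i ≈ 0#
      vg i i∉ = vanish hg i (λ i∈ → i∉ (∈ₚ.∈-deduplicate⁺ _==_ (∈ₚ.∈-++⁺ʳ (supp hf) i∈)))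

  module _ {I : Set} where
    HasSum-cong : {f g : I → Carrier} {s : Carrier} → (∀ i → f i ≈ g i) → HasSum f s → HasSum g s
    HasSum-cong f≈g h = hasSum (supp h) (unique h)
      (λ i i∉ → trans (sym (f≈g i)) (vanish h i i∉))
      (trans (ΣL-cong (supp h) (λ i → sym (f≈g i))) (total h))

    HasSum-resp : {f : I → Carrier} {s s′ : Carrier} → s ≈ s′ → HasSum f s → HasSum f s′
    HasSum-resp s≈ h = hasSum (supp h) (unique h) (vanish h) (trans (total h) s≈)

    HasSum-0 : {f : I → Carrier} → (∀ i → f i ≈ 0#) → HasSum f 0#
    HasSum-0 f≈0 = hasSum [] [] (λ i _ → f≈0 i) refl

    HasSum-*ˡ : (c : Carrier) {f : I → Carrier} {s : Carrier} → HasSum f s → HasSum (λ i → c * f i) (c * s)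
    HasSum-*ˡ c h = hasSum (supp h) (unique h)
      (λ i i∉ → trans (*-congˡ (vanish h i i∉)) (zeroʳ c))
      (trans (ΣL-*ˡ c _ (supp h)) (*-congˡ (total h)))

    HasSum-neg : {f : I → Carrier} {s : Carrier} → HasSum f s → HasSum (λ i → - f i) (- s)
    HasSum-neg h = HasSum-resp (neg₁ _) (HasSum-cong (λ i → neg₁ _) (HasSum-*ˡ (- 1#) h))
      where
      neg₁ : ∀ x → - 1# * x ≈ - x
      neg₁ x = trans (sym (-‿distribˡ-* 1# x)) (-‿cong (*-identityˡ x))

  module _ {I J : Set} where
    -- `φ` may miss indices at which `g` vanishes. This serves for the diagonal of ℤ × ℤ, for the
    -- two quadrants and for the two cosets of `rot`.
    HasSum-push : (φ : I → J) → (∀ {i i′} → φ i ≡ φ i′ → i ≡ i′) → {g : J → Carrier} →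
                  (∀ j → (∃ λ i → j ≡ φ i) ⊎ (g j ≈ 0#)) → {s : Carrier} →
                  HasSum (g ∘ φ) s → HasSum g s
    HasSum-push φ inj {g} image h = hasSum (map φ (supp h)) (Uₚ.map⁺ inj (unique h)) v
      (trans (reflexive (ΣL-map g φ (supp h))) (total h))
      where
      v : ∀ j → j ∉ map φ (supp h) → g j ≈ 0#
      v j j∉ with image j
      ... | inj₂ g≈0          = g≈0
      ... | inj₁ (i , ≡.refl) = vanish h i (λ i∈ → j∉ (∈ₚ.∈-map⁺ φ i∈))

    HasSum-pull : (φ : I → J) (ψ : J → I) → (∀ i → ψ (φ i) ≡ i) → (∀ j → φ (ψ j) ≡ j) →
                  {g : J → Carrier} {s : Carrier} → HasSum g s → HasSum (g ∘ φ) s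
    HasSum-pull φ ψ ψφ φψ {g} h = hasSum (map ψ (supp h))
      (Uₚ.map⁺ (λ {j} {j′} eq → ≡.trans (≡.sym (φψ j)) (≡.trans (≡.cong φ eq) (φψ j′))) (unique h))
      (λ i i∉ → vanish h (φ i) (λ φi∈ → i∉ (≡.subst (_∈ map ψ (supp h)) (ψφ i) (∈ₚ.∈-map⁺ ψ φi∈))))
      (trans (reflexive (ΣL-map′ (supp h))) (total h))
      where
      ΣL-map′ : ∀ js → ΣL (g ∘ φ) (map ψ js) ≡ ΣL g js
      ΣL-map′ []       = ≡.refl
      ΣL-map′ (j ∷ js) = ≡.cong₂ _+_ (≡.cong g (φψ j)) (ΣL-map′ js)

    HasSum-bij : (φ : I → J) (ψ : J → I) → (∀ i → ψ (φ i) ≡ i) → (∀ j → φ (ψ j) ≡ j) →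
                 {g : J → Carrier} {s : Carrier} → HasSum (g ∘ φ) s → HasSum g s
    HasSum-bij φ ψ ψφ φψ h = HasSum-push φ
      (λ {i} {i′} eq → ≡.trans (≡.sym (ψφ i)) (≡.trans (≡.cong ψ eq) (ψφ i′)))
      (λ j → inj₁ (ψ j , ≡.sym (φψ j))) h

  module _ {I J : Set} {{_ : DecEq I}} where
    open import Data.List.Membership.DecPropositional {A = I} _==_ using (_∈?_)

    HasSum-× : {f : I → Carrier} {g : J → Carrier} {s r : Carrier} → HasSum f s → HasSum g r →
               HasSum (λ ij → f (proj₁ ij) * g (proj₂ ij)) (s * r)
    HasSum-× {f} {g} hf hg = hasSum (cartesianProduct (supp hf) (supp hg))
      (Uₚ.cartesianProduct⁺ (unique hf) (unique hg)) v
      (begin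
        ΣL _ (cartesianProduct (supp hf) (supp hg))                ≈⟨ ΣL-× _ (supp hf) (supp hg) ⟩
        ΣL (λ i → ΣL (λ j → f i * g j) (supp hg)) (supp hf)        ≈⟨ ΣL-cong (supp hf) (λ i → ΣL-*ˡ (f i) g (supp hg)) ⟩
        ΣL (λ i → f i * ΣL g (supp hg)) (supp hf)                  ≈⟨ ΣL-*ʳ _ f (supp hf) ⟩
        ΣL f (supp hf) * ΣL g (supp hg)                            ≈⟨ *-cong (total hf) (total hg) ⟩
        _ ∎)
      where
      v : ∀ ij → ij ∉ cartesianProduct (supp hf) (supp hg) → f (proj₁ ij) * g (proj₂ ij) ≈ 0#
      v (i , j) ij∉ with i ∈? supp hf
      ... | no i∉  = trans (*-congʳ (vanish hf i i∉)) (zeroˡ _)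
      ... | yes i∈ = trans (*-congˡ (vanish hg j (λ j∈ → ij∉ (∈ₚ.∈-cartesianProduct⁺ i∈ j∈)))) (zeroʳ _)

  module _ {I J : Set} where
    HasSum-⊎ : {f : I ⊎ J → Carrier} {s r : Carrier} → HasSum (f ∘ inj₁) s → HasSum (f ∘ inj₂) r → HasSum f (s + r)
    HasSum-⊎ {f} hf hg = hasSum (map inj₁ (supp hf) ++ map inj₂ (supp hg))
      (Uₚ.++⁺ (Uₚ.map⁺ ⊎ₚ.inj₁-injective (unique hf)) (Uₚ.map⁺ ⊎ₚ.inj₂-injective (unique hg)) disj) v
      (trans (ΣL-++ f (map inj₁ (supp hf)) _) (+-cong
        (trans (reflexive (ΣL-map f inj₁ (supp hf))) (total hf))
        (trans (reflexive (ΣL-map f inj₂ (supp hg))) (total hg))))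
      where
      disj : ∀ {k} → k ∈ map inj₁ (supp hf) × k ∈ map inj₂ (supp hg) → _
      disj (p , q) with ∈ₚ.∈-map⁻ inj₁ p | ∈ₚ.∈-map⁻ inj₂ q
      ... | _ , _ , ≡.refl | _ , _ , ()
      v : ∀ k → k ∉ map inj₁ (supp hf) ++ map inj₂ (supp hg) → f k ≈ 0#
      v (inj₁ i) k∉ = vanish hf i (λ i∈ → k∉ (∈ₚ.∈-++⁺ˡ (∈ₚ.∈-map⁺ inj₁ i∈)))
      v (inj₂ j) k∉ = vanish hg j (λ j∈ → k∉ (∈ₚ.∈-++⁺ʳ (map inj₁ (supp hf)) (∈ₚ.∈-map⁺ inj₂ j∈)))

  module _ {I J : Set} {{_ : DecEq I}} {{_ : DecEq J}} where
    -- Fubini, in the form that computes one sum in two orders: the fibre sums are supplied as data,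
    -- and over an index outside the support they are 0 by uniqueness.
    HasSum-fibre : {F : I × J → Carrier} {s : Carrier} {g : I → Carrier} →
                   HasSum F s → (∀ i → HasSum (λ j → F (i , j)) (g i)) → HasSum g s
    HasSum-fibre {F} {s} {g} hF hg = hasSum xs uxs vg (begin
      ΣL g xs                              ≈⟨ ΣL-cong xs (λ i → trans (sym (total (hg i)))
                                                (ΣL-covering _ _ ys (unique (hg i)) uys (vanish (hg i)) (vF₂ i))) ⟩
      ΣL (λ i → ΣL (λ j → F (i , j)) ys) xs ≈⟨ ΣL-× F xs ys ⟨
      ΣL F (cartesianProduct xs ys)        ≈⟨ ΣL-covering F _ _ (Uₚ.cartesianProduct⁺ uxs uys) (unique hF)
                                                vF (vanish hF) ⟩
      ΣL F (supp hF)                       ≈⟨ total hF ⟩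
      s                                    ∎)
      where
      xs  = deduplicate _==_ (map proj₁ (supp hF))
      ys  = deduplicate _==_ (map proj₂ (supp hF))
      uxs = DUₚ.deduplicate-! _==_ (map proj₁ (supp hF))
      uys = DUₚ.deduplicate-! _==_ (map proj₂ (supp hF))
      vF₁ : ∀ i → i ∉ xs → ∀ j → F (i , j) ≈ 0#
      vF₁ i i∉ j = vanish hF (i , j) (λ ij∈ → i∉ (∈ₚ.∈-deduplicate⁺ _==_ (∈ₚ.∈-map⁺ proj₁ ij∈)))
      vF₂ : ∀ i j → j ∉ ys → F (i , j) ≈ 0#
      vF₂ i j j∉ = vanish hF (i , j) (λ ij∈ → j∉ (∈ₚ.∈-deduplicate⁺ _==_ (∈ₚ.∈-map⁺ proj₂ ij∈)))
      vg : ∀ i → i ∉ xs → g i ≈ 0#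
      vg i i∉ = HasSum-unique (hg i) (HasSum-0 (vF₁ i i∉))
      vF : ∀ ij → ij ∉ cartesianProduct xs ys → F ij ≈ 0#
      vF (i , j) ij∉ = vanish hF (i , j) (λ ij∈ → ij∉ (∈ₚ.∈-cartesianProduct⁺
        (∈ₚ.∈-deduplicate⁺ _==_ (∈ₚ.∈-map⁺ proj₁ ij∈)) (∈ₚ.∈-deduplicate⁺ _==_ (∈ₚ.∈-map⁺ proj₂ ij∈))))

  module _ {I J : Set} {{_ : DecEq I}} {{_ : DecEq J}} where
    HasSum-fibreʳ : {F : I × J → Carrier} {s : Carrier} {g : J → Carrier} →
                    HasSum F s → (∀ j → HasSum (λ i → F (i , j)) (g j)) → HasSum g s
    HasSum-fibreʳ hF hg = HasSum-fibre (HasSum-bij (λ (i , j) → j , i) (λ (j , i) → i , j)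
      (λ _ → ≡.refl) (λ _ → ≡.refl) hF) hg

-- Truncated power series

-- Power series over R, with equality tested on the coefficients up to D only.
module Series (D : ℕ) (R : CommutativeRing 0ℓ 0ℓ) where
  open CommutativeRing R
  open RingTools R using (module Solver)
  open Summation R using (ΣL; +-interchange)
  open Algebra.Properties.Ring ring using (-‿distribˡ-*)
  open import Relation.Binary.Reasoning.Setoid setoid

  -- Shifting `f` in the recursion avoids subtraction on indices and lets all ring laws be proved by
  -- induction on the degree.
  conv : (ℕ → Carrier) → (ℕ → Carrier) → ℕ → Carrier
  conv f g zero    = f 0 * g 0
  conv f g (suc n) = f 0 * g (suc n) + conv (f ∘ suc) g n

  conv-cong : ∀ {f f′ g g′} n → (∀ k → k ℕ.≤ n → f k ≈ f′ k) → (∀ k → k ℕ.≤ n → g k ≈ g′ k) →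
              conv f g n ≈ conv f′ g′ n
  conv-cong zero    f≈ g≈ = *-cong (f≈ 0 z≤n) (g≈ 0 z≤n)
  conv-cong (suc n) f≈ g≈ = +-cong (*-cong (f≈ 0 z≤n) (g≈ (suc n) ℕₚ.≤-refl))
    (conv-cong n (λ k k≤n → f≈ (suc k) (s≤s k≤n)) (λ k k≤n → g≈ k (ℕₚ.m≤n⇒m≤1+n k≤n)))

  conv-sucʳ : ∀ f g n → conv f g (suc n) ≈ conv f (g ∘ suc) n + f (suc n) * g 0
  conv-sucʳ f g zero    = refl
  conv-sucʳ f g (suc n) = trans (+-congˡ (conv-sucʳ (f ∘ suc) g n)) (sym (+-assoc _ _ _))

  conv-comm : ∀ f g n → conv f g n ≈ conv g f n
  conv-comm f g zero    = *-comm _ _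
  conv-comm f g (suc n) = begin
    f 0 * g (suc n) + conv (f ∘ suc) g n   ≈⟨ +-cong (*-comm _ _) (conv-comm (f ∘ suc) g n) ⟩
    g (suc n) * f 0 + conv g (f ∘ suc) n   ≈⟨ +-comm _ _ ⟩
    conv g (f ∘ suc) n + g (suc n) * f 0   ≈⟨ conv-sucʳ g f n ⟨
    conv g f (suc n)                       ∎

  conv-+ˡ : ∀ f f′ g n → conv (λ k → f k + f′ k) g n ≈ conv f g n + conv f′ g n
  conv-+ˡ f f′ g zero    = distribʳ _ _ _
  conv-+ˡ f f′ g (suc n) = trans (+-cong (distribʳ _ _ _) (conv-+ˡ (f ∘ suc) (f′ ∘ suc) g n)) (+-interchange _ _ _ _)

  conv-*ˡ : ∀ c f g n → conv (λ k → c * f k) g n ≈ c * conv f g n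
  conv-*ˡ c f g zero    = *-assoc _ _ _
  conv-*ˡ c f g (suc n) = trans (+-cong (*-assoc _ _ _) (conv-*ˡ c (f ∘ suc) g n)) (sym (distribˡ _ _ _))

  conv-assoc : ∀ f g h n → conv (conv f g) h n ≈ conv f (conv g h) n
  conv-assoc f g h zero    = *-assoc _ _ _
  conv-assoc f g h (suc n) = begin
    f 0 * g 0 * h (suc n) + conv (λ k → f 0 * g (suc k) + conv (f ∘ suc) g k) h n
      ≈⟨ +-cong (*-assoc _ _ _) (conv-+ˡ (λ k → f 0 * g (suc k)) (conv (f ∘ suc) g) h n) ⟩
    f 0 * (g 0 * h (suc n)) + (conv (λ k → f 0 * g (suc k)) h n + conv (conv (f ∘ suc) g) h n)
      ≈⟨ +-congˡ (+-cong (conv-*ˡ (f 0) (g ∘ suc) h n) (conv-assoc (f ∘ suc) g h n)) ⟩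
    f 0 * (g 0 * h (suc n)) + (f 0 * conv (g ∘ suc) h n + conv (f ∘ suc) (conv g h) n)
      ≈⟨ +-assoc _ _ _ ⟨
    f 0 * (g 0 * h (suc n)) + f 0 * conv (g ∘ suc) h n + conv (f ∘ suc) (conv g h) n
      ≈⟨ +-congʳ (distribˡ _ _ _) ⟨
    conv f (conv g h) (suc n) ∎

  conv-0ˡ : ∀ g n → conv (λ _ → 0#) g n ≈ 0#
  conv-0ˡ g zero    = zeroˡ _
  conv-0ˡ g (suc n) = trans (+-cong (zeroˡ _) (conv-0ˡ g n)) (+-identityʳ _)

  const′ : Carrier → ℕ → Carrier
  const′ c zero    = c
  const′ c (suc n) = 0#

  conv-const : ∀ c g n → conv (const′ c) g n ≈ c * g n
  conv-const c g zero    = refl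
  conv-const c g (suc n) = trans (+-congˡ (conv-0ˡ g n)) (+-identityʳ _)

  infix 4 _≋_
  _≋_ : (ℕ → Carrier) → (ℕ → Carrier) → Set
  f ≋ g = ∀ k → k ℕ.≤ D → f k ≈ g k

  seriesRing : CommutativeRing 0ℓ 0ℓ
  seriesRing = record
    { Carrier = ℕ → Carrier
    ; _≈_ = _≋_
    ; _+_ = λ f g k → f k + g k
    ; _*_ = conv
    ; -_  = λ f k → - f k
    ; 0#  = λ _ → 0#
    ; 1#  = const′ 1#
    ; isCommutativeRing = record
      { isRing = record
        { +-isAbelianGroup = record
          { isGroup = record
            { isMonoid = record
              { isSemigroup = record
                { isMagma = record
                  { isEquivalence = record
                    { refl  = λ k _ → refl
                    ; sym   = λ p k k≤ → sym (p k k≤)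
                    ; trans = λ p q k k≤ → trans (p k k≤) (q k k≤) }
                  ; ∙-cong = λ p q k k≤ → +-cong (p k k≤) (q k k≤) }
                ; assoc = λ _ _ _ _ _ → +-assoc _ _ _ }
              ; identity = (λ _ _ _ → +-identityˡ _) , (λ _ _ _ → +-identityʳ _) }
            ; inverse = (λ _ _ _ → -‿inverseˡ _) , (λ _ _ _ → -‿inverseʳ _)
            ; ⁻¹-cong = λ p k k≤ → -‿cong (p k k≤) }
          ; comm = λ _ _ _ _ → +-comm _ _ }
        ; *-cong = λ p q k k≤ → conv-cong k (λ j j≤ → p j (ℕₚ.≤-trans j≤ k≤)) (λ j j≤ → q j (ℕₚ.≤-trans j≤ k≤))
        ; *-assoc = λ f g h k _ → conv-assoc f g h k
        ; *-identity = (λ f k _ → identˡ f k) , (λ f k _ → trans (conv-comm f _ k) (identˡ f k))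
        ; distrib = (λ f g h k _ → trans (conv-comm f _ k) (trans (conv-+ˡ g h f k)
                                     (+-cong (conv-comm g f k) (conv-comm h f k))))
                  , (λ f g h k _ → conv-+ˡ g h f k) }
      ; *-comm = λ f g k _ → conv-comm f g k } }
    where
    identˡ : ∀ f n → conv (const′ 1#) f n ≈ f n
    identˡ f n = trans (conv-const 1# f n) (*-identityˡ _)

  const-cong : ∀ {a b} → a ≈ b → const′ a ≋ const′ b
  const-cong a≈b zero    _ = a≈b
  const-cong a≈b (suc n) _ = refl

  const-+ : ∀ a b → const′ (a + b) ≋ (λ k → const′ a k + const′ b k)
  const-+ a b zero    _ = refl
  const-+ a b (suc n) _ = sym (+-identityʳ _)

  const-* : ∀ a b → const′ (a * b) ≋ conv (const′ a) (const′ b)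
  const-* a b n _ = sym (trans (conv-const a (const′ b) n) (lem n))
    where
    lem : ∀ n → a * const′ b n ≈ const′ (a * b) n
    lem zero    = refl
    lem (suc n) = zeroʳ a

  coeff-ΣL : {I : Set} (F : I → ℕ → Carrier) (xs : List I) (k : ℕ) →
             Summation.ΣL seriesRing F xs k ≈ ΣL (λ i → F i k) xs
  coeff-ΣL F []       k = refl
  coeff-ΣL F (x ∷ xs) k = +-congˡ (coeff-ΣL F xs k)

  coeff-HasSum : {I : Set} {F : I → ℕ → Carrier} {s : ℕ → Carrier} → Summation.HasSum seriesRing F s →
                 ∀ k → k ℕ.≤ D → Summation.HasSum R (λ i → F i k) (s k)
  coeff-HasSum h k k≤ = Summation.hasSum supp unique (λ i i∉ → vanish i i∉ k k≤)
    (trans (sym (coeff-ΣL _ supp k)) (total k k≤))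
    where open Summation.HasSum h

  shiftₛ : ℕ → (ℕ → Carrier) → ℕ → Carrier
  shiftₛ zero    f n       = f n
  shiftₛ (suc j) f zero    = 0#
  shiftₛ (suc j) f (suc n) = shiftₛ j f n

  conv-shiftˡ : ∀ j f g n → conv (shiftₛ j f) g n ≈ shiftₛ j (conv f g) n
  conv-shiftˡ zero    f g n       = refl
  conv-shiftˡ (suc j) f g zero    = zeroˡ _
  conv-shiftˡ (suc j) f g (suc n) = trans (+-congʳ (zeroˡ _)) (trans (+-identityˡ _) (conv-shiftˡ j f g n))

  shiftₛ-cong : ∀ j {f g} n → (∀ k → f k ≈ g k) → shiftₛ j f n ≈ shiftₛ j g n
  shiftₛ-cong zero    n       f≈g = f≈g n
  shiftₛ-cong (suc j) zero    f≈g = refl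
  shiftₛ-cong (suc j) (suc n) f≈g = shiftₛ-cong j n f≈g

  conv-shiftʳ : ∀ j f g n → conv f (shiftₛ j g) n ≈ shiftₛ j (conv f g) n
  conv-shiftʳ j f g n = trans (conv-comm f _ n) (trans (conv-shiftˡ j g f n) (shiftₛ-cong j n (conv-comm g f)))

  shiftₛ-< : ∀ j f n → n ℕ.< j → shiftₛ j f n ≡ 0#
  shiftₛ-< (suc j) f zero    _         = ≡.refl
  shiftₛ-< (suc j) f (suc n) (s≤s n<j) = shiftₛ-< j f n n<j

  shiftₛ-+ : ∀ j f n → shiftₛ j f (j ℕ.+ n) ≡ f n
  shiftₛ-+ zero    f n = ≡.refl
  shiftₛ-+ (suc j) f n = shiftₛ-+ j f n

  shiftₛ-shiftₛ : ∀ j k f n → shiftₛ j (shiftₛ k f) n ≡ shiftₛ (j ℕ.+ k) f n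
  shiftₛ-shiftₛ zero    k f n       = ≡.refl
  shiftₛ-shiftₛ (suc j) k f zero    = ≡.refl
  shiftₛ-shiftₛ (suc j) k f (suc n) = shiftₛ-shiftₛ j k f n

  mono : ℕ → ℕ → Carrier
  mono j = shiftₛ j (const′ 1#)

  conv-mono : ∀ j f n → conv (mono j) f n ≈ shiftₛ j f n
  conv-mono j f n = trans (conv-shiftˡ j (const′ 1#) f n)
    (shiftₛ-cong j n (λ k → trans (conv-const 1# f k) (*-identityˡ _)))

  mono-+ : ∀ j k n → mono (j ℕ.+ k) n ≈ conv (mono j) (mono k) n
  mono-+ j k n = sym (trans (conv-mono j (mono k) n) (reflexive (shiftₛ-shiftₛ j k (const′ 1#) n)))

  -- The bound by `D` makes the condition invariant under `_≋_`, which sees only those coefficients.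
  Ord : ℕ → (ℕ → Carrier) → Set
  Ord j f = ∀ n → n ℕ.< j → n ℕ.≤ D → f n ≈ 0#

  Ord-shift : ∀ j {f} → Ord j f → ∀ n → n ℕ.≤ D → f n ≈ shiftₛ j (λ k → f (j ℕ.+ k)) n
  Ord-shift j {f} o n n≤D with ℕₚ.<-≤-connex n j
  ... | inj₁ n<j = trans (o n n<j n≤D) (reflexive (≡.sym (shiftₛ-< j _ n n<j)))
  ... | inj₂ j≤n = reflexive (≡.trans (≡.cong f (≡.sym eq))
                     (≡.trans (≡.sym (shiftₛ-+ j (λ k → f (j ℕ.+ k)) (n ℕ.∸ j)))
                              (≡.cong (shiftₛ j (λ k → f (j ℕ.+ k))) eq)))
    where eq = ℕₚ.m+[n∸m]≡n j≤n

  module _ {j k f g} (ord-f : Ord j f) (ord-g : Ord k g) where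
    private
      f⁻ g⁻ : ℕ → Carrier
      f⁻ i = f (j ℕ.+ i)
      g⁻ i = g (k ℕ.+ i)

      -- Pulling the monomials of degree j and k out of the product yields both its order and its
      -- leading coefficient.
      split : ∀ n → n ℕ.≤ D → conv f g n ≈ shiftₛ (j ℕ.+ k) (conv f⁻ g⁻) n
      split n n≤D = begin
        conv f g n                            ≈⟨ conv-cong n (λ i i≤ → Ord-shift j ord-f i (ℕₚ.≤-trans i≤ n≤D))
                                                             (λ i i≤ → Ord-shift k ord-g i (ℕₚ.≤-trans i≤ n≤D)) ⟩
        conv (shiftₛ j f⁻) (shiftₛ k g⁻) n    ≈⟨ conv-shiftˡ j f⁻ _ n ⟩
        shiftₛ j (conv f⁻ (shiftₛ k g⁻)) n    ≈⟨ shiftₛ-cong j n (conv-shiftʳ k f⁻ g⁻) ⟩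
        shiftₛ j (shiftₛ k (conv f⁻ g⁻)) n    ≡⟨ shiftₛ-shiftₛ j k _ n ⟩
        shiftₛ (j ℕ.+ k) (conv f⁻ g⁻) n       ∎

    Ord-* : Ord (j ℕ.+ k) (conv f g)
    Ord-* n n< n≤D = trans (split n n≤D) (reflexive (shiftₛ-< (j ℕ.+ k) _ n n<))

    lead-* : j ℕ.+ k ℕ.≤ D → conv f g (j ℕ.+ k) ≈ f j * g k
    lead-* jk≤D = begin
      conv f g (j ℕ.+ k)                        ≈⟨ split (j ℕ.+ k) jk≤D ⟩
      shiftₛ (j ℕ.+ k) (conv f⁻ g⁻) (j ℕ.+ k)   ≡⟨ ≡.cong (shiftₛ (j ℕ.+ k) (conv f⁻ g⁻)) (ℕₚ.+-identityʳ (j ℕ.+ k)) ⟨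
      shiftₛ (j ℕ.+ k) (conv f⁻ g⁻) (j ℕ.+ k ℕ.+ 0) ≡⟨ shiftₛ-+ (j ℕ.+ k) _ 0 ⟩
      f (j ℕ.+ 0) * g (k ℕ.+ 0)                 ≡⟨ ≡.cong₂ (λ a b → f a * g b) (ℕₚ.+-identityʳ j) (ℕₚ.+-identityʳ k) ⟩
      f j * g k                                 ∎

  private
    module S = CommutativeRing seriesRing

  open RingTools seriesRing using (pow)

  Ord-0 : ∀ {f} → Ord 0 f
  Ord-0 n ()

  Ord-pow : ∀ {j f} → Ord j f → ∀ n → Ord (n ℕ.* j) (pow f n)
  Ord-pow ord-f zero    = Ord-0
  Ord-pow ord-f (suc n) = Ord-* ord-f (Ord-pow ord-f n)

  private
    geom : (ℕ → Carrier) → ℕ → (ℕ → Carrier)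
    geom x zero    = S.0#
    geom x (suc n) = S.1# S.+ x S.* geom x n

    geom-sum : ∀ x n → (S.1# S.- x) S.* geom x n S.+ pow x n S.≈ S.1#
    geom-sum x zero    = S.trans (S.+-congʳ (S.zeroʳ _)) (S.+-identityˡ _)
    geom-sum x (suc n) = S.trans (step x (geom x n) (pow x n)) (S.trans (S.+-congˡ (S.*-congˡ (geom-sum x n))) (fin x))
      where
      open RingTools.Solver seriesRing
      step : ∀ x g p → (S.1# S.- x) S.* (S.1# S.+ x S.* g) S.+ x S.* p S.≈ (S.1# S.- x) S.+ x S.* ((S.1# S.- x) S.* g S.+ p)
      step = solve 3 (λ x g p → (con (+ 1) :- x) :* (con (+ 1) :+ x :* g) :+ x :* p
                       := (con (+ 1) :- x) :+ x :* ((con (+ 1) :- x) :* g :+ p)) S.refl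
      fin : ∀ x → (S.1# S.- x) S.+ x S.* S.1# S.≈ S.1#
      fin = solve 1 (λ x → (con (+ 1) :- x) :+ x :* con (+ 1) := con (+ 1)) S.refl

  -- 1 - c f has no constant term, so its power D + 1 is 0 up to degree D and the geometric series
  -- for 1 / (c f) stops.
  series-inverse : ∀ {f c} → c * f 0 ≈ 1# → ∃ λ g → f S.* g S.≈ S.1#
  series-inverse {f} {c} cf₀ = const′ c S.* geom x (suc D) , (begin-S)
    where
    x : ℕ → Carrier
    x = S.1# S.- const′ c S.* f
    ox : Ord 1 x
    ox zero _ _ = trans (+-congˡ (-‿cong cf₀)) (-‿inverseʳ 1#)
    ox (suc n) (s≤s ())
    xᴰ : pow x (suc D) S.≈ S.0#
    xᴰ k k≤D = Ord-pow ox (suc D) k (ℕₚ.≤-trans (s≤s k≤D) (ℕₚ.≤-reflexive (≡.sym (ℕₚ.*-identityʳ (suc D))))) k≤D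
    rearrange : ∀ f c g → f S.* (c S.* g) S.≈ (S.1# S.- (S.1# S.- c S.* f)) S.* g
    rearrange = solve 3 (λ f c g → f :* (c :* g) := (con (+ 1) :- (con (+ 1) :- c :* f)) :* g) S.refl
      where open RingTools.Solver seriesRing
    begin-S : f S.* (const′ c S.* geom x (suc D)) S.≈ S.1#
    begin-S = S.trans (rearrange f (const′ c) (geom x (suc D))) (S.trans (S.sym (S.+-identityʳ _))
      (S.trans (S.+-congˡ (S.sym xᴰ)) (geom-sum x (suc D))))

-- Parity, the exponents of theta series, and a change of lattice

module Integers where
  open import Data.Integer using (_+_; _*_; _-_; -_; _≤_)
  open ≡.≡-Reasoning

  -- Both steps compare i with 1 + i, so one invertible recurrence serves in both directions.
  ℤ-ind : (P : ℤ → Set) → P (+ 0) → (∀ i → P i → P (+ 1 + i)) → (∀ i → P (+ 1 + i) → P i) → ∀ i → P i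
  ℤ-ind P p₀ up down (+ zero)       = p₀
  ℤ-ind P p₀ up down (+ suc n)      = up (+ n) (ℤ-ind P p₀ up down (+ n))
  ℤ-ind P p₀ up down -[1+ zero ]    = down -[1+ 0 ] p₀
  ℤ-ind P p₀ up down -[1+ suc n ]   = down -[1+ suc n ] (ℤ-ind P p₀ up down -[1+ n ])

  parity : ∀ i → ∃ λ j → (i ≡ j + j) ⊎ (i ≡ j + j - + 1)
  parity = ℤ-ind _ (+ 0 , inj₁ ≡.refl) up down
    where
    lem₁ : ∀ j → + 1 + (j + j) ≡ (+ 1 + j) + (+ 1 + j) - + 1
    lem₁ = solve-∀
    lem₂ : ∀ j → + 1 + (j + j - + 1) ≡ j + j
    lem₂ = solve-∀
    lem₃ : ∀ i j → + 1 + i ≡ j + j → i ≡ j + j - + 1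
    lem₃ i j eq = ≡.trans (aux i) (≡.cong (λ k → k - + 1) eq)
      where
      aux : ∀ i → i ≡ + 1 + i - + 1
      aux = solve-∀
    lem₄ : ∀ i j → + 1 + i ≡ j + j - + 1 → i ≡ (j - + 1) + (j - + 1)
    lem₄ i j eq = ≡.trans (aux i) (≡.trans (≡.cong (λ k → k - + 1) eq) (aux′ j))
      where
      aux : ∀ i → i ≡ + 1 + i - + 1
      aux = solve-∀
      aux′ : ∀ j → j + j - + 1 - + 1 ≡ (j - + 1) + (j - + 1)
      aux′ = solve-∀
    up : ∀ i → _ → _
    up i (j , inj₁ ≡.refl) = + 1 + j , inj₂ (lem₁ j)
    up i (j , inj₂ ≡.refl) = j , inj₁ (lem₂ j)
    down : ∀ i → _ → _
    down i (j , inj₁ eq) = j , inj₂ (lem₃ i j eq)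
    down i (j , inj₂ eq) = j - + 1 , inj₁ (lem₄ i j eq)

  double-injective : ∀ i j → i + i ≡ j + j → i ≡ j
  double-injective i j eq = ℤₚ.*-cancelˡ-≡ (+ 2) i j (≡.trans (lem i) (≡.trans eq (≡.sym (lem j))))
    where
    lem : ∀ i → + 2 * i ≡ i + i
    lem = solve-∀

  even≢odd : ∀ i j → i + i ≢ j + j - + 1
  even≢odd i j eq = odd (j - i) (≡.trans (lem i j) (≡.trans (≡.cong (λ k → (j + j) - k) eq) (lem′ j)))
    where
    lem : ∀ i j → (j - i) + (j - i) ≡ (j + j) - (i + i)
    lem = solve-∀
    lem′ : ∀ j → (j + j) - (j + j - + 1) ≡ + 1
    lem′ = solve-∀
    odd : ∀ k → k + k ≢ + 1
    odd (+ zero) ()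
    odd (+ suc zero) ()
    odd (+ suc (suc n)) ()
    odd -[1+ n ] ()

  -- One copy of ℤ × ℤ for each parity of the coordinate sum: (j + k, j - k) reaches only the pairs
  -- with even sum. The Landen identities, `theta-product` and `wronskian` all split a product of
  -- two theta series in this way.
  Rot : Set
  Rot = (ℤ × ℤ) ⊎ (ℤ × ℤ)

  rot : Rot → ℤ × ℤ
  rot (inj₁ (j , k)) = j + k , j - k
  rot (inj₂ (j , k)) = j + k , j - + 1 - k

  private
    sum₁ : ∀ j k → (j + k) + (j - k) ≡ j + j
    sum₁ = solve-∀
    sum₂ : ∀ j k → (j + k) + (j - + 1 - k) ≡ j + j - + 1
    sum₂ = solve-∀
    rotsum : ∀ {p q : ℤ × ℤ} → p ≡ q → proj₁ p + proj₂ p ≡ proj₁ q + proj₂ q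
    rotsum = ≡.cong (λ p → proj₁ p + proj₂ p)
    pred-injective : ∀ {i j} → i - + 1 ≡ j - + 1 → i ≡ j
    pred-injective {i} {j} eq = ≡.trans (aux i) (≡.trans (≡.cong (λ k → + 1 + k) eq) (≡.sym (aux j)))
      where
      aux : ∀ i → i ≡ + 1 + (i - + 1)
      aux = solve-∀
    pair : ∀ {j j′ k k′ : ℤ} → j ≡ j′ → j + k ≡ j′ + k′ → (j , k) ≡ (j′ , k′)
    pair {j} ≡.refl eq = ≡.cong (j ,_) (Algebra.Properties.Ring.+-cancelˡ ℤₚ.+-*-ring j _ _ eq)

  rot-injective : ∀ {x y} → rot x ≡ rot y → x ≡ y
  rot-injective {inj₁ (j , k)} {inj₁ (j′ , k′)} eq = ≡.cong inj₁ (pair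
    (double-injective j j′ (≡.trans (≡.sym (sum₁ j k)) (≡.trans (rotsum eq) (sum₁ j′ k′)))) (≡.cong proj₁ eq))
  rot-injective {inj₂ (j , k)} {inj₂ (j′ , k′)} eq = ≡.cong inj₂ (pair
    (double-injective j j′ (pred-injective (≡.trans (≡.sym (sum₂ j k)) (≡.trans (rotsum eq) (sum₂ j′ k′))))) (≡.cong proj₁ eq))
  rot-injective {inj₁ (j , k)} {inj₂ (j′ , k′)} eq =
    ⊥-elim (even≢odd j j′ (≡.trans (≡.sym (sum₁ j k)) (≡.trans (rotsum eq) (sum₂ j′ k′))))
  rot-injective {inj₂ (j , k)} {inj₁ (j′ , k′)} eq =
    ⊥-elim (even≢odd j′ j (≡.trans (≡.sym (sum₁ j′ k′)) (≡.trans (≡.sym (rotsum eq)) (sum₂ j k))))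

  rot-surjective : ∀ p → ∃ λ x → p ≡ rot x
  rot-surjective (m , n) with parity (m + n)
  ... | j , inj₁ eq = inj₁ (j , m - j) , ≡.cong₂ _,_ (lem₁ m j)
        (≡.trans (lem₂ m n) (≡.trans (≡.cong (λ s → s - m) eq) (lem₃ m j)))
    where
    lem₁ : ∀ m j → m ≡ j + (m - j)
    lem₁ = solve-∀
    lem₂ : ∀ m n → n ≡ (m + n) - m
    lem₂ = solve-∀
    lem₃ : ∀ m j → j + j - m ≡ j - (m - j)
    lem₃ = solve-∀
  ... | j , inj₂ eq = inj₂ (j , m - j) , ≡.cong₂ _,_ (lem₁ m j)
        (≡.trans (lem₂ m n) (≡.trans (≡.cong (λ s → s - m) eq) (lem₃ m j)))
    where
    lem₁ : ∀ m j → m ≡ j + (m - j)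
    lem₁ = solve-∀
    lem₂ : ∀ m n → n ≡ (m + n) - m
    lem₂ = solve-∀
    lem₃ : ∀ m j → j + j - + 1 - m ≡ j - + 1 - (m - j)
    lem₃ = solve-∀

  triangular : ℕ → ℕ
  triangular zero    = 0
  triangular (suc n) = suc n ℕ.+ triangular n

  -- The value i (i + 1) / 2 at every integer i; it is invariant under i ↦ -1 - i.
  tri : ℤ → ℕ
  tri (+ n)    = triangular n
  tri -[1+ n ] = triangular n

  sq : ℤ → ℕ
  sq i = ∣ i * i ∣

  +sq : ∀ i → + sq i ≡ i * i
  +sq (+ n)    = ≡.trans (≡.cong (λ k → + ∣ k ∣) (≡.sym (ℤₚ.pos-* n n))) (ℤₚ.pos-* n n)
  +sq -[1+ n ] = ≡.refl

  private
    triangular-double : ∀ n → + triangular n + + triangular n ≡ + n * + n + + n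
    triangular-double zero    = ≡.refl
    triangular-double (suc n) = begin
      (+ suc n + t) + (+ suc n + t)                     ≡⟨ lem (+ suc n) t ⟩
      (t + t) + (+ suc n + + suc n)                     ≡⟨ ≡.cong (_+ (+ suc n + + suc n)) (triangular-double n) ⟩
      (+ n * + n + + n) + ((+ 1 + + n) + (+ 1 + + n))   ≡⟨ lem′ (+ n) ⟩
      (+ 1 + + n) * (+ 1 + + n) + (+ 1 + + n)           ∎
      where
      t = + triangular n
      lem : ∀ s t → (s + t) + (s + t) ≡ (t + t) + (s + s)
      lem = solve-∀
      lem′ : ∀ n → (n * n + n) + ((+ 1 + n) + (+ 1 + n)) ≡ (+ 1 + n) * (+ 1 + n) + (+ 1 + n)
      lem′ = solve-∀

  tri-double : ∀ i → + tri i + + tri i ≡ i * i + i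
  tri-double (+ n)    = triangular-double n
  tri-double -[1+ n ] = ≡.trans (triangular-double n) (lem (+ n))
    where
    lem : ∀ n → n * n + n ≡ (- (+ 1 + n)) * (- (+ 1 + n)) + (- (+ 1 + n))
    lem = solve-∀

  -- This is 2 i (i + 1), written so that replacing t by t² twice turns `T (tri i)` into
  -- `T (quad i)` by definition.
  quad : ℤ → ℕ
  quad i = (tri i ℕ.+ tri i) ℕ.+ (tri i ℕ.+ tri i)

  +quad : ∀ i → + quad i ≡ (i * i + i) + (i * i + i)
  +quad i = ≡.cong₂ _+_ (tri-double i) (tri-double i)

  suc-pred : ∀ i → + 1 + (i - + 1) ≡ i
  suc-pred = solve-∀

  pred-suc : ∀ i → + 1 + i - + 1 ≡ i
  pred-suc = solve-∀

  n≤triangular : ∀ n → n ℕ.≤ triangular n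
  n≤triangular zero    = z≤n
  n≤triangular (suc n) = ℕₚ.m≤m+n (suc n) _

  ∣i∣≤1+tri : ∀ i → ∣ i ∣ ℕ.≤ suc (tri i)
  ∣i∣≤1+tri (+ n)    = ℕₚ.m≤n⇒m≤1+n (n≤triangular n)
  ∣i∣≤1+tri -[1+ n ] = s≤s (n≤triangular n)

  ∣i∣≤1+quad : ∀ i → ∣ i ∣ ℕ.≤ suc (quad i)
  ∣i∣≤1+quad i = ℕₚ.≤-trans (∣i∣≤1+tri i) (s≤s (ℕₚ.≤-trans (ℕₚ.m≤m+n _ _) (ℕₚ.m≤m+n _ _)))

  ∣i∣≤sq : ∀ i → ∣ i ∣ ℕ.≤ sq i
  ∣i∣≤sq i = ≡.subst (∣ i ∣ ℕ.≤_) (≡.sym (ℤₚ.abs-* i i)) (m≤m*m ∣ i ∣)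
    where
    m≤m*m : ∀ m → m ℕ.≤ m ℕ.* m
    m≤m*m zero    = z≤n
    m≤m*m (suc m) = ℕₚ.m≤m*n (suc m) (suc m)

  -- Natural-number exponents are compared after embedding them in ℤ.
  exp≡ : ∀ {m n : ℕ} {i j : ℤ} → + m ≡ i → + n ≡ j → i ≡ j → m ≡ n
  exp≡ p q r = ℤₚ.+-injective (≡.trans p (≡.trans r (≡.sym q)))

  double≡ : ∀ {m n : ℕ} {i : ℤ} → + m + + m ≡ i → + n + + n ≡ i → m ≡ n
  double≡ {m} {n} p q = ℤₚ.+-injective (double-injective (+ m) (+ n) (≡.trans p (≡.sym q)))

  ints : ℕ → List ℤ
  ints B = map +_ (upTo (suc B)) ++ map -[1+_] (upTo B)

  ∈ints : ∀ {B i} → ∣ i ∣ ℕ.≤ B → i ∈ ints B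
  ∈ints {B} {+ n}      n≤B = ∈ₚ.∈-++⁺ˡ (∈ₚ.∈-map⁺ +_ (∈ₚ.∈-upTo⁺ (s≤s n≤B)))
  ∈ints {B} { -[1+ n ]} n<B = ∈ₚ.∈-++⁺ʳ (map +_ (upTo (suc B))) (∈ₚ.∈-map⁺ -[1+_] (∈ₚ.∈-upTo⁺ n<B))

  ∉ints : ∀ {B i} → i ∉ ints B → B ℕ.< ∣ i ∣
  ∉ints {B} {i} i∉ with ℕₚ.<-≤-connex B ∣ i ∣
  ... | inj₁ B<i = B<i
  ... | inj₂ i≤B = ⊥-elim (i∉ (∈ints i≤B))

open Integers public

-- Lists over consecutive indices

module Segments where
  seg : {A : Set} → (ℕ → A) → ℕ → ℕ → List A
  seg f k zero    = []
  seg f k (suc n) = f k ∷ seg f (suc k) n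

  seg-snoc : {A : Set} (f : ℕ → A) (k n : ℕ) → seg f k (suc n) ≡ seg f k n ++ f (k ℕ.+ n) ∷ []
  seg-snoc f k zero    = ≡.cong (λ i → f i ∷ []) (≡.sym (ℕₚ.+-identityʳ k))
  seg-snoc f k (suc n) = ≡.cong (f k ∷_) (≡.trans (seg-snoc f (suc k) n)
    (≡.cong (λ i → seg f (suc k) n ++ f i ∷ []) (≡.sym (ℕₚ.+-suc k n))))

  seg-split : {A : Set} (f : ℕ → A) (k n : ℕ) → n ℕ.< k → ∃ λ pre → ∃ λ mid → seg f 0 k ≡ pre ++ f n ∷ mid
  seg-split f (suc k) n n<1+k with ℕₚ.m≤n⇒m<n∨m≡n n<1+k
  ... | inj₁ (s≤s n<k) = let pre , mid , eq = seg-split f k n n<k in pre , mid ++ f k ∷ [] ,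
        ≡.trans (seg-snoc f 0 k) (≡.trans (≡.cong (_++ f k ∷ []) eq) (Lₚ.++-assoc pre (f n ∷ mid) (f k ∷ [])))
  ... | inj₂ ≡.refl    = seg f 0 k , [] , seg-snoc f 0 k

  seg-map : {A A′ : Set} (g : A → A′) (f : ℕ → A) (k n : ℕ) → seg (g ∘ f) k n ≡ map g (seg f k n)
  seg-map g f k zero    = ≡.refl
  seg-map g f k (suc n) = ≡.cong (g (f k) ∷_) (seg-map g f (suc k) n)

  seg-All : ∀ {m} k n → k ℕ.+ n ℕ.≤ m → All (ℕ._< m) (seg id k n)
  seg-All k zero    _  = []
  seg-All {m} k (suc n) le = ℕₚ.≤-trans (s≤s (ℕₚ.m≤m+n k n)) le′ ∷ seg-All (suc k) n le′
    where le′ = ≡.subst (ℕ._≤ m) (ℕₚ.+-suc k n) le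

  seg-≥ : ∀ j k n → j ℕ.< k → All (j ≢_) (seg id k n)
  seg-≥ j k zero    _   = []
  seg-≥ j k (suc n) j<k = ℕₚ.<⇒≢ j<k ∷ seg-≥ j (suc k) n (ℕₚ.m≤n⇒m≤1+n j<k)

  seg-unique : ∀ k n → Unique (seg id k n)
  seg-unique k zero    = []
  seg-unique k (suc n) = seg-≥ k (suc k) n ℕₚ.≤-refl ∷ seg-unique (suc k) n

  seg-length : {A : Set} (f : ℕ → A) → ∀ k n → Data.List.length (seg f k n) ≡ n
  seg-length f k zero    = ≡.refl
  seg-length f k (suc n) = ≡.cong suc (seg-length f (suc k) n)

open Segments public

-- The character i ↦ (-1)^i

module Signs (R : CommutativeRing 0ℓ 0ℓ) where
  open CommutativeRing R
  open RingTools R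
  open Algebra.Properties.Ring ring using (-‿distribˡ-*; -‿distribʳ-*; -‿involutive)
  open import Relation.Binary.Reasoning.Setoid setoid

  private
    sgℕ : ℕ → Carrier
    sgℕ zero    = 1#
    sgℕ (suc n) = - sgℕ n

  sg : ℤ → Carrier
  sg i = sgℕ ∣ i ∣

  sg-suc : ∀ i → sg (+ 1 ℤ.+ i) ≈ - sg i
  sg-suc (+ n)          = refl
  sg-suc -[1+ zero ]    = sym (-‿involutive _)
  sg-suc -[1+ suc n ]   = sym (-‿involutive _)

  sg-+ : ∀ i j → sg (i ℤ.+ j) ≈ sg i * sg j
  sg-+ i j = ℤ-ind (λ i → sg (i ℤ.+ j) ≈ sg i * sg j)
    (trans (reflexive (≡.cong sg (ℤₚ.+-identityˡ j))) (sym (*-identityˡ _))) up down i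
    where
    step : ∀ i → sg ((+ 1 ℤ.+ i) ℤ.+ j) ≈ - sg (i ℤ.+ j)
    step i = trans (reflexive (≡.cong sg (ℤₚ.+-assoc (+ 1) i j))) (sg-suc (i ℤ.+ j))
    up : ∀ i → sg (i ℤ.+ j) ≈ sg i * sg j → sg ((+ 1 ℤ.+ i) ℤ.+ j) ≈ sg (+ 1 ℤ.+ i) * sg j
    up i p = begin
      sg ((+ 1 ℤ.+ i) ℤ.+ j)   ≈⟨ step i ⟩
      - sg (i ℤ.+ j)           ≈⟨ -‿cong p ⟩
      - (sg i * sg j)          ≈⟨ -‿distribˡ-* _ _ ⟩
      - sg i * sg j            ≈⟨ *-congʳ (sg-suc i) ⟨
      sg (+ 1 ℤ.+ i) * sg j    ∎
    down : ∀ i → sg ((+ 1 ℤ.+ i) ℤ.+ j) ≈ sg (+ 1 ℤ.+ i) * sg j → sg (i ℤ.+ j) ≈ sg i * sg j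
    down i p = begin
      sg (i ℤ.+ j)                  ≈⟨ -‿involutive _ ⟨
      - - sg (i ℤ.+ j)              ≈⟨ -‿cong (step i) ⟨
      - sg ((+ 1 ℤ.+ i) ℤ.+ j)      ≈⟨ -‿cong p ⟩
      - (sg (+ 1 ℤ.+ i) * sg j)     ≈⟨ -‿cong (*-congʳ (sg-suc i)) ⟩
      - (- sg i * sg j)             ≈⟨ -‿cong (-‿distribˡ-* _ _) ⟨
      - - (sg i * sg j)             ≈⟨ -‿involutive _ ⟩
      sg i * sg j                   ∎

  sg-neg : ∀ i → sg (ℤ.- i) ≡ sg i
  sg-neg i = ≡.cong sgℕ (ℤₚ.∣-i∣≡∣i∣ i)

  sg² : ∀ i → sg i * sg i ≈ 1#
  sg² i = trans (trans (*-congˡ (reflexive (≡.sym (sg-neg i)))) (sym (sg-+ i (ℤ.- i))))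
                (reflexive (≡.cong sg (ℤₚ.+-inverseʳ i)))

-- Theta constants

module Theta (R : CommutativeRing 0ℓ 0ℓ) (h : CommutativeRing.Carrier R)
             (h+h : CommutativeRing._≈_ R (CommutativeRing._+_ R h h) (CommutativeRing.1# R)) where
  open CommutativeRing R
  open RingTools R
  open Summation R
  open Signs R
  open Algebra.Properties.Ring ring using (-‿distribˡ-*; -‿distribʳ-*; -0#≈0#)
  open import Relation.Binary.Reasoning.Setoid setoid

  -- Cancellation is all that the descent needs, and this property passes from a product to its
  -- factors.
  Regular : Carrier → Set
  Regular y = ∀ x → y * x ≈ 0# → x ≈ 0#

  2-regular : ∀ x → x + x ≈ 0# → x ≈ 0#
  2-regular x x+x = begin
    x               ≈⟨ *-identityˡ x ⟨
    1# * x          ≈⟨ *-congʳ h+h ⟨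
    (h + h) * x     ≈⟨ Solver.solve 2 (λ h x → (h :+ h) :* x := h :* (x :+ x)) refl h x ⟩
    h * (x + x)     ≈⟨ *-congˡ x+x ⟩
    h * 0#          ≈⟨ zeroʳ h ⟩
    0#              ∎
    where open Solver using (_:+_; _:*_; _:=_)

  regular-cancel : ∀ {y} → Regular y → ∀ {a b} → y * a ≈ y * b → a ≈ b
  regular-cancel {y} reg {a} {b} eq = begin
    a             ≈⟨ Solver.solve 2 (λ a b → a := (a :- b) :+ b) refl a b ⟩
    (a - b) + b   ≈⟨ +-congʳ (reg (a - b) (begin
        y * (a - b)      ≈⟨ Solver.solve 3 (λ y a b → y :* (a :- b) := y :* a :- y :* b) refl y a b ⟩
        y * a - y * b    ≈⟨ +-congʳ eq ⟩
        y * b - y * b    ≈⟨ -‿inverseʳ _ ⟩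
        0#               ∎)) ⟩
    0# + b        ≈⟨ +-identityˡ b ⟩
    b             ∎
    where open Solver using (_:+_; _:-_; _:*_; _:=_)

  double-cancel : ∀ {a b} → a + a ≈ b + b → a ≈ b
  double-cancel {a} {b} eq = regular-cancel {1# + 1#} (λ x p → 2-regular x (trans (lem x) p))
    (trans (sym (lem a)) (trans eq (lem b)))
    where
    lem : ∀ x → x + x ≈ (1# + 1#) * x
    lem = Solver.solve 1 (λ x → x :+ x := con (+ 2) :* x) refl
      where open Solver using (_:+_; _:*_; _:=_; con)

  -- Reindexing by the involution turns the sum into its negative, and 2 is invertible.
  odd-sum : {I : Set} {{_ : DecEq I}} (ρ : I → I) → (∀ i → ρ (ρ i) ≡ i) → {f : I → Carrier} {s : Carrier} →
            (∀ i → f (ρ i) ≈ - f i) → HasSum f s → s ≈ 0#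
  odd-sum ρ ρρ {f} {s} odd hf = 2-regular s (begin
    s + s     ≈⟨ +-congˡ (HasSum-unique (HasSum-cong odd
                   (HasSum-bij ρ ρ ρρ ρρ (HasSum-cong (λ i → reflexive (≡.cong f (≡.sym (ρρ i)))) hf)))
                   (HasSum-neg hf)) ⟩
    s + - s   ≈⟨ -‿inverseʳ s ⟩
    0#        ∎)

  rotate : {F : ℤ × ℤ → Carrier} {s r : Carrier} → HasSum (F ∘ rot ∘ inj₁) s → HasSum (F ∘ rot ∘ inj₂) r → HasSum F (s + r)
  rotate h₁ h₂ = HasSum-push rot rot-injective (inj₁ ∘ rot-surjective) (HasSum-⊎ h₁ h₂)

  HasSum-up : {f : ℤ → Carrier} {s : Carrier} → HasSum f s → HasSum (λ i → f (+ 1 ℤ.+ i)) s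
  HasSum-up = HasSum-pull (λ i → + 1 ℤ.+ i) (λ i → i ℤ.- + 1) pred-suc suc-pred

  -- The powers T k = t ^ k of a nilpotent element t.
  record Nome (bound : ℕ) : Set where
    field
      T      : ℕ → Carrier
      T-0    : T 0 ≈ 1#
      T-+    : ∀ m n → T (m ℕ.+ n) ≈ T m * T n
      T-null : ∀ k → bound ℕ.≤ k → T k ≈ 0#

    T-eq : ∀ {a b c d} → a ℕ.+ b ≡ c ℕ.+ d → T a * T b ≈ T c * T d
    T-eq eq = trans (sym (T-+ _ _)) (trans (reflexive (≡.cong T eq)) (T-+ _ _))

    -- Beyond |n| = `bound` + 1 the exponent is at least `bound`, where `T` vanishes. The slack of 1
    -- in the growth condition is there for n = -1, where `tri` is 0.
    theta : (w : ℤ → Carrier) (e : ℤ → ℕ) → (∀ n → ∣ n ∣ ℕ.≤ suc (e n)) → ∃ λ s → HasSum (λ n → w n * T (e n)) s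
    theta w e grow = _ , fromSupport _ (ints (suc bound))
      (λ n n∉ → trans (*-congˡ (T-null (e n) (ℕₚ.≤-pred (ℕₚ.≤-trans (ℕₚ.<⇒≤ (∉ints n∉)) (grow n))))) (zeroʳ _))

  -- The substitution t ↦ t². The drop of the bound by one is what makes Landen's descent terminate.
  square : ∀ {B} → Nome (suc (suc B)) → Nome (suc B)
  square 𝓺 = record
    { T = λ k → T (k ℕ.+ k)
    ; T-0 = T-0
    ; T-+ = λ m n → trans (reflexive (≡.cong T (ℕ-lem m n))) (T-+ (m ℕ.+ m) (n ℕ.+ n))
    ; T-null = λ { (suc k) (s≤s B≤k) → T-null _ (s≤s (ℕₚ.≤-trans (s≤s B≤k) (ℕₚ.m≤n+m (suc k) k))) } }
    where
    open Nome 𝓺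
    ℕ-lem : ∀ m n → (m ℕ.+ n) ℕ.+ (m ℕ.+ n) ≡ (m ℕ.+ m) ℕ.+ (n ℕ.+ n)
    ℕ-lem m n = ℤₚ.+-injective (lem (+ m) (+ n))
      where
      lem : ∀ m n → (m ℤ.+ n) ℤ.+ (m ℤ.+ n) ≡ (m ℤ.+ m) ℤ.+ (n ℤ.+ n)
      lem = solve-∀

  module Families (T : ℕ → Carrier) where
    -- At u = 0, `φ⁻` is θ₄ and `φ⁺` is θ₃; up to powers of t, `ψ` is a θ₂ and `η` the derivative of
    -- θ₁. As sums over ℤ, `ψ` is twice Σ t^(n(n+1)/2) over n ≥ 0, and `η` is twice Jacobi's series
    -- for the cube of Euler's product. The factors `1#` give the shape required by `theta`.
    φ⁻ φ⁺ ψ η : ℤ → Carrier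
    φ⁻ n = sg n * T (sq n)
    φ⁺ n = 1# * T (sq n)
    ψ  n = 1# * T (tri n)
    η  n = sg n * fromℤ (+ 1 ℤ.+ (n ℤ.+ n)) * T (tri n)

  private
    reflect : ℤ → ℤ
    reflect i = -[1+ 0 ] ℤ.- i
    reflect² : ∀ i → reflect (reflect i) ≡ i
    reflect² = lem
      where
      lem : ∀ i → -[1+ 0 ] ℤ.- (-[1+ 0 ] ℤ.- i) ≡ i
      lem = solve-∀
    sg-reflect : ∀ i → sg (reflect i) ≈ - sg i
    sg-reflect i = trans (sg-+ -[1+ 0 ] (ℤ.- i)) (trans (*-congˡ (reflexive (sg-neg i)))
      (trans (sym (-‿distribˡ-* _ _)) (-‿cong (*-identityˡ _))))
    tri-reflect : ∀ i → tri (reflect i) ≡ tri i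
    tri-reflect i = double≡ (tri-double (reflect i)) (≡.trans (tri-double i) (lem i))
      where
      lem : ∀ i → i ℤ.* i ℤ.+ i ≡ (-[1+ 0 ] ℤ.- i) ℤ.* (-[1+ 0 ] ℤ.- i) ℤ.+ (-[1+ 0 ] ℤ.- i)
      lem = solve-∀

  module _ {B} (𝓺 : Nome B) where
    open Nome 𝓺

    quad-sum : ∃ (HasSum (λ n → sg n * T (quad n)))
    quad-sum = theta sg quad ∣i∣≤1+quad

    -- The reflection n ↦ -1 - n keeps the exponent and changes the sign.
    quad-sum≈0 : ∀ {z} → HasSum (λ n → sg n * T (quad n)) z → z ≈ 0#
    quad-sum≈0 = odd-sum reflect reflect² (λ i → trans (*-cong (sg-reflect i)
      (reflexive (≡.cong (λ t → T ((t ℕ.+ t) ℕ.+ (t ℕ.+ t))) (tri-reflect i)))) (sym (-‿distribˡ-* _ _)))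

  module Landen {B} (𝓺 : Nome (suc (suc B))) where
    open Nome 𝓺
    open Families T
    T₂ : ℕ → Carrier
    T₂ k = T (k ℕ.+ k)
    open Families T₂ using () renaming (φ⁻ to φ⁻₂; ψ to ψ₂; η to η₂)

    private
      -- The two cosets of rot carry the exponents 2 tri j + sq k and sq j + 2 tri k.
      tri-rot₁ : ∀ j k → tri (j ℤ.+ k) ℕ.+ tri (j ℤ.- k) ≡ (tri j ℕ.+ tri j) ℕ.+ sq k
      tri-rot₁ j k = double≡
        (≡.trans (lem₀ (+ tri (j ℤ.+ k)) (+ tri (j ℤ.- k)))
          (≡.trans (≡.cong₂ ℤ._+_ (tri-double (j ℤ.+ k)) (tri-double (j ℤ.- k))) (lem₁ j k)))
        (≡.trans (lem₂ (+ tri j) (+ sq k))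
          (≡.cong₂ (λ a b → (a ℤ.+ a) ℤ.+ (b ℤ.+ b)) (tri-double j) (+sq k)))
        where
        lem₀ : ∀ a b → (a ℤ.+ b) ℤ.+ (a ℤ.+ b) ≡ (a ℤ.+ a) ℤ.+ (b ℤ.+ b)
        lem₀ = solve-∀
        lem₁ : ∀ j k → ((j ℤ.+ k) ℤ.* (j ℤ.+ k) ℤ.+ (j ℤ.+ k)) ℤ.+ ((j ℤ.- k) ℤ.* (j ℤ.- k) ℤ.+ (j ℤ.- k))
                     ≡ ((j ℤ.* j ℤ.+ j) ℤ.+ (j ℤ.* j ℤ.+ j)) ℤ.+ (k ℤ.* k ℤ.+ k ℤ.* k)
        lem₁ = solve-∀
        lem₂ : ∀ a b → (a ℤ.+ a ℤ.+ b) ℤ.+ (a ℤ.+ a ℤ.+ b) ≡ ((a ℤ.+ a) ℤ.+ (a ℤ.+ a)) ℤ.+ (b ℤ.+ b)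
        lem₂ = solve-∀

      tri-rot₂ : ∀ j k → tri (j ℤ.+ k) ℕ.+ tri (j ℤ.- + 1 ℤ.- k) ≡ sq j ℕ.+ (tri k ℕ.+ tri k)
      tri-rot₂ j k = ≡.trans (≡.cong₂ (λ a b → tri a ℕ.+ b) (ℤₚ.+-comm j k)
        (≡.trans (≡.cong tri (lem j k)) (tri-reflect (k ℤ.- j)))) (≡.trans (tri-rot₁ k j) (ℕₚ.+-comm _ (sq j)))
        where
        lem : ∀ j k → j ℤ.- + 1 ℤ.- k ≡ -[1+ 0 ] ℤ.- (k ℤ.- j)
        lem = solve-∀

      sg-rot₁ : ∀ j k → sg (j ℤ.- k) ≈ sg j * sg k
      sg-rot₁ j k = trans (sg-+ j (ℤ.- k)) (*-congˡ (reflexive (sg-neg k)))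

      sg-rot₂ : ∀ j k → sg (j ℤ.- + 1 ℤ.- k) ≈ - (sg j * sg k)
      sg-rot₂ j k = trans (reflexive (≡.cong sg (lem j k))) (trans (sg-reflect (k ℤ.- j))
        (-‿cong (trans (sg-rot₁ k j) (*-comm _ _))))
        where
        lem : ∀ j k → j ℤ.- + 1 ℤ.- k ≡ -[1+ 0 ] ℤ.- (k ℤ.- j)
        lem = solve-∀

      ∣i∣≤1+2tri : ∀ i → ∣ i ∣ ℕ.≤ suc (tri i ℕ.+ tri i)
      ∣i∣≤1+2tri i = ℕₚ.≤-trans (∣i∣≤1+tri i) (s≤s (ℕₚ.m≤m+n _ _))

    -- On the first coset the weight 2 (j + k) + 1 splits into 2 j + 1 and 2 k. The part with 2 k
    -- contains the factor Σ (-1)^j t^(j(j+1)), which is odd under j ↦ -1 - j and hence 0. The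
    -- second coset gives the same value with j and k exchanged, which accounts for the factor 2.
    ηψ : ∀ {k d k₂ p} → HasSum η k → HasSum ψ d → HasSum η₂ k₂ → HasSum φ⁻ p → k * d ≈ k₂ * p + k₂ * p
    ηψ {k₂ = k₂} {p} hk hd hk₂ hp = HasSum-unique (HasSum-× hk hd) (rotate
      (HasSum-resp tot (HasSum-cong pt₁ both))
      (HasSum-resp tot (HasSum-cong (λ (j , k) → pt₂ j k) (HasSum-bij swap swap (λ _ → ≡.refl) (λ _ → ≡.refl) both))))
      where
      swap : ℤ × ℤ → ℤ × ℤ
      swap (j , k) = k , j
      z  = theta sg (λ n → tri n ℕ.+ tri n) ∣i∣≤1+2tri
      y  = theta (λ n → sg n * fromℤ (n ℤ.+ n)) sq (λ n → ℕₚ.m≤n⇒m≤1+n (∣i∣≤sq n))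
      z≈0 : proj₁ z ≈ 0#
      z≈0 = odd-sum reflect reflect² (λ i → trans (*-cong (sg-reflect i)
        (reflexive (≡.cong (λ t → T (t ℕ.+ t)) (tri-reflect i)))) (sym (-‿distribˡ-* _ _))) (proj₂ z)
      tot : k₂ * p + proj₁ z * proj₁ y ≈ k₂ * p
      tot = trans (+-congˡ (trans (*-congʳ z≈0) (zeroˡ _))) (+-identityʳ _)
      both = HasSum-+ (HasSum-× hk₂ hp) (HasSum-× (proj₂ z) (proj₂ y))
      weight : ∀ j k → fromℤ (+ 1 ℤ.+ ((j ℤ.+ k) ℤ.+ (j ℤ.+ k))) ≈ fromℤ (+ 1 ℤ.+ (j ℤ.+ j)) + fromℤ (k ℤ.+ k)
      weight j k = trans (reflexive (≡.cong fromℤ (lem j k))) (fromℤ-+ (+ 1 ℤ.+ (j ℤ.+ j)) (k ℤ.+ k))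
        where
        lem : ∀ j k → + 1 ℤ.+ ((j ℤ.+ k) ℤ.+ (j ℤ.+ k)) ≡ (+ 1 ℤ.+ (j ℤ.+ j)) ℤ.+ (k ℤ.+ k)
        lem = solve-∀
      collect : ∀ j k {a b} → T a * T b ≈ T₂ (tri j) * T (sq k) →
        (sg j * fromℤ (+ 1 ℤ.+ (j ℤ.+ j)) * T₂ (tri j)) * (sg k * T (sq k)) + (sg j * T₂ (tri j)) * (sg k * fromℤ (k ℤ.+ k) * T (sq k))
        ≈ (sg (j ℤ.+ k) * fromℤ (+ 1 ℤ.+ ((j ℤ.+ k) ℤ.+ (j ℤ.+ k))) * T a) * (1# * T b)
      collect j k {a} {b} TT = begin
        _ ≈⟨ solve 6 (λ s r x y u v → (s :* x :* u) :* (r :* v) :+ (s :* u) :* (r :* y :* v) := (s :* r) :* (x :+ y) :* (u :* v))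
               refl (sg j) (sg k) _ _ (T₂ (tri j)) (T (sq k)) ⟩
        (sg j * sg k) * (fromℤ (+ 1 ℤ.+ (j ℤ.+ j)) + fromℤ (k ℤ.+ k)) * (T₂ (tri j) * T (sq k))
          ≈⟨ *-cong (*-cong (sg-+ j k) (weight j k)) TT ⟨
        sg (j ℤ.+ k) * fromℤ (+ 1 ℤ.+ ((j ℤ.+ k) ℤ.+ (j ℤ.+ k))) * (T a * T b)
          ≈⟨ solve 4 (λ s x u v → s :* x :* (u :* v) := (s :* x :* u) :* (con (+ 1) :* v)) refl _ _ (T a) (T b) ⟩
        _ ∎
        where open Solver
      pt₁ : ∀ jk → _ ≈ η (proj₁ (rot (inj₁ jk))) * ψ (proj₂ (rot (inj₁ jk)))
      pt₁ (j , k) = collect j k (T-eq (tri-rot₁ j k))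
      pt₂ : ∀ j k → _ ≈ η (j ℤ.+ k) * ψ (j ℤ.- + 1 ℤ.- k)
      pt₂ j k = trans (collect k j (T-eq (≡.trans (tri-rot₂ j k) (ℕₚ.+-comm (sq j) _))))
        (*-congʳ (*-congʳ (*-cong (reflexive (≡.cong sg (ℤₚ.+-comm k j)))
          (reflexive (≡.cong (λ s → fromℤ (+ 1 ℤ.+ (s ℤ.+ s))) (ℤₚ.+-comm k j))))))

    -- There are no signs here, so each coset contributes the full product of Σ t^(j(j+1)) and Σ
    -- t^(k²).
    ψψ : ∀ {d d₂ p} → HasSum ψ d → HasSum ψ₂ d₂ → HasSum φ⁺ p → d * d ≈ d₂ * p + d₂ * p
    ψψ hd hd₂ hp = HasSum-unique (HasSum-× hd hd) (rotate
      (HasSum-cong (λ (j , k) → pt (T-eq (tri-rot₁ j k))) (HasSum-× hd₂ hp))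
      (HasSum-resp (*-comm _ _) (HasSum-cong (λ (j , k) → pt (T-eq (tri-rot₂ j k))) (HasSum-× hp hd₂))))
      where
      pt : ∀ {a b c d} → T a * T b ≈ T c * T d → (1# * T c) * (1# * T d) ≈ (1# * T a) * (1# * T b)
      pt eq = trans (*-cong (*-identityˡ _) (*-identityˡ _)) (trans (sym eq) (sym (*-cong (*-identityˡ _) (*-identityˡ _))))

    -- Pairs with even sum have the exponent 2 j² + 2 k² and give the right side. Pairs with odd sum
    -- contain the factor Σ (-1)^j t^(j² + (j-1)²), which is odd under j ↦ 1 - j.
    φφ : ∀ {p q p₂} → HasSum φ⁺ p → HasSum φ⁻ q → HasSum φ⁻₂ p₂ → p * q ≈ p₂ * p₂
    φφ {p₂ = p₂} hp hq hp₂ = trans (HasSum-unique (HasSum-× hp hq) (rotate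
      (HasSum-cong (λ (j , k) → pt₁ j k) (HasSum-× hp₂ hp₂))
      (HasSum-cong (λ (j , k) → pt₂ j k) (HasSum-× (HasSum-neg (proj₂ z)) (proj₂ y)))))
      (trans (+-congˡ (trans (*-congʳ (trans (-‿cong z≈0) -0#≈0#)) (zeroˡ _))) (+-identityʳ _))
      where
      open Solver
      e : ℤ → ℕ
      e n = sq n ℕ.+ sq (n ℤ.- + 1)
      z = theta sg e (λ n → ℕₚ.m≤n⇒m≤1+n (ℕₚ.≤-trans (∣i∣≤sq n) (ℕₚ.m≤m+n _ _)))
      y = theta sg (λ n → (tri n ℕ.+ tri n) ℕ.+ (tri n ℕ.+ tri n)) (λ n → ℕₚ.≤-trans (∣i∣≤1+2tri n) (s≤s (ℕₚ.m≤m+n _ _)))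
      flip : ℤ → ℤ
      flip i = + 1 ℤ.- i
      flip² : ∀ i → flip (flip i) ≡ i
      flip² = lem
        where
        lem : ∀ i → + 1 ℤ.- (+ 1 ℤ.- i) ≡ i
        lem = solve-∀
      z≈0 : proj₁ z ≈ 0#
      z≈0 = odd-sum flip flip² (λ i → trans (*-cong
        (trans (sg-+ (+ 1) (ℤ.- i)) (*-congˡ (reflexive (sg-neg i))))
        (reflexive (≡.cong T (≡.trans (≡.cong₂ ℕ._+_ (sq-1 i) (≡.cong ∣_∣ (lem₂ i))) (ℕₚ.+-comm (sq (i ℤ.- + 1)) (sq i))))))
        (solve 2 (λ s t → (:- con (+ 1) :* s) :* t := :- (s :* t)) refl (sg i) (T (e i)))) (proj₂ z)
        where
        lem₁ : ∀ i → (+ 1 ℤ.- i) ℤ.* (+ 1 ℤ.- i) ≡ (i ℤ.- + 1) ℤ.* (i ℤ.- + 1)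
        lem₁ = solve-∀
        sq-1 : ∀ i → sq (+ 1 ℤ.- i) ≡ sq (i ℤ.- + 1)
        sq-1 i = ≡.cong ∣_∣ (lem₁ i)
        lem₂ : ∀ i → (+ 1 ℤ.- i ℤ.- + 1) ℤ.* (+ 1 ℤ.- i ℤ.- + 1) ≡ i ℤ.* i
        lem₂ = solve-∀
      four : ∀ s r u v → (s * u) * (r * v) ≈ (s * r) * (u * v)
      four = solve 4 (λ s r u v → (s :* u) :* (r :* v) := (s :* r) :* (u :* v)) refl
      pt₁ : ∀ j k → (sg j * T₂ (sq j)) * (sg k * T₂ (sq k)) ≈ (1# * T (sq (j ℤ.+ k))) * (sg (j ℤ.- k) * T (sq (j ℤ.- k)))
      pt₁ j k = trans (four _ _ _ _) (trans (*-cong (trans (sym (sg-rot₁ j k)) (sym (*-identityˡ _))) (T-eq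
        (exp≡ (≡.cong₂ (λ a b → (a ℤ.+ a) ℤ.+ (b ℤ.+ b)) (+sq j) (+sq k)) (≡.cong₂ ℤ._+_ (+sq (j ℤ.+ k)) (+sq (j ℤ.- k))) (lem j k))))
        (sym (four _ _ _ _)))
        where
        lem : ∀ j k → (j ℤ.* j ℤ.+ j ℤ.* j) ℤ.+ (k ℤ.* k ℤ.+ k ℤ.* k) ≡ (j ℤ.+ k) ℤ.* (j ℤ.+ k) ℤ.+ (j ℤ.- k) ℤ.* (j ℤ.- k)
        lem = solve-∀
      pt₂ : ∀ j k → (- (sg j * T (e j))) * (sg k * T ((tri k ℕ.+ tri k) ℕ.+ (tri k ℕ.+ tri k)))
                    ≈ (1# * T (sq (j ℤ.+ k))) * (sg (j ℤ.- + 1 ℤ.- k) * T (sq (j ℤ.- + 1 ℤ.- k)))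
      pt₂ j k = trans (solve 4 (λ s r u v → (:- (s :* u)) :* (r :* v) := (:- (s :* r)) :* (u :* v)) refl (sg j) (sg k) _ _)
        (trans (*-cong (trans (sym (sg-rot₂ j k)) (sym (*-identityˡ _))) (T-eq
          (exp≡ (≡.cong₂ ℤ._+_ (≡.cong₂ ℤ._+_ (+sq j) (+sq (j ℤ.- + 1))) (≡.cong₂ ℤ._+_ (tri-double k) (tri-double k)))
                (≡.cong₂ ℤ._+_ (+sq (j ℤ.+ k)) (+sq (j ℤ.- + 1 ℤ.- k))) (lem j k))))
          (sym (four _ _ _ _)))
        where
        lem : ∀ j k → (j ℤ.* j ℤ.+ (j ℤ.- + 1) ℤ.* (j ℤ.- + 1)) ℤ.+ ((k ℤ.* k ℤ.+ k) ℤ.+ (k ℤ.* k ℤ.+ k))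
                      ≡ (j ℤ.+ k) ℤ.* (j ℤ.+ k) ℤ.+ (j ℤ.- + 1 ℤ.- k) ℤ.* (j ℤ.- + 1 ℤ.- k)
        lem = solve-∀

  private
    Regular-1 : Regular 1#
    Regular-1 x eq = trans (sym (*-identityˡ x)) eq

    Regular-factor : ∀ {y z} → Regular (y * z) → Regular z
    Regular-factor {y} {z} reg x zx≈0 = reg x (trans (*-assoc y z x) (trans (*-congˡ zx≈0) (zeroʳ y)))

    Regular-* : ∀ {y z} → Regular y → Regular z → Regular (y * z)
    Regular-* ry rz x eq = rz x (ry _ (trans (sym (*-assoc _ _ _)) eq))

    Regular-resp : ∀ {y z} → y ≈ z → Regular y → Regular z
    Regular-resp y≈z ry x eq = ry x (trans (*-congʳ y≈z) eq)

    Regular-double : ∀ {y} → Regular y → Regular (y + y)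
    Regular-double ry x eq = ry x (2-regular _ (trans (sym (distribʳ _ _ _)) eq))

  -- The quotient η / (φ⁻ φ⁻ ψ) takes the same value at q and at q², by the three Landen
  -- identities, and it is 1 at q = 0.
  Jacobi-derivative : ∀ B (𝓺 : Nome (suc B)) → let open Families (Nome.T 𝓺) in
    ∀ {p d k} → HasSum φ⁻ p → HasSum ψ d → HasSum η k → Regular p × Regular d × (k ≈ p * p * d)
  Jacobi-derivative zero 𝓺 {p} {d} {k} hp hd hk =
    -- Here t^k = 0 for all k ≥ 1. Only n = 0 survives in `φ⁻`, while `ψ` and `η` keep n = 0 and n =
    -- -1, both with exponent 0.
    Regular-resp (sym p≈1) Regular-1 , Regular-resp (sym d≈2) (Regular-double Regular-1) ,
    trans k≈2 (sym (trans (*-cong (trans (*-cong p≈1 p≈1) (*-identityˡ 1#)) d≈2) (*-identityˡ _)))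
    where
    open Nome 𝓺
    open Families T
    open Solver
    tri-null : ∀ n → n ∉ (+ 0 ∷ -[1+ 0 ] ∷ []) → T (tri n) ≈ 0#
    tri-null (+ zero)     n∉ = ⊥-elim (n∉ (here ≡.refl))
    tri-null (+ suc n)    n∉ = T-null _ (s≤s z≤n)
    tri-null -[1+ zero ]  n∉ = ⊥-elim (n∉ (there (here ≡.refl)))
    tri-null -[1+ suc n ] n∉ = T-null _ (s≤s z≤n)
    p≈1 : p ≈ 1#
    p≈1 = HasSum-unique hp (hasSum (+ 0 ∷ []) ([] ∷ [])
      (λ n n∉ → trans (*-congˡ (T-null _ (ℕₚ.≤-trans (nz n n∉) (∣i∣≤sq n)))) (zeroʳ _))
      (trans (+-identityʳ _) (trans (*-identityˡ _) T-0)))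
      where
      nz : ∀ n → n ∉ (+ 0 ∷ []) → 1 ℕ.≤ ∣ n ∣
      nz (+ zero)   n∉ = ⊥-elim (n∉ (here ≡.refl))
      nz (+ suc n)  n∉ = s≤s z≤n
      nz -[1+ n ]   n∉ = s≤s z≤n
    pair-unique : Unique (+ 0 ∷ -[1+ 0 ] ∷ [])
    pair-unique = ((λ ()) ∷ []) ∷ [] ∷ []
    d≈2 : d ≈ 1# + 1#
    d≈2 = HasSum-unique hd (hasSum _ pair-unique
      (λ n n∉ → trans (*-congˡ (tri-null n n∉)) (zeroʳ _))
      (trans (+-cong (*-congˡ T-0) (+-congʳ (*-congˡ T-0)))
        (solve 0 (con (+ 1) :* con (+ 1) :+ (con (+ 1) :* con (+ 1) :+ con (+ 0)) := con (+ 1) :+ con (+ 1)) refl)))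
    k≈2 : k ≈ 1# + 1#
    k≈2 = HasSum-unique hk (hasSum _ pair-unique
      (λ n n∉ → trans (*-congˡ (tri-null n n∉)) (zeroʳ _))
      (trans (+-cong (*-congˡ T-0) (+-congʳ (*-congˡ T-0)))
        (solve 0 (con (+ 1) :* con (+ 1) :* con (+ 1) :+ ((:- con (+ 1)) :* (:- con (+ 1)) :* con (+ 1) :+ con (+ 0)) := con (+ 1) :+ con (+ 1)) refl)))
  Jacobi-derivative (suc B) 𝓺 {p} {d} {k} hp hd hk = rp , rd , k≈
    where
    open Nome 𝓺
    open Landen 𝓺
    open Families T
    open Families T₂ using () renaming (φ⁻ to φ⁻₂; ψ to ψ₂; η to η₂)
    open Solver
    module N₂ = Nome (square 𝓺)
    hp⁺ = theta (λ _ → 1#) sq (λ n → ℕₚ.m≤n⇒m≤1+n (∣i∣≤sq n))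
    hp₂ = N₂.theta sg sq (λ n → ℕₚ.m≤n⇒m≤1+n (∣i∣≤sq n))
    hd₂ = N₂.theta (λ _ → 1#) tri ∣i∣≤1+tri
    hk₂ = N₂.theta (λ n → sg n * fromℤ (+ 1 ℤ.+ (n ℤ.+ n))) tri ∣i∣≤1+tri
    p⁺ = proj₁ hp⁺
    p₂ = proj₁ hp₂
    d₂ = proj₁ hd₂
    k₂ = proj₁ hk₂
    IH = Jacobi-derivative B (square 𝓺) (proj₂ hp₂) (proj₂ hd₂) (proj₂ hk₂)
    rp₂ = proj₁ IH
    rd₂ = proj₁ (proj₂ IH)
    k₂≈ = proj₂ (proj₂ IH)
    φφ′ = φφ (proj₂ hp⁺) hp (proj₂ hp₂)
    ψψ′ = ψψ hd (proj₂ hd₂) (proj₂ hp⁺)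
    ηψ′ = ηψ hk hd (proj₂ hk₂) hp
    -- Regularity is inherited upwards: `p` and `p⁺` divide p₂², and `d` divides d² = 2 d₂ p⁺.
    rpp : Regular (p⁺ * p)
    rpp = Regular-resp (sym φφ′) (Regular-* rp₂ rp₂)
    rp : Regular p
    rp = Regular-factor {p⁺} rpp
    rp⁺ : Regular p⁺
    rp⁺ = Regular-factor {p} (Regular-resp (*-comm _ _) rpp)
    rd : Regular d
    rd = Regular-factor {d} (Regular-resp (sym ψψ′) (Regular-double (Regular-* rd₂ rp⁺)))
    k≈ : k ≈ p * p * d
    k≈ = regular-cancel rd (trans (*-comm d k) (trans ηψ′ (begin
      k₂ * p + k₂ * p                                   ≈⟨ +-cong (*-congʳ k₂≈) (*-congʳ k₂≈) ⟩
      p₂ * p₂ * d₂ * p + p₂ * p₂ * d₂ * p               ≈⟨ +-cong (*-congʳ (*-congʳ φφ′)) (*-congʳ (*-congʳ φφ′)) ⟨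
      p⁺ * p * d₂ * p + p⁺ * p * d₂ * p                 ≈⟨ solve 3 (λ q p d → q :* p :* d :* p :+ q :* p :* d :* p
                                                             := (d :* q :+ d :* q) :* (p :* p)) refl p⁺ p d₂ ⟩
      (d₂ * p⁺ + d₂ * p⁺) * (p * p)                     ≈⟨ *-congʳ ψψ′ ⟨
      (d * d) * (p * p)                                 ≈⟨ solve 2 (λ d p → (d :* d) :* (p :* p) := d :* (p :* p :* d)) refl d p ⟩
      d * (p * p * d)                                   ∎)))

  -- K(q²) = φ⁻(q) Δ(q)² for the one-sided sums K and Δ, where η = 2K and ψ = 2Δ.
  Jacobi-derivative₂ : ∀ {B} (𝓺 : Nome (suc (suc B))) → let open Families (Nome.T 𝓺) in
    ∀ {p d k} → HasSum φ⁻ p → HasSum ψ d → HasSum (Families.η (λ n → Nome.T 𝓺 (n ℕ.+ n))) k → k + k ≈ p * (d * d)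
  Jacobi-derivative₂ {B} 𝓺 {p} {d} {k} hp hd hk = begin
    k + k                                                    ≈⟨ +-cong k≈ k≈ ⟩
    p₂ * p₂ * d₂ + p₂ * p₂ * d₂                              ≈⟨ +-cong (*-congʳ φφ′) (*-congʳ φφ′) ⟨
    p⁺ * p * d₂ + p⁺ * p * d₂                                ≈⟨ solve 3 (λ q p d → q :* p :* d :+ q :* p :* d
                                                                 := p :* (d :* q :+ d :* q)) refl p⁺ p d₂ ⟩
    p * (d₂ * p⁺ + d₂ * p⁺)                                  ≈⟨ *-congˡ (ψψ hd (proj₂ hd₂) (proj₂ hp⁺)) ⟨
    p * (d * d)                                              ∎
    where
    open Nome 𝓺
    open Landen 𝓺
    open Solver
    module N₂ = Nome (square 𝓺)
    hp⁺ = theta (λ _ → 1#) sq (λ n → ℕₚ.m≤n⇒m≤1+n (∣i∣≤sq n))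
    hp₂ = N₂.theta sg sq (λ n → ℕₚ.m≤n⇒m≤1+n (∣i∣≤sq n))
    hd₂ = N₂.theta (λ _ → 1#) tri ∣i∣≤1+tri
    p⁺ = proj₁ hp⁺
    p₂ = proj₁ hp₂
    d₂ = proj₁ hd₂
    φφ′ = φφ (proj₂ hp⁺) hp (proj₂ hp₂)
    k≈ = proj₂ (proj₂ (Jacobi-derivative B (square 𝓺) (proj₂ hp₂) (proj₂ hd₂) hk))

-- Kronecker's identity

module Kronecker (R : CommutativeRing 0ℓ 0ℓ) (h : CommutativeRing.Carrier R)
                 (h+h : CommutativeRing._≈_ R (CommutativeRing._+_ R h h) (CommutativeRing.1# R)) where
  open CommutativeRing R
  open RingTools R
  open Summation R
  open Signs R
  open Theta R h h+h
  open Algebra.Properties.Ring ring using (-‿distribˡ-*; -‿distribʳ-*; -0#≈0#; -‿involutive)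
  open import Relation.Binary.Reasoning.Setoid setoid

  -- The sign pattern of Kronecker's double series: the sum over a, b ≥ 0 minus the sum over a, b <
  -- 0.
  ε : ℤ → ℤ → Carrier
  ε (+ _)    (+ _)    = 1#
  ε (+ _)    -[1+ _ ] = 0#
  ε -[1+ _ ] (+ _)    = 0#
  ε -[1+ _ ] -[1+ _ ] = - 1#

  -- This is 4 x y for x = a + 1/2 and y = b + 1/2, positive wherever `ε` is nonzero.
  odd² : ℤ → ℤ → ℤ
  odd² a b = (+ 1 ℤ.+ (a ℤ.+ a)) ℤ.* (+ 1 ℤ.+ (b ℤ.+ b))

  private
    ε-support : ∀ a b → (ε a b ≈ 0#) ⊎ (∃ λ n → odd² a b ≡ + suc n)
    ε-support (+ m)    (+ n)    = inj₂ (_ , ≡.refl)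
    ε-support (+ m)    -[1+ n ] = inj₁ refl
    ε-support -[1+ m ] (+ n)    = inj₁ refl
    ε-support -[1+ m ] -[1+ n ] = inj₂ (_ , ≡.refl)

    ε-comm : ∀ a b → ε a b ≡ ε b a
    ε-comm (+ m)    (+ n)    = ≡.refl
    ε-comm (+ m)    -[1+ n ] = ≡.refl
    ε-comm -[1+ m ] (+ n)    = ≡.refl
    ε-comm -[1+ m ] -[1+ n ] = ≡.refl

    δ₋₁ : ℤ → Carrier
    δ₋₁ b = pick (b == -[1+ 0 ]) 1#

    -- The jump between b = -1 and b = 0 is the same for every a: from 0 to 1 when a ≥ 0, from -1 to
    -- 0 when a < 0.
    ε-suc : ∀ a b → ε a (+ 1 ℤ.+ b) ≈ ε a b + δ₋₁ b
    ε-suc (+ m)    (+ n)          = sym (+-identityʳ _)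
    ε-suc -[1+ m ] (+ n)          = sym (+-identityʳ _)
    ε-suc (+ m)    -[1+ zero ]    = sym (+-identityˡ _)
    ε-suc -[1+ m ] -[1+ zero ]    = sym (-‿inverseˡ _)
    ε-suc (+ m)    -[1+ suc n ]   = sym (+-identityʳ _)
    ε-suc -[1+ m ] -[1+ suc n ]   = sym (+-identityʳ _)

    ∣odd∣ : ∀ a → ∃ λ x → (∣ + 1 ℤ.+ (a ℤ.+ a) ∣ ≡ suc x) × (∣ a ∣ ℕ.≤ suc x)
    ∣odd∣ (+ n)    = _ , ≡.refl , ℕₚ.≤-trans (ℕₚ.m≤m+n n n) (ℕₚ.n≤1+n _)
    ∣odd∣ -[1+ n ] = _ , ≡.refl , s≤s (ℕₚ.m≤m+n n n)

    ∣odd²∣-≥ : ∀ a b → (∣ a ∣ ℕ.≤ ∣ odd² a b ∣) × (∣ b ∣ ℕ.≤ ∣ odd² a b ∣)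
    ∣odd²∣-≥ a b with ∣odd∣ a | ∣odd∣ b
    ... | x , ax , a≤ | y , by , b≤ rewrite ℤₚ.abs-* (+ 1 ℤ.+ (a ℤ.+ a)) (+ 1 ℤ.+ (b ℤ.+ b)) | ax | by =
      ℕₚ.≤-trans a≤ (ℕₚ.m≤m*n (suc x) (suc y)) , ℕₚ.≤-trans b≤ (ℕₚ.m≤n*m (suc y) (suc x))

    box : ℕ → List (ℤ × ℤ)
    box K = cartesianProduct (ints K) (ints K)

    ∉box : ∀ {K a b} → (a , b) ∉ box K → K ℕ.< ∣ odd² a b ∣
    ∉box {K} {a} {b} ab∉ with ℕₚ.<-≤-connex K ∣ odd² a b ∣
    ... | inj₁ K< = K<
    ... | inj₂ ≤K = ⊥-elim (ab∉ (∈ₚ.∈-cartesianProduct⁺ (∈ints (ℕₚ.≤-trans (proj₁ (∣odd²∣-≥ a b)) ≤K))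
                                                      (∈ints (ℕₚ.≤-trans (proj₂ (∣odd²∣-≥ a b)) ≤K))))

    -- By `ε-suc`, passing from the line a + b = q to the next one adds a single 1, at a = q + 1. On
    -- the line q = 0 only a = b = 0 counts.
    HasSum-ε : ∀ q → HasSum (λ a → ε a (q ℤ.- a)) (fromℤ (+ 1 ℤ.+ q))
    HasSum-ε = ℤ-ind _ (HasSum-cong base (HasSum-pick (+ 0) 1#))
      (λ q hq → HasSum-resp (trans (+-comm _ _) (sym (fromℤ-+ (+ 1) (+ 1 ℤ.+ q))))
        (HasSum-cong (λ a → sym (step q a)) (HasSum-+ hq (HasSum-pick (+ 1 ℤ.+ q) 1#))))
      (λ q hq → HasSum-resp (trans (+-congʳ (fromℤ-+ (+ 1) (+ 1 ℤ.+ q)))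
          (Solver.solve 1 (λ x → (con (+ 1) :+ x) :+ :- con (+ 1) := x) refl (fromℤ (+ 1 ℤ.+ q))))
        (HasSum-cong (λ a → trans (+-congʳ (step q a))
          (Solver.solve 2 (λ x y → x :+ y :+ :- y := x) refl (ε a (q ℤ.- a)) (pick (a == + 1 ℤ.+ q) 1#)))
          (HasSum-+ hq (HasSum-neg (HasSum-pick (+ 1 ℤ.+ q) 1#)))))
      where
      open Solver using (con; _:+_; :-_; _:=_)
      base : ∀ a → pick (a == + 0) 1# ≈ ε a (+ 0 ℤ.- a)
      base (+ zero)   = refl
      base (+ suc n)  = refl
      base -[1+ n ]   = refl
      lem : ∀ q a → (+ 1 ℤ.+ q) ℤ.- a ≡ + 1 ℤ.+ (q ℤ.- a)
      lem = solve-∀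
      to : ∀ q a → q ℤ.- a ≡ -[1+ 0 ] → a ≡ + 1 ℤ.+ q
      to q a eq = ≡.trans (aux q a) (≡.trans (≡.cong (λ z → q ℤ.- z) eq) (ℤₚ.+-comm q (+ 1)))
        where
        aux : ∀ q a → a ≡ q ℤ.- (q ℤ.- a)
        aux = solve-∀
      from : ∀ q a → a ≡ + 1 ℤ.+ q → q ℤ.- a ≡ -[1+ 0 ]
      from q _ ≡.refl = aux q
        where
        aux : ∀ q → q ℤ.- (+ 1 ℤ.+ q) ≡ -[1+ 0 ]
        aux = solve-∀
      step : ∀ q a → ε a ((+ 1 ℤ.+ q) ℤ.- a) ≈ ε a (q ℤ.- a) + pick (a == + 1 ℤ.+ q) 1#
      step q a = trans (reflexive (≡.cong (ε a) (lem q a))) (trans (ε-suc a (q ℤ.- a))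
        (+-congˡ (pick-⇔ (q ℤ.- a == -[1+ 0 ]) (a == + 1 ℤ.+ q) (to q a) (from q a) (λ _ → refl))))

  -- The exponent of t in the (a , b)-term of the coefficient at (r , s) of the product with the theta functions.
  level : ℤ → ℤ → ℤ → ℤ → ℤ
  level r s a b = odd² a b ℤ.+ (((r ℤ.- a) ℤ.* (r ℤ.- a) ℤ.+ (r ℤ.- a) ℤ.* (r ℤ.- a))
                            ℤ.+ ((s ℤ.- b) ℤ.* (s ℤ.- b) ℤ.+ (s ℤ.- b) ℤ.* (s ℤ.- b)))

  levelℕ : ℤ → ℤ → ℤ → ℤ → ℕ
  levelℕ r s a b = ∣ odd² a b ∣ ℕ.+ ((sq (r ℤ.- a) ℕ.+ sq (r ℤ.- a)) ℕ.+ (sq (s ℤ.- b) ℕ.+ sq (s ℤ.- b)))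

  private
    level-ℕ : ∀ r s a b {n} → odd² a b ≡ + suc n → level r s a b ≡ + levelℕ r s a b
    level-ℕ r s a b {n} eq = ≡.cong₂ ℤ._+_ (≡.trans eq (≡.sym (≡.cong (λ z → + ∣ z ∣) eq)))
      (≡.sym (≡.cong₂ (λ x y → (x ℤ.+ x) ℤ.+ (y ℤ.+ y)) (+sq (r ℤ.- a)) (+sq (s ℤ.- b))))

    twist : ℤ → ℤ → ℤ → ℤ → Carrier
    twist r s a b = ε a b * (sg (r ℤ.- a) * sg (s ℤ.- b))

    slice : ℤ → ℤ → ℤ → ℤ × ℤ → Carrier
    slice r s k (a , b) = pick (level r s a b == k) (twist r s a b)

    slice-0 : ∀ r s k a b → (∀ n → odd² a b ≡ + suc n → + levelℕ r s a b ≢ k) → slice r s k (a , b) ≈ 0#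
    slice-0 r s k a b no-level with ε-support a b
    ... | inj₁ ε≈0      = vanishing (level r s a b == k) (trans (*-congʳ ε≈0) (zeroˡ _))
      where
      vanishing : {P : Set} (d : Dec P) {x : Carrier} → x ≈ 0# → pick d x ≈ 0#
      vanishing (yes _) x≈0 = x≈0
      vanishing (no _)  x≈0 = refl
    ... | inj₂ (n , eq) = pick-no (level r s a b == k) (λ lk → no-level n eq (≡.trans (≡.sym (level-ℕ r s a b eq)) lk))

    slice-out : ∀ r s k a b → (a , b) ∉ box ∣ k ∣ → slice r s k (a , b) ≈ 0#
    slice-out r s k a b ab∉ = slice-0 r s k a b (λ n eq lk → ℕₚ.<-irrefl (≡.cong ∣_∣ (≡.sym lk))
      (ℕₚ.<-≤-trans (∉box {∣ k ∣} {a} {b} ab∉) (ℕₚ.m≤m+n _ _)))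

    slice-sum : ∀ r s k → ∃ λ v → HasSum (slice r s k) v
    slice-sum r s k = _ , fromSupport (slice r s k) (box ∣ k ∣) (λ (a , b) → slice-out r s k a b)

    -- The coefficient of t^k exp ((r + s + 1) u + (r - s) v) in the product of the double series
    -- with the two theta functions. It is a finite sum before any truncation, so k may be any
    -- integer, as the descent in k requires.
    V : ℤ → ℤ → ℤ → Carrier
    V r s k = proj₁ (slice-sum r s k)

    -- On the support of `ε` the level is a positive `odd²` plus squares.
    V-nonpos : ∀ r s k → k ℤ.≤ + 0 → V r s k ≈ 0#
    V-nonpos r s k k≤0 = HasSum-unique (proj₂ (slice-sum r s k)) (HasSum-0 λ (a , b) → slice-0 r s k a b
      λ n eq lk → ℕₚ.<⇒≱ (s≤s z≤n) (ℕₚ.≤-trans (ℕₚ.≤-trans (ℕₚ.≤-reflexive (≡.sym (≡.cong ∣_∣ eq))) (ℕₚ.m≤m+n _ _))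
        (ℤₚ.drop‿+≤+ (≡.subst (ℤ._≤ + 0) (≡.sym lk) k≤0))))

    swap : ℤ × ℤ → ℤ × ℤ
    swap (a , b) = b , a

    V-comm : ∀ r s k → V r s k ≈ V s r k
    V-comm r s k = HasSum-unique (proj₂ (slice-sum r s k)) (HasSum-cong pt
      (HasSum-pull swap swap (λ _ → ≡.refl) (λ _ → ≡.refl) (proj₂ (slice-sum s r k))))
      where
      level-comm : ∀ a b → level s r b a ≡ level r s a b
      level-comm a b = lem r s a b
        where
        lem : ∀ r s a b → (+ 1 ℤ.+ (b ℤ.+ b)) ℤ.* (+ 1 ℤ.+ (a ℤ.+ a)) ℤ.+ (((s ℤ.- b) ℤ.* (s ℤ.- b) ℤ.+ (s ℤ.- b) ℤ.* (s ℤ.- b)) ℤ.+ ((r ℤ.- a) ℤ.* (r ℤ.- a) ℤ.+ (r ℤ.- a) ℤ.* (r ℤ.- a)))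
                        ≡ (+ 1 ℤ.+ (a ℤ.+ a)) ℤ.* (+ 1 ℤ.+ (b ℤ.+ b)) ℤ.+ (((r ℤ.- a) ℤ.* (r ℤ.- a) ℤ.+ (r ℤ.- a) ℤ.* (r ℤ.- a)) ℤ.+ ((s ℤ.- b) ℤ.* (s ℤ.- b) ℤ.+ (s ℤ.- b) ℤ.* (s ℤ.- b)))
        lem = solve-∀
      pt : ∀ ab → slice s r k (swap ab) ≈ slice r s k ab
      pt (a , b) = pick-⇔ (level s r b a == k) (level r s a b == k)
        (≡.trans (≡.sym (level-comm a b))) (≡.trans (level-comm a b))
        (λ _ → *-cong (reflexive (ε-comm b a)) (*-comm _ _))

    -- Raising r, s and b by 1 raises every level by the same 4 (r + 1) and flips the sign, while
    -- `ε` changes only by its jump at b = -1. So the two coefficients add up to a sum over the row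
    -- b = -1, which is antisymmetric under a ↦ 2 r + 1 - a. In analytic terms, the theta function
    -- vanishes at the pole of the double series.
    V-shift : ∀ r s k → V (+ 1 ℤ.+ r) (+ 1 ℤ.+ s) (k ℤ.+ + 4 ℤ.* (+ 1 ℤ.+ r)) ≈ - V r s k
    V-shift r s k = begin
      V′                  ≈⟨ Solver.solve 2 (λ x y → x := (x :+ y) :- y) refl V′ (V r s k) ⟩
      (V′ + V r s k) - V r s k ≈⟨ +-congʳ (odd-sum ρ ρρ pt (HasSum-cong (λ (a , b) → jump a b) total)) ⟩
      0# - V r s k        ≈⟨ +-identityˡ _ ⟩
      - V r s k           ∎
      where
      open Solver using (_:+_; _:-_; _:=_)
      k′ = k ℤ.+ + 4 ℤ.* (+ 1 ℤ.+ r)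
      V′ = V (+ 1 ℤ.+ r) (+ 1 ℤ.+ s) k′
      up down ρ : ℤ × ℤ → ℤ × ℤ
      up   (a , b) = a , + 1 ℤ.+ b
      down (a , b) = a , b ℤ.- + 1
      ρ    (a , b) = (+ 1 ℤ.+ (r ℤ.+ r)) ℤ.- a , b
      ρρ : ∀ ab → ρ (ρ ab) ≡ ab
      ρρ (a , b) = ≡.cong (_, b) (lem r a)
        where
        lem : ∀ r a → (+ 1 ℤ.+ (r ℤ.+ r)) ℤ.- ((+ 1 ℤ.+ (r ℤ.+ r)) ℤ.- a) ≡ a
        lem = solve-∀
      total : HasSum (λ ab → slice (+ 1 ℤ.+ r) (+ 1 ℤ.+ s) k′ (up ab) + slice r s k ab) (V′ + V r s k)
      total = HasSum-+ (HasSum-pull up down (λ (a , b) → ≡.cong (a ,_) (pred-suc b)) (λ (a , b) → ≡.cong (a ,_) (suc-pred b))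
                (proj₂ (slice-sum (+ 1 ℤ.+ r) (+ 1 ℤ.+ s) k′))) (proj₂ (slice-sum r s k))
      D : ℤ × ℤ → Carrier
      D (a , b) = pick (level r s a b == k) (- (δ₋₁ b * (sg (r ℤ.- a) * sg (s ℤ.- b))))
      jump : ∀ a b → slice (+ 1 ℤ.+ r) (+ 1 ℤ.+ s) k′ (up (a , b)) + slice r s k (a , b) ≈ D (a , b)
      jump a b = trans (+-congʳ (pick-⇔ (level (+ 1 ℤ.+ r) (+ 1 ℤ.+ s) a (+ 1 ℤ.+ b) == k′) (level r s a b == k) to from (λ _ → twist-up)))
                       (combine (level r s a b == k))
        where
        level-up : level (+ 1 ℤ.+ r) (+ 1 ℤ.+ s) a (+ 1 ℤ.+ b) ≡ level r s a b ℤ.+ + 4 ℤ.* (+ 1 ℤ.+ r)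
        level-up = lem r s a b
          where
          lem : ∀ r s a b → (+ 1 ℤ.+ (a ℤ.+ a)) ℤ.* (+ 1 ℤ.+ ((+ 1 ℤ.+ b) ℤ.+ (+ 1 ℤ.+ b))) ℤ.+
                 (((+ 1 ℤ.+ r ℤ.- a) ℤ.* (+ 1 ℤ.+ r ℤ.- a) ℤ.+ (+ 1 ℤ.+ r ℤ.- a) ℤ.* (+ 1 ℤ.+ r ℤ.- a)) ℤ.+
                  ((+ 1 ℤ.+ s ℤ.- (+ 1 ℤ.+ b)) ℤ.* (+ 1 ℤ.+ s ℤ.- (+ 1 ℤ.+ b)) ℤ.+ (+ 1 ℤ.+ s ℤ.- (+ 1 ℤ.+ b)) ℤ.* (+ 1 ℤ.+ s ℤ.- (+ 1 ℤ.+ b))))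
               ≡ (+ 1 ℤ.+ (a ℤ.+ a)) ℤ.* (+ 1 ℤ.+ (b ℤ.+ b)) ℤ.+ (((r ℤ.- a) ℤ.* (r ℤ.- a) ℤ.+ (r ℤ.- a) ℤ.* (r ℤ.- a)) ℤ.+ ((s ℤ.- b) ℤ.* (s ℤ.- b) ℤ.+ (s ℤ.- b) ℤ.* (s ℤ.- b))) ℤ.+ + 4 ℤ.* (+ 1 ℤ.+ r)
          lem = solve-∀
        to : _ → level r s a b ≡ k
        to eq = Algebra.Properties.Ring.+-cancelʳ ℤₚ.+-*-ring (+ 4 ℤ.* (+ 1 ℤ.+ r)) _ _ (≡.trans (≡.sym level-up) eq)
        from : level r s a b ≡ k → _
        from eq = ≡.trans level-up (≡.cong (λ z → z ℤ.+ + 4 ℤ.* (+ 1 ℤ.+ r)) eq)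
        sg₁ : sg (+ 1 ℤ.+ r ℤ.- a) ≈ - sg (r ℤ.- a)
        sg₁ = trans (reflexive (≡.cong sg (ℤₚ.+-assoc (+ 1) r (ℤ.- a)))) (sg-suc (r ℤ.- a))
        sg₂ : sg (+ 1 ℤ.+ s ℤ.- (+ 1 ℤ.+ b)) ≡ sg (s ℤ.- b)
        sg₂ = ≡.cong sg (lem s b)
          where
          lem : ∀ s b → + 1 ℤ.+ s ℤ.- (+ 1 ℤ.+ b) ≡ s ℤ.- b
          lem = solve-∀
        twist-up : twist (+ 1 ℤ.+ r) (+ 1 ℤ.+ s) a (+ 1 ℤ.+ b) ≈ (ε a b + δ₋₁ b) * - (sg (r ℤ.- a) * sg (s ℤ.- b))
        twist-up = *-cong (ε-suc a b) (trans (*-cong sg₁ (reflexive sg₂)) (sym (-‿distribˡ-* _ _)))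
        combine : {P : Set} (d : Dec P) → pick d ((ε a b + δ₋₁ b) * - (sg (r ℤ.- a) * sg (s ℤ.- b))) + pick d (twist r s a b)
                                          ≈ pick d (- (δ₋₁ b * (sg (r ℤ.- a) * sg (s ℤ.- b))))
        combine (yes _) = Solver.solve 3 (λ e d x → (e :+ d) :* (:- x) :+ e :* x := :- (d :* x)) refl (ε a b) (δ₋₁ b) _
          where open Solver using (_:*_; :-_)
        combine (no _)  = +-identityʳ _
      pt : ∀ ab → D (ρ ab) ≈ - D ab
      pt (a , b) = reflected (b == -[1+ 0 ])
        where
        a′ = (+ 1 ℤ.+ (r ℤ.+ r)) ℤ.- a
        pick-neg : {P : Set} (d : Dec P) {x : Carrier} → pick d (- x) ≈ - pick d x
        pick-neg (yes _) = refl
        pick-neg (no _)  = sym -0#≈0#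
        pick-0 : {P : Set} (d : Dec P) {x : Carrier} → x ≈ 0# → pick d (- x) ≈ 0#
        pick-0 (yes _) x≈0 = trans (-‿cong x≈0) -0#≈0#
        pick-0 (no _)  x≈0 = refl
        reflected : Dec (b ≡ -[1+ 0 ]) → D (a′ , b) ≈ - D (a , b)
        reflected (no b≢) = trans (pick-0 (level r s a′ b == k) δ0) (trans (sym -0#≈0#) (-‿cong (sym (pick-0 (level r s a b == k) δ0))))
          where
          δ0 : ∀ {x} → δ₋₁ b * x ≈ 0#
          δ0 = trans (*-congʳ (pick-no (b == -[1+ 0 ]) b≢)) (zeroˡ _)
        reflected (yes ≡.refl) = trans (pick-⇔ (level r s a′ b == k) (level r s a b == k)
          (≡.trans (≡.sym (lem r s a))) (≡.trans (lem r s a)) (λ _ → -‿cong (trans (*-congˡ (trans (*-congʳ sg-a′) (sym (-‿distribˡ-* _ _)))) (sym (-‿distribʳ-* _ _)))))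
          (pick-neg (level r s a b == k))
          where
          lem : ∀ r s a → (+ 1 ℤ.+ ((+ 1 ℤ.+ (r ℤ.+ r) ℤ.- a) ℤ.+ (+ 1 ℤ.+ (r ℤ.+ r) ℤ.- a))) ℤ.* (+ 1 ℤ.+ (-[1+ 0 ] ℤ.+ -[1+ 0 ])) ℤ.+
                 (((r ℤ.- (+ 1 ℤ.+ (r ℤ.+ r) ℤ.- a)) ℤ.* (r ℤ.- (+ 1 ℤ.+ (r ℤ.+ r) ℤ.- a)) ℤ.+ (r ℤ.- (+ 1 ℤ.+ (r ℤ.+ r) ℤ.- a)) ℤ.* (r ℤ.- (+ 1 ℤ.+ (r ℤ.+ r) ℤ.- a))) ℤ.+
                  ((s ℤ.- -[1+ 0 ]) ℤ.* (s ℤ.- -[1+ 0 ]) ℤ.+ (s ℤ.- -[1+ 0 ]) ℤ.* (s ℤ.- -[1+ 0 ])))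
               ≡ (+ 1 ℤ.+ (a ℤ.+ a)) ℤ.* (+ 1 ℤ.+ (-[1+ 0 ] ℤ.+ -[1+ 0 ])) ℤ.+ (((r ℤ.- a) ℤ.* (r ℤ.- a) ℤ.+ (r ℤ.- a) ℤ.* (r ℤ.- a)) ℤ.+ ((s ℤ.- -[1+ 0 ]) ℤ.* (s ℤ.- -[1+ 0 ]) ℤ.+ (s ℤ.- -[1+ 0 ]) ℤ.* (s ℤ.- -[1+ 0 ])))
          lem = solve-∀
          sg-a′ : sg (r ℤ.- a′) ≈ - sg (r ℤ.- a)
          sg-a′ = trans (reflexive (≡.trans (≡.cong sg (lem′ r a)) (sg-neg (+ 1 ℤ.+ (r ℤ.- a))))) (sg-suc (r ℤ.- a))
            where
            lem′ : ∀ r a → r ℤ.- (+ 1 ℤ.+ (r ℤ.+ r) ℤ.- a) ≡ ℤ.- (+ 1 ℤ.+ (r ℤ.- a))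
            lem′ = solve-∀

    -- Raise (r, s), exchange the two indices, and lower again: the shifts 4 (r + 1) and 4 (s + 1)
    -- do not cancel.
    V-period : ∀ r s k → V r s k ≈ V r s (k ℤ.+ + 4 ℤ.* (r ℤ.- s))
    V-period r s k = begin
      V r s k                 ≈⟨ -‿involutive _ ⟨
      - - V r s k             ≈⟨ -‿cong (V-shift r s k) ⟨
      - V (+ 1 ℤ.+ r) (+ 1 ℤ.+ s) k₁   ≈⟨ -‿cong (V-comm (+ 1 ℤ.+ r) (+ 1 ℤ.+ s) k₁) ⟩
      - V (+ 1 ℤ.+ s) (+ 1 ℤ.+ r) k₁   ≡⟨ ≡.cong (λ z → - V (+ 1 ℤ.+ s) (+ 1 ℤ.+ r) z) (lem r s k) ⟩
      - V (+ 1 ℤ.+ s) (+ 1 ℤ.+ r) (k₂ ℤ.+ + 4 ℤ.* (+ 1 ℤ.+ s)) ≈⟨ -‿cong (V-shift s r k₂) ⟩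
      - - V s r k₂            ≈⟨ -‿involutive _ ⟩
      V s r k₂                ≈⟨ V-comm s r k₂ ⟩
      V r s k₂                ∎
      where
      k₁ = k ℤ.+ + 4 ℤ.* (+ 1 ℤ.+ r)
      k₂ = k ℤ.+ + 4 ℤ.* (r ℤ.- s)
      lem : ∀ r s k → k ℤ.+ + 4 ℤ.* (+ 1 ℤ.+ r) ≡ k ℤ.+ + 4 ℤ.* (r ℤ.- s) ℤ.+ + 4 ℤ.* (+ 1 ℤ.+ s)
      lem = solve-∀

    -- For r < s the period is negative, so repeated translation brings k down to the range of
    -- `V-nonpos`.
    V-descent : ∀ r s m → r ℤ.- s ≡ -[1+ m ] → ∀ n k → k ℤ.≤ + n → V r s k ≈ 0#
    V-descent r s m d zero    k k≤ = V-nonpos r s k k≤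
    V-descent r s m d (suc n) k k≤ = trans (V-period r s k) (V-descent r s m d n _ bound)
      where
      bound : k ℤ.+ + 4 ℤ.* (r ℤ.- s) ℤ.≤ + n
      bound = ≡.subst (λ z → k ℤ.+ + 4 ℤ.* z ℤ.≤ + n) (≡.sym d)
        (ℤₚ.≤-trans (ℤₚ.+-mono-≤ k≤ (≤-1 m)) (ℤₚ.≤-reflexive (lem (+ n))))
        where
        ≤-1 : ∀ m → + 4 ℤ.* -[1+ m ] ℤ.≤ -[1+ 0 ]
        ≤-1 m = ℤ.-≤- z≤n
        lem : ∀ n → + 1 ℤ.+ n ℤ.+ -[1+ 0 ] ≡ n
        lem = solve-∀

    k≤∣k∣ : ∀ k → k ℤ.≤ + ∣ k ∣
    k≤∣k∣ (+ n)    = ℤₚ.≤-refl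
    k≤∣k∣ -[1+ n ] = ℤ.-≤+

    V-zero : ∀ r s → r ≢ s → ∀ k → V r s k ≈ 0#
    V-zero r s r≢s k = by-sign (r ℤ.- s) ≡.refl
      where
      by-sign : ∀ d → r ℤ.- s ≡ d → V r s k ≈ 0#
      by-sign -[1+ m ]   eq = V-descent r s m eq ∣ k ∣ k (k≤∣k∣ k)
      by-sign (+ suc m)  eq = trans (V-comm r s k) (V-descent s r m (≡.trans (lem r s) (≡.cong ℤ.-_ eq)) ∣ k ∣ k (k≤∣k∣ k))
        where
        lem : ∀ r s → s ℤ.- r ≡ ℤ.- (r ℤ.- s)
        lem = solve-∀
      by-sign (+ zero)   eq = ⊥-elim (r≢s (ℤₚ.i-j≡0⇒i≡j r s eq))

  -- `E s d` stands for exp (s u + d v). The constant family 1 is the specialisation u = v = 0, used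
  -- for `theta-square`.
  module Product {B} (𝓣 : Nome B) (E : ℤ → ℤ → Carrier)
                 (E-+ : ∀ s s′ d d′ → E (s ℤ.+ s′) (d ℤ.+ d′) ≈ E s d * E s′ d′) where
    open Nome 𝓣

    e₁ e₂ o₁ o₂ : ℤ → Carrier
    e₁ j = E (j ℤ.+ j) (+ 0) * T (sq (j ℤ.+ j))
    e₂ j = E (+ 0) (j ℤ.+ j) * T (sq (j ℤ.+ j))
    o₁ j = E (j ℤ.+ j ℤ.- + 1) (+ 0) * T (sq (j ℤ.+ j ℤ.- + 1))
    o₂ j = E (+ 0) (j ℤ.+ j ℤ.- + 1) * T (sq (j ℤ.+ j ℤ.- + 1))

    θθ : ℤ × ℤ → Carrier
    θθ (n , m) = (sg n * sg m) * E (n ℤ.+ m) (n ℤ.- m) * T ((sq n ℕ.+ sq n) ℕ.+ (sq m ℕ.+ sq m))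

    private
      T-cong : ∀ {m n} → m ≡ n → T m ≈ T n
      T-cong eq = reflexive (≡.cong T eq)

      E-cong : ∀ {s s′ d d′} → s ≡ s′ → d ≡ d′ → E s d ≈ E s′ d′
      E-cong eq eq′ = reflexive (≡.cong₂ E eq eq′)

      E-split : ∀ s d → E s d ≈ E s (+ 0) * E (+ 0) d
      E-split s d = trans (E-cong (≡.sym (ℤₚ.+-identityʳ s)) (≡.sym (ℤₚ.+-identityˡ d))) (E-+ s (+ 0) (+ 0) d)

    -- In the variables M = n + m and N = n - m the exponent 2 n² + 2 m² becomes M² + N². M and N
    -- have the same parity, and the sign (-1)^M is plus on even pairs and minus on odd ones.
    theta-product : ∀ {a b c d} → HasSum e₁ a → HasSum e₂ b → HasSum o₁ c → HasSum o₂ d → HasSum θθ (a * b - c * d)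
    theta-product {c = c} {d} ha hb hc hd = rotate
      (HasSum-cong (λ (j , k) → pt₁ j k) (HasSum-× ha hb))
      (HasSum-resp (sym (-‿distribˡ-* c d)) (HasSum-cong (λ (j , k) → pt₂ j k) (HasSum-× (HasSum-neg hc)
        (HasSum-up hd))))
      where
      collect : ∀ {σ s d M N e} → s ≡ M → d ≡ N → e ≡ sq M ℕ.+ sq N →
                σ * (E M (+ 0) * T (sq M)) * (E (+ 0) N * T (sq N)) ≈ σ * E s d * T e
      collect {σ} {M = M} {N} ≡.refl ≡.refl ≡.refl = begin
        σ * (E M (+ 0) * T (sq M)) * (E (+ 0) N * T (sq N))
          ≈⟨ Solver.solve 5 (λ s x u y v → s :* (x :* u) :* (y :* v) := s :* (x :* y) :* (u :* v)) refl σ _ _ _ _ ⟩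
        σ * (E M (+ 0) * E (+ 0) N) * (T (sq M) * T (sq N)) ≈⟨ *-cong (*-congˡ (E-split M N)) (T-+ _ _) ⟨
        σ * E M N * T (sq M ℕ.+ sq N) ∎
        where open Solver using (_:*_; _:=_)
      exponent : ∀ n m M N → n ℤ.+ m ≡ M → n ℤ.- m ≡ N → (sq n ℕ.+ sq n) ℕ.+ (sq m ℕ.+ sq m) ≡ sq M ℕ.+ sq N
      exponent n m _ _ ≡.refl ≡.refl = exp≡ (≡.cong₂ (λ x y → (x ℤ.+ x) ℤ.+ (y ℤ.+ y)) (+sq n) (+sq m))
        (≡.cong₂ ℤ._+_ (+sq (n ℤ.+ m)) (+sq (n ℤ.- m))) (lem n m)
        where
        lem : ∀ n m → (n ℤ.* n ℤ.+ n ℤ.* n) ℤ.+ (m ℤ.* m ℤ.+ m ℤ.* m) ≡ (n ℤ.+ m) ℤ.* (n ℤ.+ m) ℤ.+ (n ℤ.- m) ℤ.* (n ℤ.- m)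
        lem = solve-∀
      M₁ : ∀ j k → (j ℤ.+ k) ℤ.+ (j ℤ.- k) ≡ j ℤ.+ j
      M₁ = solve-∀
      N₁ : ∀ j k → (j ℤ.+ k) ℤ.- (j ℤ.- k) ≡ k ℤ.+ k
      N₁ = solve-∀
      M₂ : ∀ j k → (j ℤ.+ k) ℤ.+ (j ℤ.- + 1 ℤ.- k) ≡ j ℤ.+ j ℤ.- + 1
      M₂ = solve-∀
      N₂ : ∀ j k → (j ℤ.+ k) ℤ.- (j ℤ.- + 1 ℤ.- k) ≡ (+ 1 ℤ.+ k) ℤ.+ (+ 1 ℤ.+ k) ℤ.- + 1
      N₂ = solve-∀
      pt₁ : ∀ j k → e₁ j * e₂ k ≈ θθ (j ℤ.+ k , j ℤ.- k)
      pt₁ j k = trans (*-congʳ (sym (*-identityˡ _))) (trans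
        (collect (M₁ j k) (N₁ j k) (exponent (j ℤ.+ k) (j ℤ.- k) _ _ (M₁ j k) (N₁ j k)))
        (*-congʳ (*-congʳ (sym (trans (sym (sg-+ (j ℤ.+ k) (j ℤ.- k))) (trans (reflexive (≡.cong sg (M₁ j k))) (trans (sg-+ j j) (sg² j))))))))
      pt₂ : ∀ j k → - o₁ j * o₂ (+ 1 ℤ.+ k) ≈ θθ (j ℤ.+ k , j ℤ.- + 1 ℤ.- k)
      pt₂ j k = trans (*-congʳ (Solver.solve 1 (λ x → :- x := (:- con (+ 1)) :* x) refl (o₁ j))) (trans
        (collect (M₂ j k) (N₂ j k) (exponent (j ℤ.+ k) (j ℤ.- + 1 ℤ.- k) _ _ (M₂ j k) (N₂ j k)))
        (*-congʳ (*-congʳ (sym (trans (sym (sg-+ (j ℤ.+ k) (j ℤ.- + 1 ℤ.- k))) (trans (reflexive (≡.cong sg (M₂ j k)))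
          (trans (sg-+ (j ℤ.+ j) -[1+ 0 ]) (trans (*-congʳ (trans (sg-+ j j) (sg² j))) (*-identityˡ _)))))))))
        where open Solver using (con; :-_; _:*_; _:=_)

    -- For x = a + 1/2 and y = b + 1/2 the sum of G is that of (E (x + y) (x - y) - E (- x - y) (y - x)) t^(4xy)
    -- over all x, y > 0; the factor ε spreads it over ℤ × ℤ.
    G : ℤ × ℤ → Carrier
    G (a , b) = ε a b * E (+ 1 ℤ.+ (a ℤ.+ b)) (a ℤ.- b) * T ∣ odd² a b ∣

    private
      term : ℤ → ℤ → ℤ × ℤ → Carrier
      term r s (a , b) = twist r s a b * T (levelℕ r s a b)

      out-of-box : ∀ {a b} → (a , b) ∉ box B → ∀ {n} → T (∣ odd² a b ∣ ℕ.+ n) ≈ 0#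
      out-of-box {a} {b} ab∉ = T-null _ (ℕₚ.≤-trans (ℕₚ.<⇒≤ (∉box {B} {a} {b} ab∉)) (ℕₚ.m≤m+n _ _))

      term-sum : ∀ r s → ∃ (HasSum (term r s))
      term-sum r s = _ , fromSupport (term r s) (box B) λ (a , b) ab∉ → trans (*-congˡ (out-of-box {a} {b} ab∉)) (zeroʳ _)

      -- The terms are sorted by their exponent k of t: the fibre over k sums to t^k `V r s k`,
      -- which is 0, and only finitely many k matter because t is nilpotent.
      term-offdiagonal : ∀ r s → r ≢ s → HasSum (term r s) 0#
      term-offdiagonal r s r≢s = HasSum-resp x≈0 (HasSum-fibreʳ total λ (a , b) → column a b)
        where
        F : ℕ × (ℤ × ℤ) → Carrier
        F (k , ab) = T k * slice r s (+ k) ab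
        total : HasSum F _
        total = fromSupport F (cartesianProduct (upTo B) (box B)) outside
          where
          outside : ∀ kab → kab ∉ cartesianProduct (upTo B) (box B) → F kab ≈ 0#
          outside (k , a , b) kab∉ with ℕₚ.<-≤-connex k B
          ... | inj₂ B≤k = trans (*-congʳ (T-null k B≤k)) (zeroˡ _)
          ... | inj₁ k<B = trans (*-congˡ (slice-0 r s (+ k) a b λ n eq lk → ℕₚ.<⇒≱ k<B
            (ℕₚ.≤-trans (ℕₚ.<⇒≤ (∉box {B} {a} {b} (λ ab∈ → kab∉ (∈ₚ.∈-cartesianProduct⁺ (∈ₚ.∈-upTo⁺ k<B) ab∈))))
              (ℕₚ.≤-trans (ℕₚ.m≤m+n _ _) (ℕₚ.≤-reflexive (ℤₚ.+-injective lk)))))) (zeroʳ _)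
        x≈0 : _ ≈ 0#
        x≈0 = sym (HasSum-unique (HasSum-0 (λ _ → refl)) (HasSum-fibre total (λ k → HasSum-resp
          (trans (*-congˡ (V-zero r s r≢s (+ k))) (zeroʳ _)) (HasSum-*ˡ (T k) (proj₂ (slice-sum r s (+ k)))))))
        column : ∀ a b → HasSum (λ k → T k * slice r s (+ k) (a , b)) (term r s (a , b))
        column a b with ε-support a b
        ... | inj₁ ε≈0 = HasSum-resp (sym (trans (*-congʳ (trans (*-congʳ ε≈0) (zeroˡ _))) (zeroˡ _)))
          (HasSum-0 λ k → trans (*-congˡ (pick-zero (level r s a b == + k))) (zeroʳ _))
          where
          pick-zero : {P : Set} (d : Dec P) → pick d (twist r s a b) ≈ 0#
          pick-zero (yes _) = trans (*-congʳ ε≈0) (zeroˡ _)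
          pick-zero (no _)  = refl
        ... | inj₂ (n , eq) = HasSum-cong (λ k → trans
          (pick-⇔ (k == levelℕ r s a b) (level r s a b == + k)
            (λ { ≡.refl → level-ℕ r s a b eq }) (λ lk → ℤₚ.+-injective (≡.trans (≡.sym lk) (level-ℕ r s a b eq)))
            (λ { ≡.refl → *-comm _ _ }))
          (pick-*ˡ (level r s a b == + k) (T k) _)) (HasSum-pick (levelℕ r s a b) _)

    module _ {c′ : Carrier} (hc′ : HasSum (λ p → fromℤ p * (sg p * T (quad p))) c′) where
      -- The terms with r = s only depend on p = a + b - r, and Σ_{a + b = p} ε a b = p + 1.
      term-diagonal : ∀ r → HasSum (term r r) (sg r * T (quad r) * (T 1 * c′))
      term-diagonal r = HasSum-resp (trans (HasSum-unique by-p value) (sym tidy)) (proj₂ (term-sum r r))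
        where
        φ ψ : ℤ × ℤ → ℤ × ℤ
        φ (p , a) = a , (p ℤ.+ r) ℤ.- a
        ψ (a , b) = (a ℤ.+ b) ℤ.- r , a
        ψφ : ∀ x → ψ (φ x) ≡ x
        ψφ (p , a) = ≡.cong (_, a) (lem r p a)
          where
          lem : ∀ r p a → (a ℤ.+ (p ℤ.+ r ℤ.- a)) ℤ.- r ≡ p
          lem = solve-∀
        φψ : ∀ x → φ (ψ x) ≡ x
        φψ (a , b) = ≡.cong (a ,_) (lem r a b)
          where
          lem : ∀ r a b → ((a ℤ.+ b) ℤ.- r ℤ.+ r) ℤ.- a ≡ b
          lem = solve-∀
        w = sg r * T (quad r) * T 1
        w-term : ∀ p a → (w * (sg p * T (quad p))) * ε a ((p ℤ.+ r) ℤ.- a) ≈ term r r (φ (p , a))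
        w-term p a with ε-support a ((p ℤ.+ r) ℤ.- a)
        ... | inj₁ ε≈0 = trans (*-congˡ ε≈0) (trans (zeroʳ _) (sym (trans (*-congʳ (trans (*-congʳ ε≈0) (zeroˡ _))) (zeroˡ _))))
        ... | inj₂ (n , eq) = begin
          (w * (sg p * T (quad p))) * ε a b      ≈⟨ Solver.solve 6 (λ s u t σ v e → ((s :* u :* t) :* (σ :* v)) :* e
                                                   := (e :* (s :* σ)) :* (u :* (t :* v))) refl (sg r) (T (quad r)) (T 1) (sg p) (T (quad p)) (ε a b) ⟩
          (ε a b * (sg r * sg p)) * (T (quad r) * (T 1 * T (quad p)))   ≈⟨ *-cong (*-congˡ signs) exponents ⟨
          term r r (a , b)                    ∎
          where
          open Solver using (_:*_; _:=_)
          b = (p ℤ.+ r) ℤ.- a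
          signs : sg (r ℤ.- a) * sg (r ℤ.- b) ≈ sg r * sg p
          signs = trans (sym (sg-+ (r ℤ.- a) (r ℤ.- b))) (trans (reflexive (≡.cong sg (lem r p a))) (trans (sg-+ r (ℤ.- p)) (*-congˡ (reflexive (sg-neg p)))))
            where
            lem : ∀ r p a → (r ℤ.- a) ℤ.+ (r ℤ.- (p ℤ.+ r ℤ.- a)) ≡ r ℤ.- p
            lem = solve-∀
          exponents : T (levelℕ r r a b) ≈ T (quad r) * (T 1 * T (quad p))
          exponents = trans (T-cong (exp≡ (≡.sym (level-ℕ r r a b eq))
              (≡.cong₂ (λ x y → x ℤ.+ (+ 1 ℤ.+ y)) (+quad r) (+quad p)) (lem r p a)))
            (trans (T-+ _ _) (*-congˡ (T-+ 1 (quad p))))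
            where
            lem : ∀ r p a → (+ 1 ℤ.+ (a ℤ.+ a)) ℤ.* (+ 1 ℤ.+ ((p ℤ.+ r ℤ.- a) ℤ.+ (p ℤ.+ r ℤ.- a))) ℤ.+ (((r ℤ.- a) ℤ.* (r ℤ.- a) ℤ.+ (r ℤ.- a) ℤ.* (r ℤ.- a)) ℤ.+ ((r ℤ.- (p ℤ.+ r ℤ.- a)) ℤ.* (r ℤ.- (p ℤ.+ r ℤ.- a)) ℤ.+ (r ℤ.- (p ℤ.+ r ℤ.- a)) ℤ.* (r ℤ.- (p ℤ.+ r ℤ.- a))))
                  ≡ ((r ℤ.* r ℤ.+ r) ℤ.+ (r ℤ.* r ℤ.+ r)) ℤ.+ (+ 1 ℤ.+ ((p ℤ.* p ℤ.+ p) ℤ.+ (p ℤ.* p ℤ.+ p)))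
            lem = solve-∀
        by-p : HasSum (λ p → (w * (sg p * T (quad p))) * fromℤ (+ 1 ℤ.+ (p ℤ.+ r))) (proj₁ (term-sum r r))
        by-p = HasSum-fibre (HasSum-cong (λ (p , a) → sym (w-term p a)) (HasSum-pull φ ψ ψφ φψ (proj₂ (term-sum r r))))
          (λ p → HasSum-*ˡ _ (HasSum-ε (p ℤ.+ r)))
        -- The weight 1 + p + r splits into p, which gives `c′`, and 1 + r, which multiplies the
        -- vanishing `quad-sum`.
        value : HasSum (λ p → (w * (sg p * T (quad p))) * fromℤ (+ 1 ℤ.+ (p ℤ.+ r))) (w * c′ + (w * fromℤ (+ 1 ℤ.+ r)) * proj₁ (quad-sum 𝓣))
        value = HasSum-cong pt (HasSum-+ (HasSum-*ˡ w hc′) (HasSum-*ˡ (w * fromℤ (+ 1 ℤ.+ r)) (proj₂ (quad-sum 𝓣))))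
          where
          lem : ∀ p r → + 1 ℤ.+ (p ℤ.+ r) ≡ p ℤ.+ (+ 1 ℤ.+ r)
          lem = solve-∀
          pt : ∀ p → _
          pt p = trans (Solver.solve 4 (λ w x y s → w :* (x :* s) :+ (w :* y) :* s := (w :* s) :* (x :+ y)) refl w (fromℤ p) (fromℤ (+ 1 ℤ.+ r)) (sg p * T (quad p)))
            (*-congˡ (sym (trans (reflexive (≡.cong fromℤ (lem p r))) (fromℤ-+ p (+ 1 ℤ.+ r)))))
            where open Solver using (_:+_; _:*_; _:=_)
        tidy : sg r * T (quad r) * (T 1 * c′) ≈ w * c′ + (w * fromℤ (+ 1 ℤ.+ r)) * proj₁ (quad-sum 𝓣)
        tidy = trans (sym (*-assoc _ _ _)) (trans (sym (+-identityʳ _)) (+-congˡ (sym (trans (*-congˡ (quad-sum≈0 𝓣 (proj₂ (quad-sum 𝓣)))) (zeroʳ _)))))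

      -- The product is regrouped by the total indices r = a + n and s = b + m; the fibres off the
      -- diagonal r = s are 0, and those on it are multiples of `c′`.
      Kronecker : ∀ {g q c} → HasSum G g → HasSum θθ q → HasSum (λ r → E (+ 1 ℤ.+ (r ℤ.+ r)) (+ 0) * (sg r * T (quad r))) c →
                  g * q ≈ c * (T 1 * c′)
      Kronecker {g} {q} {c} hg hq hc = HasSum-unique (HasSum-fibre product fibre) diagonal
        where
        φ ψ : (ℤ × ℤ) × (ℤ × ℤ) → (ℤ × ℤ) × (ℤ × ℤ)
        φ ((r , s) , (a , b)) = (a , b) , (r ℤ.- a , s ℤ.- b)
        ψ ((a , b) , (n , m)) = (n ℤ.+ a , m ℤ.+ b) , (a , b)
        cancel : ∀ r a → r ℤ.- a ℤ.+ a ≡ r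
        cancel = solve-∀
        cancel′ : ∀ n a → n ℤ.+ a ℤ.- a ≡ n
        cancel′ = solve-∀
        ψφ : ∀ x → ψ (φ x) ≡ x
        ψφ ((r , s) , (a , b)) = ≡.cong₂ (λ x y → (x , y) , (a , b)) (cancel r a) (cancel s b)
        φψ : ∀ x → φ (ψ x) ≡ x
        φψ ((a , b) , (n , m)) = ≡.cong₂ (λ x y → (a , b) , (x , y)) (cancel′ n a) (cancel′ m b)
        pt : ∀ r s a b → G (a , b) * θθ (r ℤ.- a , s ℤ.- b) ≈ E (+ 1 ℤ.+ (r ℤ.+ s)) (r ℤ.- s) * term r s (a , b)
        pt r s a b = begin
          _ ≈⟨ Solver.solve 6 (λ e x u σ y v → (e :* x :* u) :* (σ :* y :* v) := (x :* y) :* ((e :* σ) :* (u :* v))) refl _ _ _ _ _ _ ⟩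
          (E (+ 1 ℤ.+ (a ℤ.+ b)) (a ℤ.- b) * E _ _) * (twist r s a b * (T ∣ odd² a b ∣ * T _))
            ≈⟨ *-cong (E-+ _ _ _ _) (*-congˡ (T-+ _ _)) ⟨
          E _ _ * term r s (a , b) ≈⟨ *-congʳ (E-cong (lem₁ r s a b) (lem₂ r s a b)) ⟩
          _ ∎
          where
          open Solver using (_:*_; _:=_)
          lem₁ : ∀ r s a b → (+ 1 ℤ.+ (a ℤ.+ b)) ℤ.+ ((r ℤ.- a) ℤ.+ (s ℤ.- b)) ≡ + 1 ℤ.+ (r ℤ.+ s)
          lem₁ = solve-∀
          lem₂ : ∀ r s a b → (a ℤ.- b) ℤ.+ ((r ℤ.- a) ℤ.- (s ℤ.- b)) ≡ r ℤ.- s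
          lem₂ = solve-∀
        product : HasSum (λ ((r , s) , ab) → E (+ 1 ℤ.+ (r ℤ.+ s)) (r ℤ.- s) * term r s ab) (g * q)
        product = HasSum-cong (λ ((r , s) , (a , b)) → pt r s a b) (HasSum-pull φ ψ ψφ φψ (HasSum-× hg hq))
        f : ℤ × ℤ → Carrier
        f (r , s) = pick (r == s) (E (+ 1 ℤ.+ (r ℤ.+ s)) (r ℤ.- s) * (sg r * T (quad r) * (T 1 * c′)))
        fibre : ∀ rs → HasSum (λ ab → E (+ 1 ℤ.+ (proj₁ rs ℤ.+ proj₂ rs)) (proj₁ rs ℤ.- proj₂ rs) * term (proj₁ rs) (proj₂ rs) ab) (f rs)
        fibre (r , s) with r == s
        ... | yes ≡.refl = HasSum-*ˡ _ (term-diagonal r)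
        ... | no r≢s     = HasSum-resp (zeroʳ _) (HasSum-*ˡ _ (term-offdiagonal r s r≢s))
        diagonal : HasSum f (c * (T 1 * c′))
        diagonal = HasSum-push (λ r → r , r) (≡.cong proj₁) image
          (HasSum-resp (*-comm _ _) (HasSum-cong on-diagonal (HasSum-*ˡ (T 1 * c′) hc)))
          where
          image : ∀ rs → (∃ λ r → rs ≡ (r , r)) ⊎ (f rs ≈ 0#)
          image (r , s) with r == s
          ... | yes ≡.refl = inj₁ (r , ≡.refl)
          ... | no r≢s     = inj₂ refl
          on-diagonal : ∀ r → (T 1 * c′) * (E (+ 1 ℤ.+ (r ℤ.+ r)) (+ 0) * (sg r * T (quad r))) ≈ f (r , r)
          on-diagonal r = sym (trans (pick-yes (r == r) ≡.refl) (trans (*-congʳ (E-cong ≡.refl (ℤₚ.+-inverseʳ r)))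
            (Solver.solve 3 (λ x y z → x :* (y :* z) := z :* (x :* y)) refl (E (+ 1 ℤ.+ (r ℤ.+ r)) (+ 0)) (sg r * T (quad r)) (T 1 * c′))))
            where open Solver using (_:*_; _:=_)

-- Alternating forms and determinants

module Alternating (R : CommutativeRing 0ℓ 0ℓ) where
  open CommutativeRing R
  open RingTools R
  open Summation R
  open Algebra.Properties.Ring ring using (-‿distribˡ-*; -‿distribʳ-*; -0#≈0#; -‿involutive; -‿+-comm)
  open import Relation.Binary.Reasoning.Setoid setoid

  -- lap h [x₀, x₁, …] = Σᵢ (-1)ⁱ h xᵢ (the list without xᵢ), the shape of a Laplace expansion.
  lap : {X : Set} → (X → List X → Carrier) → List X → Carrier
  lap h []       = 0#
  lap h (x ∷ xs) = h x xs - lap (λ y ys → h y (x ∷ ys)) xs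

  private
    0-0≈0 : 0# - 0# ≈ 0#
    0-0≈0 = -‿inverseʳ 0#

  module _ {X : Set} where
    lap-cong-All : {P : X → Set} {h h′ : X → List X → Carrier} (xs : List X) → All P xs →
                   (∀ x ys → P x → All P ys → h x ys ≈ h′ x ys) → lap h xs ≈ lap h′ xs
    lap-cong-All []       _          eq = refl
    lap-cong-All (x ∷ xs) (px ∷ pxs) eq = +-cong (eq x xs px pxs)
      (-‿cong (lap-cong-All xs pxs (λ y ys py pys → eq y (x ∷ ys) py (px ∷ pys))))

    lap-cong : {h h′ : X → List X → Carrier} (xs : List X) → (∀ x ys → h x ys ≈ h′ x ys) → lap h xs ≈ lap h′ xs
    lap-cong []       eq = refl
    lap-cong (x ∷ xs) eq = +-cong (eq x xs) (-‿cong (lap-cong xs (λ y ys → eq y (x ∷ ys))))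

    lap-zero : {h : X → List X → Carrier} (xs : List X) → All (λ x → ∀ ys → h x ys ≈ 0#) xs → lap h xs ≈ 0#
    lap-zero []       _        = refl
    lap-zero (x ∷ xs) (z ∷ zs) = trans (+-cong (z xs) (-‿cong (lap-zero xs (All.map (λ w ys → w (x ∷ ys)) zs)))) 0-0≈0

    lap-linear : (c : Carrier) (h h′ : X → List X → Carrier) (xs : List X) →
                 lap (λ x ys → c * h x ys + h′ x ys) xs ≈ c * lap h xs + lap h′ xs
    lap-linear c h h′ []       = sym (trans (+-identityʳ _) (zeroʳ c))
    lap-linear c h h′ (x ∷ xs) = trans (+-congˡ (-‿cong (lap-linear c _ _ xs)))
      (solve 5 (λ c a b u v → (c :* a :+ b) :- (c :* u :+ v) := c :* (a :- u) :+ (b :- v)) refl c _ _ _ _)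
      where open Solver

    lap-*ˡ : (c : Carrier) (h : X → List X → Carrier) (xs : List X) → lap (λ x ys → c * h x ys) xs ≈ c * lap h xs
    lap-*ˡ c h []       = sym (zeroʳ c)
    lap-*ˡ c h (x ∷ xs) = trans (+-congˡ (-‿cong (lap-*ˡ c _ xs)))
      (solve 3 (λ c a u → c :* a :- c :* u := c :* (a :- u)) refl c _ _)
      where open Solver

    lap-*ʳ : (c : Carrier) (h : X → List X → Carrier) (xs : List X) → lap (λ x ys → h x ys * c) xs ≈ lap h xs * c
    lap-*ʳ c h xs = trans (lap-cong xs (λ _ _ → *-comm _ c)) (trans (lap-*ˡ c h xs) (*-comm c _))

    lap-map : {Y : Set} (f : Y → X) (h : X → List X → Carrier) (ys : List Y) →
              lap h (map f ys) ≡ lap (λ y zs → h (f y) (map f zs)) ys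
    lap-map f h []       = ≡.refl
    lap-map f h (y ∷ ys) = ≡.cong (λ s → h (f y) (map f ys) - s) (lap-map f _ ys)

  record IsLinear {A : Set} (Φ : (A → Carrier) → Carrier) : Set where
    field
      Φ-cong : ∀ {f g} → (∀ a → f a ≈ g a) → Φ f ≈ Φ g
      Φ-+    : ∀ f g → Φ (λ a → f a + g a) ≈ Φ f + Φ g
      Φ-*    : ∀ c f → Φ (λ a → c * f a) ≈ c * Φ f

    Φ-0 : Φ (λ _ → 0#) ≈ 0#
    Φ-0 = trans (Φ-cong (λ _ → sym (zeroˡ 0#))) (trans (Φ-* 0# (λ _ → 0#)) (zeroˡ _))

    Φ-neg : ∀ f → Φ (λ a → - f a) ≈ - Φ f
    Φ-neg f = trans (Φ-cong (λ a → sym (neg₁ (f a)))) (trans (Φ-* (- 1#) f) (neg₁ _))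
      where
      neg₁ : ∀ x → - 1# * x ≈ - x
      neg₁ x = trans (sym (-‿distribˡ-* 1# x)) (-‿cong (*-identityˡ x))

    Φ-lap : {X : Set} (F : X → List X → A → Carrier) (xs : List X) →
            Φ (λ a → lap (λ x ys → F x ys a) xs) ≈ lap (λ x ys → Φ (F x ys)) xs
    Φ-lap F []       = Φ-0
    Φ-lap F (x ∷ xs) = trans (Φ-+ _ _) (+-congˡ (trans (Φ-neg _) (-‿cong (Φ-lap _ xs))))

  module _ {Z : Set} where
    record IsAlternating (Ω : List (Z → Carrier) → Carrier) : Set where
      field
        linear      : ∀ pre post {x y z : Z → Carrier} {c} → (∀ ζ → x ζ ≈ c * y ζ + z ζ) →
                      Ω (pre ++ x ∷ post) ≈ c * Ω (pre ++ y ∷ post) + Ω (pre ++ z ∷ post)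
        alternating : ∀ pre post x → Ω (pre ++ x ∷ x ∷ post) ≈ 0#

    open IsAlternating

    -- The determinant of the values of the functions at the points, expanded along the first point.
    -- Lists of different lengths give 0, so the alternating laws hold without length conditions.
    det : List Z → List (Z → Carrier) → Carrier
    det []       []      = 1#
    det []       (_ ∷ _) = 0#
    det (z ∷ zs) xs      = lap (λ x ys → x z * det zs ys) xs

    private
      tail-alternating : ∀ {Ω} p → IsAlternating Ω → IsAlternating (λ ys → Ω (p ∷ ys))
      tail-alternating p a = record
        { linear = λ pre → linear a (p ∷ pre) ; alternating = λ pre → alternating a (p ∷ pre) }

      lap-linear′ : ∀ z {Ω} → IsAlternating Ω → ∀ pre post {x y w : Z → Carrier} {c} → (∀ ζ → x ζ ≈ c * y ζ + w ζ) →
        let L = lap (λ x ys → x z * Ω ys) in L (pre ++ x ∷ post) ≈ c * L (pre ++ y ∷ post) + L (pre ++ w ∷ post)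
      lap-linear′ z {Ω} a [] post {x} {y} {w} {c} eq = begin
        x z * Ω post - lap (λ u ys → u z * Ω (x ∷ ys)) post
          ≈⟨ +-cong (*-congʳ (eq z)) (-‿cong (trans (lap-cong post (λ u ys → trans (*-congˡ (linear a [] ys eq)) (distr (u z) _ _)))
               (lap-linear c (λ u ys → u z * Ω (y ∷ ys)) (λ u ys → u z * Ω (w ∷ ys)) post))) ⟩
        (c * y z + w z) * Ω post - (c * lap (λ u ys → u z * Ω (y ∷ ys)) post + lap (λ u ys → u z * Ω (w ∷ ys)) post)
          ≈⟨ solve 6 (λ c a b o u v → (c :* a :+ b) :* o :- (c :* u :+ v) := c :* (a :* o :- u) :+ (b :* o :- v)) refl c (y z) (w z) (Ω post) _ _ ⟩
        _ ∎
        where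
        open Solver
        distr : ∀ u o p → u * (c * o + p) ≈ c * (u * o) + u * p
        distr = solve 4 (λ c u o p → u :* (c :* o :+ p) := c :* (u :* o) :+ u :* p) refl c
      lap-linear′ z {Ω} a (p ∷ pre) post {c = c} eq = trans
        (+-cong (*-congˡ (linear a pre post eq)) (-‿cong (lap-linear′ z (tail-alternating p a) pre post eq)))
        (solve 6 (λ c q a b u v → q :* (c :* a :+ b) :- (c :* u :+ v) := c :* (q :* a :- u) :+ (q :* b :- v)) refl c (p z) _ _ _ _)
        where open Solver

      lap-alternating′ : ∀ z {Ω} → IsAlternating Ω → ∀ pre post x → lap (λ x ys → x z * Ω ys) (pre ++ x ∷ x ∷ post) ≈ 0#
      lap-alternating′ z {Ω} a [] post x = begin
        x z * Ω (x ∷ post) - (x z * Ω (x ∷ post) - lap (λ u ys → u z * Ω (x ∷ x ∷ ys)) post)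
          ≈⟨ +-congˡ (-‿cong (+-congˡ (-‿cong (lap-zero post (All.universal (λ u ys → trans (*-congˡ (alternating a [] ys x)) (zeroʳ _)) post))))) ⟩
        x z * Ω (x ∷ post) - (x z * Ω (x ∷ post) - 0#)
          ≈⟨ solve 1 (λ a → a :- (a :- con (+ 0)) := con (+ 0)) refl _ ⟩
        0# ∎
        where open Solver
      lap-alternating′ z a (p ∷ pre) post x = trans (+-cong (trans (*-congˡ (alternating a pre post x)) (zeroʳ _))
        (-‿cong (lap-alternating′ z (tail-alternating p a) pre post x))) 0-0≈0

    det-alternating : ∀ zs → IsAlternating (det zs)
    det-alternating []       = record
      { linear      = λ { []        post _ → sym (trans (+-identityʳ _) (zeroʳ _))
                        ; (_ ∷ pre) post _ → sym (trans (+-identityʳ _) (zeroʳ _)) }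
      ; alternating = λ { [] _ _ → refl ; (_ ∷ _) _ _ → refl } }
    det-alternating (z ∷ zs) = record
      { linear      = lap-linear′ z (det-alternating zs)
      ; alternating = lap-alternating′ z (det-alternating zs) }

    module _ {Ω : List (Z → Carrier) → Carrier} (a : IsAlternating Ω) where
      alternating-0 : ∀ pre post {x : Z → Carrier} → (∀ ζ → x ζ ≈ 0#) → Ω (pre ++ x ∷ post) ≈ 0#
      alternating-0 pre post {x} x≈0 = begin
        o               ≈⟨ solve 1 (λ o → o := (con (+ 1) :* o :+ o) :- o) refl o ⟩
        (1# * o + o) - o ≈⟨ +-congʳ (linear a pre post (λ ζ → trans (x≈0 ζ) (sym (trans (+-cong (trans (*-identityˡ _) (x≈0 ζ)) (x≈0 ζ)) (+-identityʳ _))))) ⟨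
        o - o           ≈⟨ -‿inverseʳ o ⟩
        0#              ∎
        where
        open Solver
        o = Ω (pre ++ x ∷ post)

      private
        additive : ∀ pre post (x y : Z → Carrier) → Ω (pre ++ (λ ζ → x ζ + y ζ) ∷ post) ≈ Ω (pre ++ x ∷ post) + Ω (pre ++ y ∷ post)
        additive pre post x y = trans (linear a pre post (λ ζ → +-congʳ (sym (*-identityˡ (x ζ))))) (+-congʳ (*-identityˡ _))

        assoc : {A : Set} (pre : List A) (x y : A) (post : List A) → pre ++ x ∷ y ∷ post ≡ (pre ++ x ∷ []) ++ y ∷ post
        assoc pre x y post = ≡.sym (Lₚ.++-assoc pre (x ∷ []) (y ∷ post))

      alternating-swap : ∀ pre post (x y : Z → Carrier) → Ω (pre ++ x ∷ y ∷ post) ≈ - Ω (pre ++ y ∷ x ∷ post)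
      alternating-swap pre post x y = begin
        xy                     ≈⟨ solve 2 (λ a b → a := ((con (+ 0) :+ a) :+ (b :+ con (+ 0))) :- b) refl xy yx ⟩
        ((0# + xy) + (yx + 0#)) - yx ≈⟨ +-congʳ (+-cong (+-congʳ (alternating a pre post x)) (+-congˡ (alternating a pre post y))) ⟨
        ((Ω (pre ++ x ∷ x ∷ post) + xy) + (yx + Ω (pre ++ y ∷ y ∷ post))) - yx
          ≈⟨ +-congʳ (+-cong (second x) (second y)) ⟨
        (Ω (pre ++ x ∷ s ∷ post) + Ω (pre ++ y ∷ s ∷ post)) - yx ≈⟨ +-congʳ (additive pre (s ∷ post) x y) ⟨
        Ω (pre ++ s ∷ s ∷ post) - yx ≈⟨ +-congʳ (alternating a pre post s) ⟩
        0# - yx                ≈⟨ +-identityˡ _ ⟩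
        - yx                   ∎
        where
        open Solver
        s : Z → Carrier
        s ζ = x ζ + y ζ
        xy = Ω (pre ++ x ∷ y ∷ post)
        yx = Ω (pre ++ y ∷ x ∷ post)
        second : ∀ u → Ω (pre ++ u ∷ s ∷ post) ≈ Ω (pre ++ u ∷ x ∷ post) + Ω (pre ++ u ∷ y ∷ post)
        second u = trans (reflexive (≡.cong Ω (assoc pre u s post))) (trans (additive (pre ++ u ∷ []) post x y)
          (reflexive (≡.sym (≡.cong₂ (λ v w → Ω v + Ω w) (assoc pre u x post) (assoc pre u y post)))))

      alternating-repeat : ∀ pre mid post (x : Z → Carrier) → Ω (pre ++ x ∷ mid ++ x ∷ post) ≈ 0#
      alternating-repeat pre []        post x = alternating a pre post x
      alternating-repeat pre (u ∷ mid) post x = begin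
        Ω (pre ++ x ∷ u ∷ mid ++ x ∷ post)            ≈⟨ alternating-swap pre (mid ++ x ∷ post) x u ⟩
        - Ω (pre ++ u ∷ x ∷ mid ++ x ∷ post)          ≡⟨ ≡.cong (λ l → - Ω l) (assoc pre u x (mid ++ x ∷ post)) ⟩
        - Ω ((pre ++ u ∷ []) ++ x ∷ mid ++ x ∷ post)  ≈⟨ -‿cong (alternating-repeat (pre ++ u ∷ []) mid post x) ⟩
        - 0#                                          ≈⟨ -0#≈0# ⟩
        0#                                            ∎

  prodFrom : (ℕ → Carrier) → ℕ → ℕ → Carrier
  prodFrom c k zero    = 1#
  prodFrom c k (suc n) = c k * prodFrom c (suc k) n

  module _ {Z : Set} where
    open IsAlternating

    combination : (ℕ → Carrier) → (ℕ → Z → Carrier) → ℕ → Z → Carrier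
    combination c e zero    ζ = 0#
    combination c e (suc n) ζ = c n * e n ζ + combination c e n ζ

    module _ {Ω : List (Z → Carrier) → Carrier} (a : IsAlternating Ω)
             (c : ℕ → ℕ → Carrier) (e x : ℕ → Z → Carrier) where
      private
        kill : ∀ cs k n post → n ℕ.≤ k → Ω (seg e 0 k ++ combination cs e n ∷ post) ≈ 0#
        kill cs k zero    post _   = alternating-0 a (seg e 0 k) post (λ _ → refl)
        kill cs k (suc n) post n<k = begin
          Ω (seg e 0 k ++ combination cs e (suc n) ∷ post) ≈⟨ linear a (seg e 0 k) post (λ _ → refl) ⟩
          cs n * Ω (seg e 0 k ++ e n ∷ post) + Ω (seg e 0 k ++ combination cs e n ∷ post)
            ≈⟨ +-cong (trans (*-congˡ repeated) (zeroʳ _)) (kill cs k n post (ℕₚ.<⇒≤ n<k)) ⟩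
          0# + 0# ≈⟨ +-identityʳ _ ⟩
          0# ∎
          where
          repeated : Ω (seg e 0 k ++ e n ∷ post) ≈ 0#
          repeated = let pre , mid , eq = seg-split e k n n<k in
            trans (reflexive (≡.cong Ω (≡.trans (≡.cong (_++ e n ∷ post) eq) (Lₚ.++-assoc pre (e n ∷ mid) (e n ∷ post)))))
                  (alternating-repeat a pre mid post (e n))

        triangular-from : ∀ k n → (∀ i → k ℕ.≤ i → i ℕ.< k ℕ.+ n → ∀ ζ → x i ζ ≈ combination (c i) e (suc i) ζ) →
          Ω (seg e 0 k ++ seg x k n) ≈ prodFrom (λ i → c i i) k n * Ω (seg e 0 (k ℕ.+ n))
        triangular-from k zero    eq = trans (reflexive (≡.cong Ω (≡.trans (Lₚ.++-identityʳ _)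
          (≡.cong (seg e 0) (≡.sym (ℕₚ.+-identityʳ k)))))) (sym (*-identityˡ _))
        triangular-from k (suc n) eq = begin
          Ω (seg e 0 k ++ x k ∷ seg x (suc k) n)
            ≈⟨ linear a (seg e 0 k) _ (eq k ℕₚ.≤-refl (ℕₚ.≤-trans (s≤s (ℕₚ.m≤m+n k n)) (ℕₚ.≤-reflexive (≡.sym (ℕₚ.+-suc k n))))) ⟩
          c k k * Ω (seg e 0 k ++ e k ∷ seg x (suc k) n) + Ω (seg e 0 k ++ combination (c k) e k ∷ seg x (suc k) n)
            ≈⟨ +-cong (*-congˡ (reflexive (≡.cong Ω (≡.trans (≡.sym (Lₚ.++-assoc (seg e 0 k) (e k ∷ []) _))
                 (≡.cong (_++ seg x (suc k) n) (≡.sym (seg-snoc e 0 k))))))) (kill (c k) k k _ ℕₚ.≤-refl) ⟩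
          c k k * Ω (seg e 0 (suc k) ++ seg x (suc k) n) + 0#  ≈⟨ +-identityʳ _ ⟩
          c k k * Ω (seg e 0 (suc k) ++ seg x (suc k) n)
            ≈⟨ *-congˡ (triangular-from (suc k) n (λ i k<i i< → eq i (ℕₚ.<⇒≤ k<i) (≡.subst (i ℕ.<_) (≡.sym (ℕₚ.+-suc k n)) i<))) ⟩
          c k k * (prodFrom (λ i → c i i) (suc k) n * Ω (seg e 0 (suc k ℕ.+ n))) ≈⟨ *-assoc _ _ _ ⟨
          c k k * prodFrom (λ i → c i i) (suc k) n * Ω (seg e 0 (suc k ℕ.+ n))
            ≡⟨ ≡.cong (λ j → c k k * prodFrom (λ i → c i i) (suc k) n * Ω (seg e 0 j)) (≡.sym (ℕₚ.+-suc k n)) ⟩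
          _ ∎

      -- Columns are replaced from the left. The lower terms of column k repeat one of e_0, ...,
      -- e_(k-1), which are already in place, so only the diagonal term survives.
      alternating-triangular : ∀ n → (∀ i → i ℕ.< n → ∀ ζ → x i ζ ≈ combination (c i) e (suc i) ζ) →
        Ω (seg x 0 n) ≈ prodFrom (λ i → c i i) 0 n * Ω (seg e 0 n)
      alternating-triangular n eq = triangular-from 0 n (λ i _ i<n → eq i i<n)

  prodL : {Z : Set} → (Z → Carrier) → List Z → Carrier
  prodL f []       = 1#
  prodL f (z ∷ zs) = f z * prodL f zs

  module _ {Z : Set} where
    det-scale : (g : Z → Carrier) (zs : List Z) (xs : List (Z → Carrier)) →
                det zs (map (λ x ζ → g ζ * x ζ) xs) ≈ prodL g zs * det zs xs
    det-scale g []       []       = sym (*-identityˡ _)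
    det-scale g []       (_ ∷ _)  = sym (zeroʳ _)
    det-scale g (z ∷ zs) xs = begin
      lap (λ x ys → x z * det zs ys) (map (λ x ζ → g ζ * x ζ) xs)    ≡⟨ lap-map (λ x ζ → g ζ * x ζ) _ xs ⟩
      lap (λ x ys → (g z * x z) * det zs (map (λ x ζ → g ζ * x ζ) ys)) xs
        ≈⟨ lap-cong xs (λ x ys → trans (*-congˡ (det-scale g zs ys))
             (solve 4 (λ g x p d → (g :* x) :* (p :* d) := (g :* p) :* (x :* d)) refl (g z) (x z) _ _)) ⟩
      lap (λ x ys → (g z * prodL g zs) * (x z * det zs ys)) xs       ≈⟨ lap-*ˡ _ _ xs ⟩
      (g z * prodL g zs) * det (z ∷ zs) xs                           ∎
      where open Solver

    vandermonde : (Z → Carrier) → List Z → Carrier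
    vandermonde S []       = 1#
    vandermonde S (z ∷ zs) = prodL (λ ζ → S ζ - S z) zs * vandermonde S zs

    -- A unitriangular change of columns makes all columns but the first vanish at z, so the
    -- expansion along z has one term, and S - S z factors out of the rest.
    det-vandermonde : (S : Z → Carrier) (zs : List Z) →
                      det zs (seg (λ i ζ → pow (S ζ) i) 0 (Data.List.length zs)) ≈ vandermonde S zs
    det-vandermonde S []       = refl
    det-vandermonde S (z ∷ zs) = begin
      det (z ∷ zs) (seg (λ i ζ → pow (S ζ) i) 0 (suc n))
        ≈⟨ alternating-triangular (det-alternating (z ∷ zs)) c e (λ i ζ → pow (S ζ) i) (suc n) (λ i _ ζ → expand ζ i) ⟩
      prodFrom (λ i → c i i) 0 (suc n) * det (z ∷ zs) (seg e 0 (suc n))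
        ≈⟨ trans (*-congʳ (diag 0 (suc n))) (*-identityˡ _) ⟩
      1# * det zs (seg e 1 n) - lap (λ y ys → y z * det zs (e 0 ∷ ys)) (seg e 1 n)
        ≈⟨ +-cong (*-identityˡ _) (-‿cong (lap-zero (seg e 1 n) (vanishing 0 n))) ⟩
      det zs (seg e 1 n) - 0#                           ≈⟨ trans (+-congˡ -0#≈0#) (+-identityʳ _) ⟩
      det zs (seg e 1 n)                                ≡⟨ ≡.cong (det zs) (shifted 0 n) ⟩
      det zs (map (λ x ζ → (S ζ - S z) * x ζ) (seg (λ i ζ → pow (S ζ) i) 0 n)) ≈⟨ det-scale _ zs _ ⟩
      prodL (λ ζ → S ζ - S z) zs * det zs (seg (λ i ζ → pow (S ζ) i) 0 n) ≈⟨ *-congˡ (det-vandermonde S zs) ⟩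
      prodL (λ ζ → S ζ - S z) zs * vandermonde S zs     ∎
      where
      open Solver
      n = Data.List.length zs
      -- S^k = Σ_{l ≤ k} (S z)^(k-l) e_l with e_0 = 1 and e_{l+1} = (S - S z) S^l.
      e : ℕ → Z → Carrier
      e zero    ζ = 1#
      e (suc l) ζ = (S ζ - S z) * pow (S ζ) l
      c : ℕ → ℕ → Carrier
      c k l = pow (S z) (k ℕ.∸ l)
      diag : ∀ k n → prodFrom (λ i → c i i) k n ≈ 1#
      diag k zero    = refl
      diag k (suc n) = trans (*-cong (reflexive (≡.cong (pow (S z)) (ℕₚ.n∸n≡0 k))) (diag (suc k) n)) (*-identityˡ _)
      raise : ∀ ζ k n → n ℕ.≤ suc k → combination (c (suc k)) e n ζ ≈ S z * combination (c k) e n ζ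
      raise ζ k zero    _         = sym (zeroʳ _)
      raise ζ k (suc n) (s≤s n≤k) = trans (+-cong (*-congʳ (reflexive (≡.cong (pow (S z)) (ℕₚ.+-∸-assoc 1 n≤k))))
        (raise ζ k n (ℕₚ.m≤n⇒m≤1+n n≤k))) (solve 4 (λ s p e q → (s :* p) :* e :+ s :* q := s :* (p :* e :+ q)) refl (S z) (c k n) (e n ζ) _)
      expand : ∀ ζ k → pow (S ζ) k ≈ combination (c k) e (suc k) ζ
      expand ζ zero    = sym (trans (+-identityʳ _) (*-identityˡ _))
      expand ζ (suc k) = begin
        S ζ * pow (S ζ) k                                  ≈⟨ solve 3 (λ s t p → s :* p := con (+ 1) :* ((s :- t) :* p) :+ t :* p) refl (S ζ) (S z) (pow (S ζ) k) ⟩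
        1# * e (suc k) ζ + S z * pow (S ζ) k               ≈⟨ +-cong (*-congʳ (reflexive (≡.cong (pow (S z)) (≡.sym (ℕₚ.n∸n≡0 (suc k))))))
                                                                (trans (*-congˡ (expand ζ k)) (sym (raise ζ k (suc k) ℕₚ.≤-refl))) ⟩
        combination (c (suc k)) e (suc (suc k)) ζ          ∎
      vanishing : ∀ k n → All (λ x → ∀ ys → x z * det zs (e 0 ∷ ys) ≈ 0#) (seg e (suc k) n)
      vanishing k zero    = []
      vanishing k (suc n) = (λ ys → trans (*-congʳ (trans (*-congʳ (-‿inverseʳ _)) (zeroˡ _))) (zeroˡ _)) ∷ vanishing (suc k) n
      shifted : ∀ k n → seg e (suc k) n ≡ map (λ x ζ → (S ζ - S z) * x ζ) (seg (λ i ζ → pow (S ζ) i) k n)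
      shifted k zero    = ≡.refl
      shifted k (suc n) = ≡.cong (_ ∷_) (shifted (suc k) n)

  -- For index lists of length n this is n! times the determinant of the corresponding minor: a
  -- signed sum over pairs of permutations. It is the form in which an integral of two determinants
  -- arises.
  doubleLap : (ℕ → ℕ → Carrier) → ℕ → List ℕ → List ℕ → Carrier
  doubleLap M zero    []      []      = 1#
  doubleLap M zero    []      (_ ∷ _) = 0#
  doubleLap M zero    (_ ∷ _) _       = 0#
  doubleLap M (suc n) is      js      = lap (λ i is′ → lap (λ j js′ → M i j * doubleLap M n is′ js′) js) is

  doubleLap-cong : ∀ {m M M′} → (∀ i j → i ℕ.< m → j ℕ.< m → M i j ≈ M′ i j) →
                   ∀ n {is js} → All (ℕ._< m) is → All (ℕ._< m) js → doubleLap M n is js ≈ doubleLap M′ n is js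
  doubleLap-cong M≈ zero    []      []      = refl
  doubleLap-cong M≈ zero    []      (_ ∷ _) = refl
  doubleLap-cong M≈ zero    (_ ∷ _) _       = refl
  doubleLap-cong M≈ (suc n) pis     pjs     = lap-cong-All _ pis λ i is′ pi pis′ → lap-cong-All _ pjs λ j js′ pj pjs′ →
    *-cong (M≈ i j pi pj) (doubleLap-cong M≈ n pis′ pjs′)

  kronecker-δ : ℕ → ℕ → Carrier
  kronecker-δ i j = pick (i == j) 1#

  private
    signℕ : ℕ → Carrier
    signℕ zero    = 1#
    signℕ (suc n) = - signℕ n

    lap-δ : ∀ k pre post (g : List ℕ → Carrier) → k ∉ pre → k ∉ post →
            lap (λ l ls → kronecker-δ k l * g ls) (pre ++ k ∷ post) ≈ signℕ (Data.List.length pre) * g (pre ++ post)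
    lap-δ k [] post g _ k∉ = begin
      kronecker-δ k k * g post - lap (λ l ls → kronecker-δ k l * g (k ∷ ls)) post
        ≈⟨ +-cong (*-congʳ (pick-yes (k == k) ≡.refl)) (-‿cong (lap-zero post (off post k∉))) ⟩
      1# * g post - 0#   ≈⟨ trans (+-congˡ -0#≈0#) (+-identityʳ _) ⟩
      1# * g post        ∎
      where
      off : ∀ ls → k ∉ ls → All (λ l → ∀ ys → kronecker-δ k l * g (k ∷ ys) ≈ 0#) ls
      off []       _  = []
      off (l ∷ ls) k∉ = (λ ys → trans (*-congʳ (pick-no (k == l) (λ eq → k∉ (here eq)))) (zeroˡ _)) ∷ off ls (k∉ ∘ there)
    lap-δ k (p ∷ pre) post g k∉pre k∉post = begin
      kronecker-δ k p * g (pre ++ k ∷ post) - lap (λ l ls → kronecker-δ k l * g (p ∷ ls)) (pre ++ k ∷ post)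
        ≈⟨ +-cong (trans (*-congʳ (pick-no (k == p) (λ eq → k∉pre (here eq)))) (zeroˡ _))
                  (-‿cong (lap-δ k pre post (λ ls → g (p ∷ ls)) (k∉pre ∘ there) k∉post)) ⟩
      0# - signℕ (Data.List.length pre) * g (p ∷ pre ++ post)
        ≈⟨ trans (+-identityˡ _) (-‿distribˡ-* _ _) ⟩
      - signℕ (Data.List.length pre) * g (p ∷ pre ++ post) ∎

    signℕ² : ∀ n → signℕ n * signℕ n ≈ 1#
    signℕ² zero    = *-identityˡ _
    signℕ² (suc n) = trans (solve 1 (λ s → (:- s) :* (:- s) := s :* s) refl (signℕ n)) (signℕ² n)
      where open Solver

    unique-middle : ∀ (pre : List ℕ) {x xs} → Unique (pre ++ x ∷ xs) → x ∉ pre × x ∉ xs × Unique (pre ++ xs)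
    unique-middle []        (x∉ ∷ u) = (λ ()) , (λ x∈ → All.lookup x∉ x∈ ≡.refl) , u
    unique-middle (p ∷ pre) {x} {xs} (p∉ ∷ u) = let x∉pre , x∉xs , u′ = unique-middle pre u in
      (λ { (here x≡p) → All.lookup p∉ (∈ₚ.∈-++⁺ʳ pre (here ≡.refl)) (≡.sym x≡p) ; (there x∈) → x∉pre x∈ }) , x∉xs ,
      All.tabulate (λ y∈ → All.lookup p∉ (weaken pre y∈)) ∷ u′
      where
      weaken : ∀ {y} (pre : List ℕ) → y ∈ pre ++ xs → y ∈ pre ++ x ∷ xs
      weaken []        y∈         = there y∈
      weaken (q ∷ pre) (here eq)  = here eq
      weaken (q ∷ pre) (there y∈) = there (weaken pre y∈)

  factorial : ℕ → Carrier
  factorial zero    = 1#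
  factorial (suc n) = fromℕ′ (suc n) * factorial n

  -- Choosing the row k forces the column k, and the two positions carry equal signs. The remainder
  -- is the same sum over a shorter list, once for each of the n choices.
  doubleLap-δ : ∀ n ks → Unique ks → Data.List.length ks ≡ n → doubleLap kronecker-δ n ks ks ≈ factorial n
  doubleLap-δ zero    []       _ _  = refl
  doubleLap-δ (suc n) ks       u eq = begin
    lap (λ k ks′ → row ks k ks′) ks    ≈⟨ rows [] ks u eq ⟩
    1# * (fromℕ′ (Data.List.length ks) * factorial n) ≈⟨ *-identityˡ _ ⟩
    fromℕ′ (Data.List.length ks) * factorial n ≡⟨ ≡.cong (λ l → fromℕ′ l * factorial n) eq ⟩
    factorial (suc n) ∎
    where
    row : List ℕ → ℕ → List ℕ → Carrier
    row js k ks′ = lap (λ j js′ → kronecker-δ k j * doubleLap kronecker-δ n ks′ js′) js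
    rows : ∀ pre xs → Unique (pre ++ xs) → Data.List.length (pre ++ xs) ≡ suc n →
           lap (λ k ks′ → row (pre ++ xs) k (pre ++ ks′)) xs
           ≈ signℕ (Data.List.length pre) * (fromℕ′ (Data.List.length xs) * factorial n)
    rows pre []       u len = sym (trans (*-congˡ (zeroˡ _)) (zeroʳ _))
    rows pre (x ∷ xs) u len = begin
      row (pre ++ x ∷ xs) x (pre ++ xs) - lap (λ k ks′ → row (pre ++ x ∷ xs) k (pre ++ x ∷ ks′)) xs
        ≈⟨ +-cong head (-‿cong rest) ⟩
      s * factorial n - (- s) * (fromℕ′ (Data.List.length xs) * factorial n)
        ≈⟨ solve 3 (λ s l f → s :* f :- (:- s) :* (l :* f) := s :* ((con (+ 1) :+ l) :* f)) refl s _ _ ⟩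
      s * ((1# + fromℕ′ (Data.List.length xs)) * factorial n)
        ≈⟨ *-congˡ (*-congʳ (fromℕ′-suc (Data.List.length xs))) ⟨
      s * (fromℕ′ (suc (Data.List.length xs)) * factorial n) ∎
      where
      open Solver
      s = signℕ (Data.List.length pre)
      middle = unique-middle pre u
      head : row (pre ++ x ∷ xs) x (pre ++ xs) ≈ s * factorial n
      head = trans (lap-δ x pre xs (doubleLap kronecker-δ n (pre ++ xs)) (proj₁ middle) (proj₁ (proj₂ middle)))
        (*-congˡ (doubleLap-δ n (pre ++ xs) (proj₂ (proj₂ middle))
          (ℕₚ.suc-injective (≡.trans (≡.sym (length-middle pre)) len))))
        where
        length-middle : ∀ (pre : List ℕ) → Data.List.length (pre ++ x ∷ xs) ≡ suc (Data.List.length (pre ++ xs))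
        length-middle []        = ≡.refl
        length-middle (p ∷ pre) = ≡.cong suc (length-middle pre)
      snoc : ∀ (ys : List ℕ) → (pre ++ x ∷ []) ++ ys ≡ pre ++ x ∷ ys
      snoc ys = Lₚ.++-assoc pre (x ∷ []) ys
      rest : lap (λ k ks′ → row (pre ++ x ∷ xs) k (pre ++ x ∷ ks′)) xs
             ≈ (- s) * (fromℕ′ (Data.List.length xs) * factorial n)
      rest = trans (lap-cong xs (λ k ks′ → reflexive (≡.sym (≡.cong₂ (λ a b → row a k b) (snoc xs) (snoc ks′)))))
        (trans (rows (pre ++ x ∷ []) xs (≡.subst Unique (≡.sym (snoc xs)) u)
                 (≡.trans (≡.cong Data.List.length (snoc xs)) len))
          (*-congʳ (reflexive (sign-snoc pre))))
        where
        sign-snoc : ∀ (pre : List ℕ) → signℕ (Data.List.length (pre ++ x ∷ [])) ≡ - signℕ (Data.List.length pre)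
        sign-snoc []        = ≡.refl
        sign-snoc (p ∷ pre) = ≡.cong -_ (sign-snoc pre)

  module _ {Z : Set} (μ : Z → Carrier) (dom : List Z) where
    integral : ℕ → (List Z → Carrier) → Carrier
    integral zero    f = f []
    integral (suc n) f = ΣL (λ z → μ z * integral n (λ zs → f (z ∷ zs))) dom

    private
      ΣL-isLinear : IsLinear {Z} (λ f → ΣL f dom)
      ΣL-isLinear = record
        { Φ-cong = ΣL-cong dom ; Φ-+ = λ f g → ΣL-+ f g dom ; Φ-* = λ c f → ΣL-*ˡ c f dom }

    integral-isLinear : ∀ n → IsLinear (integral n)
    integral-isLinear zero    = record { Φ-cong = λ f≈g → f≈g [] ; Φ-+ = λ _ _ → refl ; Φ-* = λ _ _ → refl }
    integral-isLinear (suc n) = record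
      { Φ-cong = λ f≈g → ΣL-cong dom (λ z → *-congˡ (I.Φ-cong (λ zs → f≈g (z ∷ zs))))
      ; Φ-+ = λ f g → trans (ΣL-cong dom (λ z → trans (*-congˡ (I.Φ-+ _ _)) (distribˡ _ _ _))) (ΣL-+ _ _ dom)
      ; Φ-* = λ c f → trans (ΣL-cong dom (λ z → trans (*-congˡ (I.Φ-* c _))
          (solve 3 (λ m c i → m :* (c :* i) := c :* (m :* i)) refl (μ z) c _))) (ΣL-*ˡ c _ dom) }
      where
      open Solver
      module I = IsLinear (integral-isLinear n)

    pairing : (Z → Carrier) → (Z → Carrier) → Carrier
    pairing φ ψ = ΣL (λ z → μ z * (φ z * ψ z)) dom

    -- Expanding both determinants at the first point and summing over it.
    integral-det : (φ ψ : ℕ → Z → Carrier) → ∀ n is js →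
      integral n (λ zs → det zs (map φ is) * det zs (map ψ js)) ≈ doubleLap (λ i j → pairing (φ i) (ψ j)) n is js
    integral-det φ ψ zero    []      []      = *-identityˡ _
    integral-det φ ψ zero    []      (_ ∷ _) = zeroʳ _
    integral-det φ ψ zero    (_ ∷ _) _       = zeroˡ _
    integral-det φ ψ (suc n) is      js      = begin
      ΣL (λ z → μ z * integral n (λ zs → det (z ∷ zs) (map φ is) * det (z ∷ zs) (map ψ js))) dom
        ≈⟨ ΣL-cong dom (λ z → *-congˡ (I.Φ-cong (λ zs → expand z zs))) ⟩
      ΣL (λ z → μ z * integral n (λ zs → lap (λ i is′ → lap (λ j js′ → F z i is′ j js′ zs) js) is)) dom
        ≈⟨ ΣL-cong dom (λ z → trans (*-congˡ (trans (I.Φ-lap _ is) (lap-cong is (λ i is′ → I.Φ-lap _ js))))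
             (trans (sym (lap-*ˡ (μ z) _ is)) (lap-cong is (λ i is′ → sym (lap-*ˡ (μ z) _ js))))) ⟩
      ΣL (λ z → lap (λ i is′ → lap (λ j js′ → μ z * integral n (F z i is′ j js′)) js) is) dom
        ≈⟨ trans (S.Φ-lap _ is) (lap-cong is (λ i is′ → S.Φ-lap _ js)) ⟩
      lap (λ i is′ → lap (λ j js′ → ΣL (λ z → μ z * integral n (F z i is′ j js′)) dom) js) is
        ≈⟨ lap-cong is (λ i is′ → lap-cong js (λ j js′ → trans
             (ΣL-cong dom (λ z → trans (*-congˡ (trans (I.Φ-* _ _) (*-congˡ (integral-det φ ψ n is′ js′)))) (sym (*-assoc _ _ _))))
             (ΣL-*ʳ _ _ dom))) ⟩
      doubleLap (λ i j → pairing (φ i) (ψ j)) (suc n) is js ∎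
      where
      module I = IsLinear (integral-isLinear n)
      module S = IsLinear ΣL-isLinear
      open Solver
      F : Z → ℕ → List ℕ → ℕ → List ℕ → List Z → Carrier
      F z i is′ j js′ zs = (φ i z * ψ j z) * (det zs (map φ is′) * det zs (map ψ js′))
      expand : ∀ z zs → det (z ∷ zs) (map φ is) * det (z ∷ zs) (map ψ js) ≈ lap (λ i is′ → lap (λ j js′ → F z i is′ j js′ zs) js) is
      expand z zs = begin
        det (z ∷ zs) (map φ is) * det (z ∷ zs) (map ψ js)
          ≡⟨ ≡.cong₂ _*_ (lap-map φ _ is) (lap-map ψ _ js) ⟩
        lap (λ i is′ → φ i z * det zs (map φ is′)) is * lap (λ j js′ → ψ j z * det zs (map ψ js′)) js
          ≈⟨ lap-*ʳ _ _ is ⟨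
        lap (λ i is′ → (φ i z * det zs (map φ is′)) * lap (λ j js′ → ψ j z * det zs (map ψ js′)) js) is
          ≈⟨ lap-cong is (λ i is′ → trans (sym (lap-*ˡ _ _ js)) (lap-cong js (λ j js′ →
               solve 4 (λ a b c d → (a :* b) :* (c :* d) := (a :* c) :* (b :* d)) refl (φ i z) _ (ψ j z) _))) ⟩
        lap (λ i is′ → lap (λ j js′ → F z i is′ j js′ zs) js) is ∎

  private
    range : ℕ → List ℕ
    range = seg id 0

  -- Andréief's formula when the matrix of pairings is the product of a lower triangular matrix L
  -- and an upper triangular matrix U: these are themselves pairings over the counting measure
  -- on {0, …, m - 1}, where L and U become triangular combinations of δ-functions.
  integral-det-LU : ∀ {Z : Set} (μ : Z → Carrier) dom (φ ψ : ℕ → Z → Carrier) (L U : ℕ → ℕ → Carrier) m →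
    (∀ i k → i ℕ.< k → L i k ≈ 0#) → (∀ k j → j ℕ.< k → U k j ≈ 0#) →
    (∀ i j → i ℕ.< m → j ℕ.< m → pairing μ dom (φ i) (ψ j) ≈ ΣL (λ k → L i k * U k j) (seg id 0 m)) →
    integral μ dom m (λ zs → det zs (seg φ 0 m) * det zs (seg ψ 0 m))
    ≈ prodFrom (λ k → L k k * U k k) 0 m * factorial m
  integral-det-LU μ dom φ ψ L U m L-lower U-upper LU = begin
    integral μ dom m (λ zs → det zs (seg φ 0 m) * det zs (seg ψ 0 m))
      ≡⟨ ≡.cong₂ (λ a b → integral μ dom m (λ zs → det zs a * det zs b)) (seg-map φ id 0 m) (seg-map ψ id 0 m) ⟩
    integral μ dom m (λ zs → det zs (map φ (range m)) * det zs (map ψ (range m)))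
      ≈⟨ integral-det μ dom φ ψ m (range m) (range m) ⟩
    doubleLap (λ i j → pairing μ dom (φ i) (ψ j)) m (range m) (range m)
      ≈⟨ doubleLap-cong (λ i j i< j< → trans (LU i j i< j<) (ΣL-cong (range m) (λ k → sym (*-identityˡ _)))) m all all ⟩
    doubleLap (λ i j → pairing one (range m) (L i) (U′ j)) m (range m) (range m)
      ≈⟨ integral-det one (range m) L U′ m (range m) (range m) ⟨
    integral one (range m) m (λ ks → det ks (map L (range m)) * det ks (map U′ (range m)))
      ≈⟨ N.Φ-cong (λ ks → *-cong (reduce ks L L-lower) (reduce ks U′ (λ j k → U-upper k j))) ⟩
    integral one (range m) m (λ ks → (pL * det ks δs) * (pU * det ks δs))
      ≈⟨ N.Φ-cong (λ ks → solve 3 (λ a b c → (a :* c) :* (b :* c) := (a :* b) :* (c :* c)) refl pL pU (det ks δs)) ⟩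
    integral one (range m) m (λ ks → (pL * pU) * (det ks δs * det ks δs)) ≈⟨ N.Φ-* (pL * pU) _ ⟩
    (pL * pU) * integral one (range m) m (λ ks → det ks δs * det ks δs)
      ≈⟨ *-cong (sym (prod-* 0 m)) (integral-det one (range m) kronecker-δ kronecker-δ m (range m) (range m)) ⟩
    prodFrom (λ k → L k k * U k k) 0 m * doubleLap (λ i j → pairing one (range m) (kronecker-δ i) (kronecker-δ j)) m (range m) (range m)
      ≈⟨ *-congˡ (doubleLap-cong (λ i j i< j< → orthogonal i j i<) m all all) ⟩
    prodFrom (λ k → L k k * U k k) 0 m * doubleLap kronecker-δ m (range m) (range m)
      ≈⟨ *-congˡ (doubleLap-δ m (range m) (seg-unique 0 m) (seg-length id 0 m)) ⟩
    prodFrom (λ k → L k k * U k k) 0 m * factorial m ∎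
    where
    open Solver
    one : ℕ → Carrier
    one _ = 1#
    U′ : ℕ → ℕ → Carrier
    U′ j k = U k j
    δs : List (ℕ → Carrier)
    δs = map kronecker-δ (range m)
    pL pU : Carrier
    pL = prodFrom (λ k → L k k) 0 m
    pU = prodFrom (λ k → U′ k k) 0 m
    all = seg-All 0 m ℕₚ.≤-refl
    module N = IsLinear (integral-isLinear one (range m) m)
    prod-* : ∀ k n → prodFrom (λ k → L k k * U k k) k n ≈ prodFrom (λ k → L k k) k n * prodFrom (λ k → U′ k k) k n
    prod-* k zero    = sym (*-identityˡ _)
    prod-* k (suc n) = trans (*-congˡ (prod-* (suc k) n))
      (solve 4 (λ a b c d → (a :* b) :* (c :* d) := (a :* c) :* (b :* d)) refl (L k k) (U k k) _ _)
    reduce : ∀ ks (M : ℕ → ℕ → Carrier) → (∀ i k → i ℕ.< k → M i k ≈ 0#) →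
             det ks (map M (range m)) ≈ prodFrom (λ k → M k k) 0 m * det ks δs
    reduce ks M lower = trans (reflexive (≡.cong (det ks) (≡.sym (seg-map M id 0 m)))) (trans
      (alternating-triangular (det-alternating ks) M kronecker-δ M m (λ i _ k → expand i k))
      (*-congˡ (reflexive (≡.cong (det ks) (seg-map kronecker-δ id 0 m)))))
      where
      below : ∀ i k n → k ℕ.< n → combination (M i) kronecker-δ n k ≈ M i k
      above : ∀ i k n → n ℕ.≤ k → combination (M i) kronecker-δ n k ≈ 0#
      above i k zero    _   = refl
      above i k (suc n) n<k = trans (+-cong (trans (*-congˡ (pick-no (n == k) (ℕₚ.<⇒≢ n<k))) (zeroʳ _)) (above i k n (ℕₚ.<⇒≤ n<k))) (+-identityʳ _)
      below i k (suc n) (s≤s k≤n) with ℕₚ.m≤n⇒m<n∨m≡n k≤n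
      ... | inj₁ k<n    = trans (+-cong (trans (*-congˡ (pick-no (n == k) (λ eq → ℕₚ.<⇒≢ k<n (≡.sym eq)))) (zeroʳ _)) (below i k n k<n)) (+-identityˡ _)
      ... | inj₂ ≡.refl = trans (+-cong (trans (*-congˡ (pick-yes (k == k) ≡.refl)) (*-identityʳ _)) (above i k k ℕₚ.≤-refl)) (+-identityʳ _)
      expand : ∀ i k → M i k ≈ combination (M i) kronecker-δ (suc i) k
      expand i k with ℕₚ.<-≤-connex k (suc i)
      ... | inj₁ k≤i = sym (below i k (suc i) k≤i)
      ... | inj₂ i<k = trans (lower i k i<k) (sym (above i k (suc i) i<k))
    orthogonal : ∀ i j → i ℕ.< m → pairing one (range m) (kronecker-δ i) (kronecker-δ j) ≈ kronecker-δ i j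
    orthogonal i j i<m = trans (ΣL-cong (range m) pt) (ΣL-pick (λ l → kronecker-δ l j) i (range m) (seg-unique 0 m) (λ i∉ → ⊥-elim (i∉ (mem 0 m z≤n i<m))))
      where
      pt : ∀ l → 1# * (kronecker-δ i l * kronecker-δ j l) ≈ pick (i == l) (kronecker-δ i j)
      pt l = trans (*-identityˡ _) (by (i == l))
        where
        by : (d : Dec (i ≡ l)) → pick d 1# * kronecker-δ j l ≈ pick d (kronecker-δ i j)
        by (yes ≡.refl) = trans (*-identityˡ _) (pick-⇔ (j == i) (i == j) ≡.sym ≡.sym (λ _ → refl))
        by (no _)       = zeroˡ _
      mem : ∀ k n → k ℕ.≤ i → i ℕ.< k ℕ.+ n → i ∈ seg id k n
      mem k zero    k≤i i< = ⊥-elim (ℕₚ.<⇒≱ i< (≡.subst (ℕ._≤ i) (≡.sym (ℕₚ.+-identityʳ k)) k≤i))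
      mem k (suc n) k≤i i< with ℕₚ.m≤n⇒m<n∨m≡n k≤i
      ... | inj₂ ≡.refl = here ≡.refl
      ... | inj₁ k<i    = there (mem (suc k) n k<i (≡.subst (i ℕ.<_) (ℕₚ.+-suc k n) i<))

-- Series in two variables

module TwoVariables (D : ℕ) (R : CommutativeRing 0ℓ 0ℓ) where
  private
    module R = CommutativeRing R
    module S₁ = Series D R
    U-ring = S₁.seriesRing
    module S₂ = Series D U-ring
    W-ring = S₂.seriesRing
    module U = CommutativeRing U-ring
    module W = CommutativeRing W-ring

  open S₁ using (const-+; const-*; const-cong)

  -- f(u) and g(v) as series in v with coefficients that are series in u.
  i₁ i₂ : U.Carrier → W.Carrier
  i₁ f = S₂.const′ f
  i₂ g j = S₁.const′ (g j)

  i₁-cong : ∀ {f f′} → f U.≈ f′ → i₁ f W.≈ i₁ f′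
  i₁-cong f≈ zero    _ = f≈
  i₁-cong f≈ (suc n) _ = U.refl

  i₁-* : ∀ f g → i₁ (f U.* g) W.≈ i₁ f W.* i₁ g
  i₁-* f g n _ = U.sym (U.trans (S₂.conv-const f (i₁ g) n) (lem n))
    where
    lem : ∀ n → f U.* i₁ g n U.≈ i₁ (f U.* g) n
    lem zero    = U.refl
    lem (suc n) = U.zeroʳ f

  i₁-- : ∀ f g → i₁ (f U.- g) W.≈ i₁ f W.- i₁ g
  i₁-- f g zero    _ = U.refl
  i₁-- f g (suc n) _ = U.sym (U.-‿inverseʳ U.0#)

  i₂-cong : ∀ {f f′} → f U.≈ f′ → i₂ f W.≈ i₂ f′
  i₂-cong f≈ j j≤ = const-cong (f≈ j j≤)

  i₂-- : ∀ f g → i₂ (f U.- g) W.≈ i₂ f W.- i₂ g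
  i₂-- f g n _ zero    _ = R.refl
  i₂-- f g n _ (suc i) _ = R.sym (R.-‿inverseʳ R.0#)

  i₂-1 : i₂ U.1# W.≈ W.1#
  i₂-1 zero    _ i       _ = R.refl
  i₂-1 (suc n) _ zero    _ = R.refl
  i₂-1 (suc n) _ (suc i) _ = R.refl

  i₂-* : ∀ f g → i₂ (f U.* g) W.≈ i₂ f W.* i₂ g
  i₂-* f g n _ = lem f g n
    where
    lem : ∀ f g n → S₁.const′ (S₁.conv f g n) U.≈ S₂.conv (i₂ f) (i₂ g) n
    lem f g zero    = const-* (f 0) (g 0)
    lem f g (suc n) = U.trans (const-+ _ _) (U.+-cong (const-* (f 0) (g (suc n))) (lem (f ∘ suc) g n))

  coeff-i₁i₂ : ∀ f g j i → i ℕ.≤ D → (i₁ f W.* i₂ g) j i R.≈ f i R.* g j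
  coeff-i₁i₂ f g j i i≤D = begin
    (i₁ f W.* i₂ g) j i                 ≈⟨ S₂.conv-const f (i₂ g) j i i≤D ⟩
    (f U.* S₁.const′ (g j)) i           ≈⟨ U.*-comm f (S₁.const′ (g j)) i i≤D ⟩
    (S₁.const′ (g j) U.* f) i           ≈⟨ S₁.conv-const (g j) f i ⟩
    g j R.* f i                         ≈⟨ R.*-comm _ _ ⟩
    f i R.* g j                         ∎
    where open import Relation.Binary.Reasoning.Setoid R.setoid

  private
    module PU = RingTools U-ring
    module PW = RingTools W-ring
    module ΣW = Summation W-ring
    module ΣU = Summation U-ring
    module ΣR = Summation R

  i₁-pow : ∀ f k → i₁ (PU.pow f k) W.≈ PW.pow (i₁ f) k
  i₁-pow f zero    = W.refl
  i₁-pow f (suc k) = W.trans (i₁-* f _) (W.*-congˡ {i₁ f} (i₁-pow f k))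

  i₂-pow : ∀ f k → i₂ (PU.pow f k) W.≈ PW.pow (i₂ f) k
  i₂-pow f zero    = i₂-1
  i₂-pow f (suc k) = W.trans (i₂-* f _) (W.*-congˡ {i₂ f} (i₂-pow f k))

  -- Expanding c(u) / (a(u) a(v) - b(u) b(v)) as a geometric series in b(u) b(v) / (a(u) a(v)).
  module Factorisation {a b c : U.Carrier} {g : W.Carrier} {α⁻¹ : R.Carrier}
      (unit : α⁻¹ R.* a 0 R.≈ R.1#) (ord-b : S₁.Ord 2 b) (ord-c : S₁.Ord 1 c)
      (equation : g W.* (i₁ a W.* i₂ a W.- i₁ b W.* i₂ b) W.≈ i₁ c) where
    private
      a⁻¹ : U.Carrier
      a⁻¹ = proj₁ (S₁.series-inverse {a} {α⁻¹} unit)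

      aa⁻¹ : a U.* a⁻¹ U.≈ U.1#
      aa⁻¹ = proj₂ (S₁.series-inverse {a} {α⁻¹} unit)

      x : U.Carrier
      x = b U.* a⁻¹

    -- The k-th term of the geometric series is `L k` in u times `U′ k` in v. As x = b / a has order
    -- 2, these start in degrees 2 k + 1 and 2 k, so the matrices of their coefficients are
    -- triangular on the odd powers of u and the even powers of v.
    L U′ : ℕ → U.Carrier
    L k  = (c U.* a⁻¹) U.* PU.pow x k
    U′ k = a⁻¹ U.* PU.pow x k

    private
      X P : W.Carrier
      X = i₁ x W.* i₂ x
      P = i₁ (c U.* a⁻¹) W.* i₂ a⁻¹

      a₁a₁⁻¹ : i₁ a W.* i₁ a⁻¹ W.≈ W.1#
      a₁a₁⁻¹ = W.trans (W.sym (i₁-* a a⁻¹)) (i₁-cong aa⁻¹)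

      a₂a₂⁻¹ : i₂ a W.* i₂ a⁻¹ W.≈ W.1#
      a₂a₂⁻¹ = W.trans (W.sym (i₂-* a a⁻¹)) (W.trans (i₂-cong aa⁻¹) i₂-1)

      -- The equation divided by a(u) a(v), in the form that is iterated.
      step : g W.≈ P W.+ X W.* g
      step = begin
        g                         ≈⟨ W.trans (W.sym (W.*-identityʳ g)) (W.*-congˡ {g} (W.sym (W.trans (W.*-cong a₁a₁⁻¹ a₂a₂⁻¹) (W.*-identityˡ W.1#)))) ⟩
        g W.* ((i₁ a W.* i₁ a⁻¹) W.* (i₂ a W.* i₂ a⁻¹))
          ≈⟨ solve 7 (λ g a a′ b a⁻ a′⁻ b′ → g :* ((a :* a⁻) :* (a′ :* a′⁻))
               := (g :* (a :* a′ :- b :* b′)) :* (a⁻ :* a′⁻) :+ ((b :* a⁻) :* (b′ :* a′⁻)) :* g)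
               W.refl g (i₁ a) (i₂ a) (i₁ b) (i₁ a⁻¹) (i₂ a⁻¹) (i₂ b) ⟩
        (g W.* (i₁ a W.* i₂ a W.- i₁ b W.* i₂ b)) W.* (i₁ a⁻¹ W.* i₂ a⁻¹) W.+ ((i₁ b W.* i₁ a⁻¹) W.* (i₂ b W.* i₂ a⁻¹)) W.* g
          ≈⟨ W.+-cong (W.trans (W.*-congʳ {i₁ a⁻¹ W.* i₂ a⁻¹} equation) (W.trans (W.sym (W.*-assoc (i₁ c) (i₁ a⁻¹) (i₂ a⁻¹))) (W.*-congʳ {i₂ a⁻¹} (W.sym (i₁-* c a⁻¹)))))
                      (W.*-congʳ {g} (W.*-cong (W.sym (i₁-* b a⁻¹)) (W.sym (i₂-* b a⁻¹)))) ⟩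
        P W.+ X W.* g             ∎
        where
        open import Relation.Binary.Reasoning.Setoid W.setoid
        open PW.Solver

      geometric : ∀ k n → PW.pow X k W.* g W.≈ ΣW.ΣL (λ i → P W.* PW.pow X i) (seg id k n) W.+ PW.pow X (k ℕ.+ n) W.* g
      geometric k zero    = W.trans (W.reflexive (≡.cong (λ i → PW.pow X i W.* g) (≡.sym (ℕₚ.+-identityʳ k)))) (W.sym (W.+-identityˡ _))
      geometric k (suc n) = begin
        PW.pow X k W.* g                        ≈⟨ W.*-congˡ {PW.pow X k} step ⟩
        PW.pow X k W.* (P W.+ X W.* g)          ≈⟨ solve 4 (λ q p x g → q :* (p :+ x :* g) := p :* q :+ (x :* q) :* g) W.refl (PW.pow X k) P X g ⟩
        P W.* PW.pow X k W.+ PW.pow X (suc k) W.* g ≈⟨ W.+-congˡ {P W.* PW.pow X k} (geometric (suc k) n) ⟩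
        P W.* PW.pow X k W.+ (ΣW.ΣL (λ i → P W.* PW.pow X i) (seg id (suc k) n) W.+ PW.pow X (suc k ℕ.+ n) W.* g)
          ≈⟨ W.sym (W.+-assoc _ _ _) ⟩
        ΣW.ΣL (λ i → P W.* PW.pow X i) (seg id k (suc n)) W.+ PW.pow X (suc k ℕ.+ n) W.* g
          ≡⟨ ≡.cong (λ j → ΣW.ΣL (λ i → P W.* PW.pow X i) (seg id k (suc n)) W.+ PW.pow X j W.* g) (≡.sym (ℕₚ.+-suc k n)) ⟩
        _ ∎
        where
        open import Relation.Binary.Reasoning.Setoid W.setoid
        open PW.Solver

      X-pow : ∀ k → PW.pow X k W.≈ i₁ (PU.pow x k) W.* i₂ (PU.pow x k)
      X-pow k = W.trans (PW.pow-* (i₁ x) (i₂ x) k) (W.sym (W.*-cong (i₁-pow x k) (i₂-pow x k)))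

      ord-x : S₁.Ord 2 x
      ord-x = ≡.subst (λ n → S₁.Ord n x) (ℕₚ.+-identityʳ 2) (S₁.Ord-* {2} {0} {b} {a⁻¹} ord-b S₁.Ord-0)

      ord-pow : ∀ k → S₁.Ord (k ℕ.* 2) (PU.pow x k)
      ord-pow k = S₁.Ord-pow ord-x k

      term : ∀ k → P W.* PW.pow X k W.≈ i₁ (L k) W.* i₂ (U′ k)
      term k = begin
        P W.* PW.pow X k           ≈⟨ W.*-congˡ {P} (X-pow k) ⟩
        (i₁ (c U.* a⁻¹) W.* i₂ a⁻¹) W.* (i₁ (PU.pow x k) W.* i₂ (PU.pow x k))
          ≈⟨ solve 4 (λ a b c d → (a :* b) :* (c :* d) := (a :* c) :* (b :* d)) W.refl _ _ _ _ ⟩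
        (i₁ (c U.* a⁻¹) W.* i₁ (PU.pow x k)) W.* (i₂ a⁻¹ W.* i₂ (PU.pow x k))
          ≈⟨ W.sym (W.*-cong (i₁-* _ _) (i₂-* _ _)) ⟩
        i₁ (L k) W.* i₂ (U′ k) ∎
        where
        open import Relation.Binary.Reasoning.Setoid W.setoid
        open PW.Solver

      remainder-ord : ∀ m → S₂.Ord (m ℕ.* 2) (PW.pow X m W.* g)
      remainder-ord m j j< j≤D = U.trans (W.trans (W.*-congʳ {g} (X-pow m)) (W.trans (W.*-comm _ g) (W.sym (W.*-assoc g _ _))) j j≤D)
        (S₂.Ord-* {0} {m ℕ.* 2} {g W.* i₁ (PU.pow x m)} S₂.Ord-0 ord-i₂ j j< j≤D)
        where
        ord-i₂ : S₂.Ord (m ℕ.* 2) (i₂ (PU.pow x m))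
        ord-i₂ n n< n≤ zero    _ = ord-pow m n n< n≤
        ord-i₂ n n< n≤ (suc i) _ = R.refl

    -- After m terms the remainder contains x(v)^m, hence has order 2 m in v and is not seen by v^j
    -- with j < 2 m.
    factorisation : ∀ m {i j} → i ℕ.≤ D → j ℕ.≤ D → j ℕ.< m ℕ.* 2 →
                    g j i R.≈ ΣR.ΣL (λ k → L k i R.* U′ k j) (seg id 0 m)
    factorisation m {i} {j} i≤D j≤D j< = begin
      g j i ≈⟨ W.trans (W.sym (W.*-identityˡ g)) (geometric 0 m) j j≤D i i≤D ⟩
      ΣW.ΣL (λ k → P W.* PW.pow X k) (seg id 0 m) j i R.+ (PW.pow X m W.* g) j i
        ≈⟨ R.+-congˡ (remainder-ord m j j< j≤D i i≤D) ⟩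
      ΣW.ΣL (λ k → P W.* PW.pow X k) (seg id 0 m) j i R.+ R.0# ≈⟨ R.+-identityʳ _ ⟩
      ΣW.ΣL (λ k → P W.* PW.pow X k) (seg id 0 m) j i   ≈⟨ S₂.coeff-ΣL _ (seg id 0 m) j i i≤D ⟩
      ΣU.ΣL (λ k → (P W.* PW.pow X k) j) (seg id 0 m) i ≈⟨ S₁.coeff-ΣL _ (seg id 0 m) i ⟩
      ΣR.ΣL (λ k → (P W.* PW.pow X k) j i) (seg id 0 m)
        ≈⟨ ΣR.ΣL-cong (seg id 0 m) (λ k → R.trans (term k j j≤D i i≤D) (coeff-i₁i₂ (L k) (U′ k) j i i≤D)) ⟩
      ΣR.ΣL (λ k → L k i R.* U′ k j) (seg id 0 m) ∎
      where open import Relation.Binary.Reasoning.Setoid R.setoid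

    ord-L : ∀ k → S₁.Ord (suc (k ℕ.* 2)) (L k)
    ord-L k = S₁.Ord-* {1} {k ℕ.* 2} (S₁.Ord-* {1} {0} {c} {a⁻¹} ord-c S₁.Ord-0) (ord-pow k)

    ord-U : ∀ k → S₁.Ord (k ℕ.* 2) (U′ k)
    ord-U k = S₁.Ord-* {0} {k ℕ.* 2} {a⁻¹} S₁.Ord-0 (ord-pow k)

    private
      module PR = RingTools R

      a⁻¹₀ : a⁻¹ 0 R.≈ α⁻¹
      a⁻¹₀ = begin
        a⁻¹ 0                       ≈⟨ R.trans (R.sym (R.*-identityˡ _)) (R.*-congʳ (R.sym unit)) ⟩
        (α⁻¹ R.* a 0) R.* a⁻¹ 0     ≈⟨ R.*-assoc _ _ _ ⟩
        α⁻¹ R.* (a 0 R.* a⁻¹ 0)     ≈⟨ R.*-congˡ (aa⁻¹ 0 z≤n) ⟩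
        α⁻¹ R.* R.1#                ≈⟨ R.*-identityʳ _ ⟩
        α⁻¹                         ∎
        where open import Relation.Binary.Reasoning.Setoid R.setoid

      lead-x : 2 ℕ.≤ D → x 2 R.≈ b 2 R.* α⁻¹
      lead-x 2≤D = R.trans (S₁.lead-* {2} {0} {b} {a⁻¹} ord-b S₁.Ord-0 2≤D) (R.*-congˡ a⁻¹₀)

      lead-pow : ∀ k → k ℕ.* 2 ℕ.≤ D → PU.pow x k (k ℕ.* 2) R.≈ PR.pow (b 2 R.* α⁻¹) k
      lead-pow zero    _  = R.refl
      lead-pow (suc k) le = R.trans (S₁.lead-* {2} {k ℕ.* 2} ord-x (ord-pow k) le)
        (R.*-cong (lead-x (ℕₚ.≤-trans (ℕₚ.m≤m+n 2 (k ℕ.* 2)) le)) (lead-pow k (ℕₚ.≤-trans (ℕₚ.m≤n+m (k ℕ.* 2) 2) le)))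

    lead-U : ∀ k → k ℕ.* 2 ℕ.≤ D → U′ k (k ℕ.* 2) R.≈ α⁻¹ R.* PR.pow (b 2 R.* α⁻¹) k
    lead-U k le = R.trans (S₁.lead-* {0} {k ℕ.* 2} {a⁻¹} S₁.Ord-0 (ord-pow k) le) (R.*-cong a⁻¹₀ (lead-pow k le))

    lead-L : ∀ k → suc (k ℕ.* 2) ℕ.≤ D → L k (suc (k ℕ.* 2)) R.≈ (c 1 R.* α⁻¹) R.* PR.pow (b 2 R.* α⁻¹) k
    lead-L k le = R.trans (S₁.lead-* {1} {k ℕ.* 2} (S₁.Ord-* {1} {0} {c} {a⁻¹} ord-c S₁.Ord-0) (ord-pow k) le)
      (R.*-cong (R.trans (S₁.lead-* {1} {0} {c} {a⁻¹} ord-c S₁.Ord-0 (ℕₚ.≤-trans (s≤s z≤n) le)) (R.*-congˡ a⁻¹₀))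
                (lead-pow k (ℕₚ.≤-trans (ℕₚ.n≤1+n _) le)))

-- Ring homomorphisms and the transport of sums

record RingHom (R R′ : CommutativeRing 0ℓ 0ℓ) : Set where
  private
    module R  = CommutativeRing R
    module R′ = CommutativeRing R′
  field
    ⟦_⟧   : R.Carrier → R′.Carrier
    ⟦⟧-cong : ∀ {x y} → x R.≈ y → ⟦ x ⟧ R′.≈ ⟦ y ⟧
    ⟦⟧-+    : ∀ x y → ⟦ x R.+ y ⟧ R′.≈ ⟦ x ⟧ R′.+ ⟦ y ⟧
    ⟦⟧-*    : ∀ x y → ⟦ x R.* y ⟧ R′.≈ ⟦ x ⟧ R′.* ⟦ y ⟧
    ⟦⟧-1    : ⟦ R.1# ⟧ R′.≈ R′.1#

  open import Relation.Binary.Reasoning.Setoid R′.setoid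

  ⟦⟧-0 : ⟦ R.0# ⟧ R′.≈ R′.0#
  ⟦⟧-0 = begin
    z                    ≈⟨ solve 1 (λ z → z := (z :+ z) :- z) R′.refl z ⟩
    (z R′.+ z) R′.- z    ≈⟨ R′.+-congʳ (R′.trans (R′.sym (⟦⟧-+ R.0# R.0#)) (⟦⟧-cong (R.+-identityʳ R.0#))) ⟩
    z R′.- z             ≈⟨ R′.-‿inverseʳ z ⟩
    R′.0#                ∎
    where
    open RingTools.Solver R′ using (solve; _:=_; _:+_; _:-_)
    z = ⟦ R.0# ⟧

  ⟦⟧-neg : ∀ x → ⟦ R.- x ⟧ R′.≈ R′.- ⟦ x ⟧
  ⟦⟧-neg x = begin
    ⟦ R.- x ⟧                        ≈⟨ solve 2 (λ y z → z := (y :+ z) :- y) R′.refl ⟦ x ⟧ ⟦ R.- x ⟧ ⟩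
    (⟦ x ⟧ R′.+ ⟦ R.- x ⟧) R′.- ⟦ x ⟧ ≈⟨ R′.+-congʳ (R′.trans (R′.sym (⟦⟧-+ x (R.- x))) (R′.trans (⟦⟧-cong (R.-‿inverseʳ x)) ⟦⟧-0)) ⟩
    R′.0# R′.- ⟦ x ⟧                 ≈⟨ R′.+-identityˡ _ ⟩
    R′.- ⟦ x ⟧                       ∎
    where open RingTools.Solver R′ using (solve; _:=_; _:+_; _:-_)

  private
    module RT  = RingTools R
    module RT′ = RingTools R′
    module SG  = Signs R
    module SG′ = Signs R′
    module Σ   = Summation R
    module Σ′  = Summation R′

  ⟦⟧-fromℕ′ : ∀ n → ⟦ RT.fromℕ′ n ⟧ R′.≈ RT′.fromℕ′ n
  ⟦⟧-fromℕ′ zero          = ⟦⟧-0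
  ⟦⟧-fromℕ′ (suc zero)    = ⟦⟧-1
  ⟦⟧-fromℕ′ (suc (suc n)) = R′.trans (⟦⟧-+ _ _) (R′.+-cong ⟦⟧-1 (⟦⟧-fromℕ′ (suc n)))

  ⟦⟧-fromℤ : ∀ i → ⟦ RT.fromℤ i ⟧ R′.≈ RT′.fromℤ i
  ⟦⟧-fromℤ (+ n)    = ⟦⟧-fromℕ′ n
  ⟦⟧-fromℤ -[1+ n ] = R′.trans (⟦⟧-neg _) (R′.-‿cong (⟦⟧-fromℕ′ (suc n)))

  ⟦⟧-sg : ∀ i → ⟦ SG.sg i ⟧ R′.≈ SG′.sg i
  ⟦⟧-sg = ℤ-ind _ ⟦⟧-1
    (λ i p → R′.trans (⟦⟧-cong (SG.sg-suc i)) (R′.trans (⟦⟧-neg _) (R′.trans (R′.-‿cong p) (R′.sym (SG′.sg-suc i)))))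
    (λ i p → R′.trans (⟦⟧-cong (R.trans (R.sym (-‿involutive _)) (R.-‿cong (R.sym (SG.sg-suc i)))))
      (R′.trans (⟦⟧-neg _) (R′.trans (R′.-‿cong (R′.trans p (SG′.sg-suc i))) (-‿involutive′ _))))
    where
    open Algebra.Properties.Ring R.ring using (-‿involutive)
    open Algebra.Properties.Ring R′.ring using () renaming (-‿involutive to -‿involutive′)

  ⟦⟧-pow : ∀ x n → ⟦ RT.pow x n ⟧ R′.≈ RT′.pow ⟦ x ⟧ n
  ⟦⟧-pow x zero    = ⟦⟧-1
  ⟦⟧-pow x (suc n) = R′.trans (⟦⟧-* _ _) (R′.*-congˡ (⟦⟧-pow x n))

  ⟦⟧-ΣL : {I : Set} (f : I → R.Carrier) (xs : List I) → ⟦ Σ.ΣL f xs ⟧ R′.≈ Σ′.ΣL (λ i → ⟦ f i ⟧) xs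
  ⟦⟧-ΣL f []       = ⟦⟧-0
  ⟦⟧-ΣL f (x ∷ xs) = R′.trans (⟦⟧-+ _ _) (R′.+-congˡ (⟦⟧-ΣL f xs))

  ⟦⟧-HasSum : {I : Set} {f : I → R.Carrier} {s : R.Carrier} → Σ.HasSum f s → Σ′.HasSum (λ i → ⟦ f i ⟧) ⟦ s ⟧
  ⟦⟧-HasSum hs = Σ′.hasSum supp unique (λ i i∉ → R′.trans (⟦⟧-cong (vanish i i∉)) ⟦⟧-0)
    (R′.trans (R′.sym (⟦⟧-ΣL _ supp)) (⟦⟧-cong total))
    where open Σ.HasSum hs

constHom : (D : ℕ) (R : CommutativeRing 0ℓ 0ℓ) → RingHom R (Series.seriesRing D R)
constHom D R = record
  { ⟦_⟧ = const′ ; ⟦⟧-cong = const-cong ; ⟦⟧-+ = const-+ ; ⟦⟧-* = const-* ; ⟦⟧-1 = λ _ _ → CommutativeRing.refl R }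
  where open Series D R

coefficientwiseHom : (D : ℕ) {R R′ : CommutativeRing 0ℓ 0ℓ} → RingHom R R′ → RingHom (Series.seriesRing D R) (Series.seriesRing D R′)
coefficientwiseHom D {R} {R′} ι = record
  { ⟦_⟧ = λ f k → ⟦ f k ⟧
  ; ⟦⟧-cong = λ f≈g k k≤ → ⟦⟧-cong (f≈g k k≤)
  ; ⟦⟧-+ = λ f g k _ → ⟦⟧-+ (f k) (g k)
  ; ⟦⟧-* = λ f g k _ → convolution f g k
  ; ⟦⟧-1 = λ { zero _ → ⟦⟧-1 ; (suc k) _ → ⟦⟧-0 } }
  where
  open RingHom ι
  module R′ = CommutativeRing R′
  convolution : ∀ f g k → ⟦ Series.conv D R f g k ⟧ R′.≈ Series.conv D R′ (λ k → ⟦ f k ⟧) (λ k → ⟦ g k ⟧) k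
  convolution f g zero    = ⟦⟧-* (f 0) (g 0)
  convolution f g (suc n) = R′.trans (⟦⟧-+ _ _) (R′.+-cong (⟦⟧-* (f 0) (g (suc n))) (convolution (f ∘ suc) g n))

-- The exponential series

-- Coefficients n ^ k / k! of exp (n u), over a ring containing the inverses of the positive integers.
module Exponential (D : ℕ) (R : CommutativeRing 0ℓ 0ℓ) (inv : ℕ → CommutativeRing.Carrier R)
  (inverse : ∀ k → CommutativeRing._≈_ R (CommutativeRing._*_ R (inv k) (RingTools.fromℕ′ R (suc k))) (CommutativeRing.1# R)) where
  open CommutativeRing R
  open RingTools R
  open Series D R
  open import Relation.Binary.Reasoning.Setoid setoid

  exp : ℤ → ℕ → Carrier
  exp n zero    = 1#
  exp n (suc k) = inv k * (fromℤ n * exp n k)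

  private
    -- The derivation u d/du; it keeps degrees, so no index is shifted in the product rule.
    euler : (ℕ → Carrier) → ℕ → Carrier
    euler f k = fromℕ′ k * f k

    euler-conv : ∀ f g k → euler (conv f g) k ≈ conv (euler f) g k + conv f (euler g) k
    euler-conv f g zero    = solve 2 (λ a b → con (+ 0) :* (a :* b) := con (+ 0) :* a :* b :+ a :* (con (+ 0) :* b)) refl (f 0) (g 0)
      where open Solver
    euler-conv f g (suc n) = begin
      fromℕ′ (suc n) * (f 0 * g (suc n) + conv (f ∘ suc) g n)
        ≈⟨ trans (distribˡ _ _ _) (+-congˡ (trans (*-congʳ (fromℕ′-suc n)) (trans (distribʳ _ _ _) (+-congˡ (euler-conv (f ∘ suc) g n))))) ⟩
      fromℕ′ (suc n) * (f 0 * g (suc n)) + (1# * conv (f ∘ suc) g n + (conv (euler (f ∘ suc)) g n + conv (f ∘ suc) (euler g) n))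
        ≈⟨ solve 6 (λ s a b x y z → s :* (a :* b) :+ (con (+ 1) :* x :+ (y :+ z)) := (con (+ 0) :* a :* b :+ (x :+ y)) :+ (a :* (s :* b) :+ z)) refl
             (fromℕ′ (suc n)) (f 0) (g (suc n)) _ _ _ ⟩
      (0# * f 0 * g (suc n) + (conv (f ∘ suc) g n + conv (euler (f ∘ suc)) g n)) + (f 0 * euler g (suc n) + conv (f ∘ suc) (euler g) n)
        ≈⟨ +-congʳ (+-congˡ (trans (sym (conv-+ˡ (f ∘ suc) (euler (f ∘ suc)) g n))
             (conv-cong n (λ k _ → trans (+-congʳ (sym (*-identityˡ _))) (trans (sym (distribʳ _ _ _)) (*-congʳ (sym (fromℕ′-suc k))))) (λ _ _ → refl)))) ⟩
      conv (euler f) g (suc n) + conv f (euler g) (suc n) ∎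
      where open Solver

    euler-exp : ∀ n k → euler (exp n) (suc k) ≈ fromℤ n * exp n k
    euler-exp n k = trans (sym (*-assoc _ _ _)) (trans (*-congʳ (trans (*-comm _ _) (inverse k))) (*-identityˡ _))

    conv-euler : ∀ m n k → conv (euler (exp m)) (exp n) (suc k) ≈ fromℤ m * conv (exp m) (exp n) k
    conv-euler m n k = begin
      0# * 1# * exp n (suc k) + conv (euler (exp m) ∘ suc) (exp n) k
        ≈⟨ +-cong (trans (*-congʳ (zeroˡ _)) (zeroˡ _)) (conv-cong k (λ j _ → euler-exp m j) (λ _ _ → refl)) ⟩
      0# + conv (λ j → fromℤ m * exp m j) (exp n) k ≈⟨ trans (+-identityˡ _) (conv-*ˡ (fromℤ m) (exp m) (exp n) k) ⟩
      fromℤ m * conv (exp m) (exp n) k ∎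

  -- By the product rule for `euler`, both sides satisfy (k + 1) f_(k+1) = (m + n) f_k with f_0 = 1.
  exp-+ : ∀ m n k → exp (m ℤ.+ n) k ≈ conv (exp m) (exp n) k
  exp-+ m n zero    = sym (*-identityˡ _)
  exp-+ m n (suc k) = begin
    inv k * (fromℤ (m ℤ.+ n) * exp (m ℤ.+ n) k)
      ≈⟨ *-congˡ (*-cong (fromℤ-+ m n) (exp-+ m n k)) ⟩
    inv k * ((fromℤ m + fromℤ n) * c)
      ≈⟨ *-congˡ (distribʳ _ _ _) ⟩
    inv k * (fromℤ m * c + fromℤ n * c)
      ≈⟨ *-congˡ (+-cong (sym (conv-euler m n k)) (trans (*-congˡ (conv-comm (exp m) (exp n) k))
           (trans (sym (conv-euler n m k)) (conv-comm (euler (exp n)) (exp m) (suc k))))) ⟩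
    inv k * (conv (euler (exp m)) (exp n) (suc k) + conv (exp m) (euler (exp n)) (suc k))
      ≈⟨ *-congˡ (euler-conv (exp m) (exp n) (suc k)) ⟨
    inv k * (fromℕ′ (suc k) * conv (exp m) (exp n) (suc k))
      ≈⟨ trans (sym (*-assoc _ _ _)) (trans (*-congʳ (inverse k)) (*-identityˡ _)) ⟩
    conv (exp m) (exp n) (suc k) ∎
    where c = conv (exp m) (exp n) k

  factorialℕ : ℕ → Carrier
  factorialℕ zero    = 1#
  factorialℕ (suc k) = fromℕ′ (suc k) * factorialℕ k

  exp-pow : ∀ n k → factorialℕ k * exp n k ≈ pow (fromℤ n) k
  exp-pow n zero    = *-identityˡ _
  exp-pow n (suc k) = begin
    (fromℕ′ (suc k) * factorialℕ k) * (inv k * (fromℤ n * exp n k))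
      ≈⟨ solve 5 (λ s f i x e → (s :* f) :* (i :* (x :* e)) := (i :* s) :* (x :* (f :* e))) refl _ _ _ _ _ ⟩
    (inv k * fromℕ′ (suc k)) * (fromℤ n * (factorialℕ k * exp n k))
      ≈⟨ trans (*-cong (inverse k) (*-congˡ (exp-pow n k))) (*-identityˡ _) ⟩
    fromℤ n * pow (fromℤ n) k ∎
    where open Solver

  exp-0 : ∀ k → exp (+ 0) k ≈ const′ 1# k
  exp-0 zero    = refl
  exp-0 (suc k) = trans (*-congˡ (zeroˡ _)) (zeroʳ _)

  exp-neg : ∀ n k → (exp (ℤ.- n) (k ℕ.* 2) ≈ exp n (k ℕ.* 2)) × (exp (ℤ.- n) (suc (k ℕ.* 2)) ≈ - exp n (suc (k ℕ.* 2)))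
  exp-neg n k = even k , odd k (even k)
    where
    open Solver
    odd : ∀ k → exp (ℤ.- n) (k ℕ.* 2) ≈ exp n (k ℕ.* 2) → exp (ℤ.- n) (suc (k ℕ.* 2)) ≈ - exp n (suc (k ℕ.* 2))
    odd k p = trans (*-congˡ (*-cong (fromℤ-neg n) p)) (solve 3 (λ i x e → i :* ((:- x) :* e) := :- (i :* (x :* e))) refl _ _ _)
    even : ∀ k → exp (ℤ.- n) (k ℕ.* 2) ≈ exp n (k ℕ.* 2)
    even zero    = refl
    even (suc k) = trans (*-congˡ (*-cong (fromℤ-neg n) (odd k (even k))))
      (solve 3 (λ i x e → i :* ((:- x) :* (:- e)) := i :* (x :* e)) refl _ _ _)

-- The matrix of moments

module Moments (R : CommutativeRing 0ℓ 0ℓ) (h : CommutativeRing.Carrier R)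
    (h+h : CommutativeRing._≈_ R (CommutativeRing._+_ R h h) (CommutativeRing.1# R)) where
  open CommutativeRing R
  open RingTools R
  open Summation R
  open Signs R
  open Theta R h h+h
  open Algebra.Properties.Ring ring using (-‿distribˡ-*; -‿distribʳ-*; -0#≈0#; -‿involutive)
  open import Relation.Binary.Reasoning.Setoid setoid

  even odd : ℤ → ℤ
  even j = j ℤ.+ j
  odd  j = j ℤ.+ j ℤ.- + 1

  ∣i∣≤1+sq-even : ∀ i → ∣ i ∣ ℕ.≤ suc (sq (even i))
  ∣i∣≤1+sq-even i = ℕₚ.m≤n⇒m≤1+n (ℕₚ.≤-trans (lem i) (∣i∣≤sq (even i)))
    where
    lem : ∀ i → ∣ i ∣ ℕ.≤ ∣ even i ∣
    lem (+ n)    = ℕₚ.m≤m+n n n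
    lem -[1+ n ] = s≤s (ℕₚ.≤-trans (ℕₚ.m≤m+n n n) (ℕₚ.n≤1+n _))

  ∣i∣≤1+sq-odd : ∀ i → ∣ i ∣ ℕ.≤ suc (sq (odd i))
  ∣i∣≤1+sq-odd i = ℕₚ.m≤n⇒m≤1+n (ℕₚ.≤-trans (lem i) (∣i∣≤sq (odd i)))
    where
    lem : ∀ i → ∣ i ∣ ℕ.≤ ∣ odd i ∣
    lem (+ zero)   = z≤n
    lem (+ suc n)  = ℕₚ.m≤n+m (suc n) n
    lem -[1+ n ]   = s≤s (ℕₚ.≤-trans (ℕₚ.m≤m+n n n) (ℕₚ.≤-trans (ℕₚ.n≤1+n _) (ℕₚ.≤-trans (ℕₚ.m≤m+n _ 0) (ℕₚ.n≤1+n _))))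

  module Wronskian {B} (𝓣 : Nome B) where
    open Nome 𝓣

    -- The family `η` at the nome t⁴.
    η₄ : ℤ → Carrier
    η₄ n = sg n * fromℤ (+ 1 ℤ.+ (n ℤ.+ n)) * T (quad n)

    weighted : (ℤ → Carrier) → (ℤ → ℤ) → ℤ → Carrier
    weighted w f j = w (f j) * T (sq (f j))

    one square² : ℤ → Carrier
    one _     = 1#
    square² n = fromℤ n * fromℤ n

    private
      -- With P = m + n + 1 and N = m - n, (2 m + 1) (2 n + 1) = P² - N² and 1 + 2 m (m + 1) + 2 n
      -- (n + 1) = P² + N².
      merge : ∀ m n → T 1 * (η₄ m * η₄ n) ≈
        (sg m * sg n) * ((square² (+ 1 ℤ.+ (m ℤ.+ n)) - square² (m ℤ.- n)) * (T (sq (+ 1 ℤ.+ (m ℤ.+ n))) * T (sq (m ℤ.- n))))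
      merge m n = begin
        T 1 * (η₄ m * η₄ n)
          ≈⟨ solve 7 (λ t s x u r y v → t :* ((s :* x :* u) :* (r :* y :* v)) := (s :* r) :* ((x :* y) :* (t :* (u :* v)))) refl
               (T 1) (sg m) _ _ (sg n) _ _ ⟩
        (sg m * sg n) * ((fromℤ (+ 1 ℤ.+ (m ℤ.+ m)) * fromℤ (+ 1 ℤ.+ (n ℤ.+ n))) * (T 1 * (T (quad m) * T (quad n))))
          ≈⟨ *-congˡ (*-cong weights exponents) ⟩
        _ ∎
        where
        open Solver
        P = + 1 ℤ.+ (m ℤ.+ n)
        N = m ℤ.- n
        weights : fromℤ (+ 1 ℤ.+ (m ℤ.+ m)) * fromℤ (+ 1 ℤ.+ (n ℤ.+ n)) ≈ square² P - square² N
        weights = trans (sym (fromℤ-* (+ 1 ℤ.+ (m ℤ.+ m)) (+ 1 ℤ.+ (n ℤ.+ n)))) (trans (reflexive (≡.cong fromℤ (lem m n)))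
          (trans (fromℤ-+ (P ℤ.* P) (ℤ.- (N ℤ.* N))) (+-cong (fromℤ-* P P) (trans (fromℤ-neg (N ℤ.* N)) (-‿cong (fromℤ-* N N))))))
          where
          lem : ∀ m n → (+ 1 ℤ.+ (m ℤ.+ m)) ℤ.* (+ 1 ℤ.+ (n ℤ.+ n))
                        ≡ (+ 1 ℤ.+ (m ℤ.+ n)) ℤ.* (+ 1 ℤ.+ (m ℤ.+ n)) ℤ.- (m ℤ.- n) ℤ.* (m ℤ.- n)
          lem = solve-∀
        exponents : T 1 * (T (quad m) * T (quad n)) ≈ T (sq P) * T (sq N)
        exponents = trans (*-congˡ (sym (T-+ _ _))) (T-eq (exp≡
          (≡.cong₂ (λ a b → + 1 ℤ.+ (a ℤ.+ b)) (+quad m) (+quad n))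
          (≡.cong₂ ℤ._+_ (+sq P) (+sq N)) (lem m n)))
          where
          lem : ∀ m n → + 1 ℤ.+ (((m ℤ.* m ℤ.+ m) ℤ.+ (m ℤ.* m ℤ.+ m)) ℤ.+ ((n ℤ.* n ℤ.+ n) ℤ.+ (n ℤ.* n ℤ.+ n)))
                        ≡ (+ 1 ℤ.+ (m ℤ.+ n)) ℤ.* (+ 1 ℤ.+ (m ℤ.+ n)) ℤ.+ (m ℤ.- n) ℤ.* (m ℤ.- n)
          lem = solve-∀

    -- In the variables of `merge`, P and N have opposite parities. Each of the two parity patterns
    -- produces o₂ e₀ - o₀ e₂ once, the second through the sign of `sg`.
    wronskian : ∀ {k e₀ e₂ o₀ o₂} → HasSum η₄ k →
      HasSum (weighted one even) e₀ → HasSum (weighted square² even) e₂ →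
      HasSum (weighted one odd) o₀ → HasSum (weighted square² odd) o₂ →
      T 1 * (k * k) ≈ (o₂ * e₀ - o₀ * e₂) + (o₂ * e₀ - o₀ * e₂)
    wronskian {k} {e₀} {e₂} {o₀} {o₂} hk he₀ he₂ ho₀ ho₂ =
      trans (HasSum-unique (HasSum-*ˡ (T 1) (HasSum-× hk hk)) (rotate
        (HasSum-cong (λ (j , k) → pt₁ j k) (HasSum-+ (HasSum-× (HasSum-up ho₂) he₀) (HasSum-neg (HasSum-× (HasSum-up ho₀) he₂))))
        (HasSum-cong (λ (j , k) → pt₂ j k) (HasSum-+ (HasSum-× he₀ (HasSum-up ho₂)) (HasSum-neg (HasSum-× he₂ (HasSum-up ho₀)))))))
      (+-congˡ (+-cong (*-comm _ _) (-‿cong (*-comm _ _))))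
      where
      open Solver
      pt : ∀ m n {P N σ} → + 1 ℤ.+ (m ℤ.+ n) ≡ P → m ℤ.- n ≡ N → σ ≈ sg m * sg n →
           σ * ((square² P - square² N) * (T (sq P) * T (sq N))) ≈ T 1 * (η₄ m * η₄ n)
      pt m n ≡.refl ≡.refl σ≈ = trans (*-congʳ σ≈) (sym (merge m n))
      sign₁ : ∀ j k → 1# ≈ sg (j ℤ.+ k) * sg (j ℤ.- k)
      sign₁ j k = sym (trans (sym (sg-+ (j ℤ.+ k) (j ℤ.- k))) (trans (reflexive (≡.cong sg (lem j k))) (trans (sg-+ j j) (sg² j))))
        where
        lem : ∀ j k → (j ℤ.+ k) ℤ.+ (j ℤ.- k) ≡ j ℤ.+ j
        lem = solve-∀
      sign₂ : ∀ j k → - 1# ≈ sg (j ℤ.+ k) * sg (j ℤ.- + 1 ℤ.- k)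
      sign₂ j k = sym (trans (sym (sg-+ (j ℤ.+ k) (j ℤ.- + 1 ℤ.- k))) (trans (reflexive (≡.cong sg (lem j k)))
        (trans (sg-+ (j ℤ.+ j) -[1+ 0 ]) (trans (*-congʳ (trans (sg-+ j j) (sg² j))) (*-identityˡ _)))))
        where
        lem : ∀ j k → (j ℤ.+ k) ℤ.+ (j ℤ.- + 1 ℤ.- k) ≡ (j ℤ.+ j) ℤ.- + 1
        lem = solve-∀
      P₁ : ∀ j k → + 1 ℤ.+ ((j ℤ.+ k) ℤ.+ (j ℤ.- k)) ≡ (+ 1 ℤ.+ j) ℤ.+ (+ 1 ℤ.+ j) ℤ.- + 1
      P₁ = solve-∀
      N₁ : ∀ j k → (j ℤ.+ k) ℤ.- (j ℤ.- k) ≡ k ℤ.+ k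
      N₁ = solve-∀
      P₂ : ∀ j k → + 1 ℤ.+ ((j ℤ.+ k) ℤ.+ (j ℤ.- + 1 ℤ.- k)) ≡ j ℤ.+ j
      P₂ = solve-∀
      N₂ : ∀ j k → (j ℤ.+ k) ℤ.- (j ℤ.- + 1 ℤ.- k) ≡ (+ 1 ℤ.+ k) ℤ.+ (+ 1 ℤ.+ k) ℤ.- + 1
      N₂ = solve-∀
      pt₁ : ∀ j k → weighted square² odd (+ 1 ℤ.+ j) * weighted one even k - weighted one odd (+ 1 ℤ.+ j) * weighted square² even k
                    ≈ T 1 * (η₄ (j ℤ.+ k) * η₄ (j ℤ.- k))
      pt₁ j k = trans (solve 4 (λ x y u v → (x :* u) :* (con (+ 1) :* v) :- (con (+ 1) :* u) :* (y :* v) := con (+ 1) :* ((x :- y) :* (u :* v))) refl _ _ _ _)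
        (pt (j ℤ.+ k) (j ℤ.- k) (P₁ j k) (N₁ j k) (sign₁ j k))
      pt₂ : ∀ j k → weighted one even j * weighted square² odd (+ 1 ℤ.+ k) - weighted square² even j * weighted one odd (+ 1 ℤ.+ k)
                    ≈ T 1 * (η₄ (j ℤ.+ k) * η₄ (j ℤ.- + 1 ℤ.- k))
      pt₂ j k = trans (solve 4 (λ x y u v → (con (+ 1) :* u) :* (y :* v) :- (x :* u) :* (con (+ 1) :* v) := (:- con (+ 1)) :* ((x :- y) :* (u :* v))) refl _ _ _ _)
        (pt (j ℤ.+ k) (j ℤ.- + 1 ℤ.- k) (P₂ j k) (N₂ j k) (sign₂ j k))

    -- This is `theta-product` at u = v = 0, where the two theta functions coincide.
    theta-square : ∀ {p e₀ o₀} → HasSum (λ n → sg n * T (sq n ℕ.+ sq n)) p → HasSum (weighted one even) e₀ → HasSum (weighted one odd) o₀ →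
                   e₀ * e₀ - o₀ * o₀ ≈ p * p
    theta-square hp he ho = HasSum-unique (Product.theta-product he he ho ho)
      (HasSum-cong (λ (n , m) → trans (solve 4 (λ s u r v → (s :* u) :* (r :* v) := (s :* r) :* con (+ 1) :* (u :* v)) refl _ _ _ _) (*-congˡ (sym (T-+ _ _)))) (HasSum-× hp hp))
      where
      open Solver
      module Product = Kronecker.Product R h h+h 𝓣 (λ _ _ → 1#) (λ _ _ _ _ → sym (*-identityˡ 1#))

    c′-sum : ∃ (HasSum (λ p → fromℤ p * (sg p * T (quad p))))
    c′-sum = let s , hs = theta (λ p → fromℤ p * sg p) quad ∣i∣≤1+quad in s , HasSum-cong (λ p → *-assoc _ _ _) hs

    -- In the weight 2 p + 1 the summand 1 contributes `quad-sum`, which is 0.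
    η₄-half : ∀ {k c′} → HasSum η₄ k → HasSum (λ p → fromℤ p * (sg p * T (quad p))) c′ → k ≈ c′ + c′
    η₄-half {k} {c′} hk hc′ = trans (HasSum-unique hk (HasSum-cong pt (HasSum-+ (HasSum-+ hc′ hc′) (proj₂ (quad-sum 𝓣)))))
      (trans (+-congˡ (quad-sum≈0 𝓣 (proj₂ (quad-sum 𝓣)))) (+-identityʳ _))
      where
      open Solver
      pt : ∀ p → (fromℤ p * (sg p * T (quad p)) + fromℤ p * (sg p * T (quad p))) + sg p * T (quad p) ≈ η₄ p
      pt p = trans (solve 3 (λ x s t → (x :* (s :* t) :+ x :* (s :* t)) :+ s :* t := s :* (con (+ 1) :+ (x :+ x)) :* t) refl (fromℤ p) (sg p) (T (quad p)))
        (*-congʳ (*-congˡ (sym (trans (fromℤ-+ (+ 1) (p ℤ.+ p)) (+-congˡ (fromℤ-+ p p))))))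

liftNome : {R R′ : CommutativeRing 0ℓ 0ℓ} {h : CommutativeRing.Carrier R} {h′ : CommutativeRing.Carrier R′} →
  ∀ {h+h h′+h′ B} → RingHom R R′ → Theta.Nome R h h+h B → Theta.Nome R′ h′ h′+h′ B
liftNome {R′ = R′} ι 𝓣 = record
  { T = λ k → ⟦ T k ⟧
  ; T-0 = R′.trans (⟦⟧-cong T-0) ⟦⟧-1
  ; T-+ = λ m n → R′.trans (⟦⟧-cong (T-+ m n)) (⟦⟧-* _ _)
  ; T-null = λ k B≤k → R′.trans (⟦⟧-cong (T-null k B≤k)) ⟦⟧-0 }
  where
  open RingHom ι
  open Theta.Nome 𝓣
  module R′ = CommutativeRing R′

-- R contains t, U adjoins u and W adjoins v to U. The degree `D` truncates u and v and is
-- independent of the truncation in t.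
module Characters (R : CommutativeRing 0ℓ 0ℓ) (h : CommutativeRing.Carrier R)
    (h+h : CommutativeRing._≈_ R (CommutativeRing._+_ R h h) (CommutativeRing.1# R))
    (inv : ℕ → CommutativeRing.Carrier R)
    (inverse : ∀ k → CommutativeRing._≈_ R (CommutativeRing._*_ R (inv k) (RingTools.fromℕ′ R (suc k))) (CommutativeRing.1# R))
    (D : ℕ) {B : ℕ} (𝓣 : Theta.Nome R h h+h B) where
  open CommutativeRing R
  open Exponential D R inv inverse public
  open TwoVariables D R public
  open Moments R h h+h
  open Theta.Nome 𝓣
  private
    module S₁ = Series D R
  U-ring = S₁.seriesRing
  W-ring = Series.seriesRing D U-ring
  module U = CommutativeRing U-ring
  module W = CommutativeRing W-ring

  c₀ : RingHom R U-ring
  c₀ = constHom D R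
  c₁ : RingHom U-ring W-ring
  c₁ = constHom D U-ring
  module C₀ = RingHom c₀
  module C₁ = RingHom c₁
  module C₂ = RingHom (coefficientwiseHom D c₀)

  module _ {R′ : CommutativeRing 0ℓ 0ℓ} (ι : RingHom R R′) where
    private module R′ = CommutativeRing R′
    image-half : RingHom.⟦_⟧ ι h R′.+ RingHom.⟦_⟧ ι h R′.≈ R′.1#
    image-half = R′.trans (R′.sym (RingHom.⟦⟧-+ ι h h)) (R′.trans (RingHom.⟦⟧-cong ι h+h) (RingHom.⟦⟧-1 ι))

  hᵁ : U.Carrier
  hᵁ = C₀.⟦ h ⟧
  hᵁ+hᵁ : hᵁ U.+ hᵁ U.≈ U.1#
  hᵁ+hᵁ = image-half c₀
  hᵂ : W.Carrier
  hᵂ = C₁.⟦ hᵁ ⟧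
  hᵂ+hᵂ : hᵂ W.+ hᵂ W.≈ W.1#
  hᵂ+hᵂ = W.trans (W.sym (C₁.⟦⟧-+ hᵁ hᵁ)) (W.trans (C₁.⟦⟧-cong hᵁ+hᵁ) C₁.⟦⟧-1)

  𝓣ᵁ : Theta.Nome U-ring hᵁ hᵁ+hᵁ B
  𝓣ᵁ = liftNome c₀ 𝓣
  𝓣ᵂ : Theta.Nome W-ring hᵂ hᵂ+hᵂ B
  𝓣ᵂ = liftNome c₁ 𝓣ᵁ

  Tᵁ : ℕ → U.Carrier
  Tᵁ k = C₀.⟦ T k ⟧
  Tᵂ : ℕ → W.Carrier
  Tᵂ k = C₁.⟦ Tᵁ k ⟧

  scalar₁₂ : ∀ x → i₁ C₀.⟦ x ⟧ W.≈ i₂ C₀.⟦ x ⟧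
  scalar₁₂ x zero    _ i       _ = refl
  scalar₁₂ x (suc j) _ zero    _ = refl
  scalar₁₂ x (suc j) _ (suc i) _ = refl

  coeff-scalar : ∀ f x k → (f U.* C₀.⟦ x ⟧) k ≈ f k * x
  coeff-scalar f x k = trans (S₁.conv-comm f C₀.⟦ x ⟧ k) (trans (S₁.conv-const x f k) (*-comm _ _))

  E : ℤ → ℤ → W.Carrier
  E s d = i₁ (exp s) W.* i₂ (exp d)

  E-+ : ∀ s s′ d d′ → E (s ℤ.+ s′) (d ℤ.+ d′) W.≈ E s d W.* E s′ d′
  E-+ s s′ d d′ = W.trans (W.*-cong (W.trans (i₁-cong (λ k _ → exp-+ s s′ k)) (i₁-* (exp s) (exp s′)))
                                    (W.trans (i₂-cong (λ k _ → exp-+ d d′ k)) (i₂-* (exp d) (exp d′))))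
    (solve 4 (λ a b c d → (a :* b) :* (c :* d) := (a :* c) :* (b :* d)) W.refl (i₁ (exp s)) (i₁ (exp s′)) (i₂ (exp d)) (i₂ (exp d′)))
    where open RingTools.Solver W-ring

  private
    module ΣU = Summation U-ring
    module ΣW = Summation W-ring
    module SU = Signs U-ring
    module SW = Signs W-ring
    module RU = RingTools U-ring
    module RW = RingTools W-ring
    module NU = Theta.Nome 𝓣ᵁ
    module NW = Theta.Nome 𝓣ᵂ

  e-sum : ∃ (ΣU.HasSum (λ j → exp (even j) U.* Tᵁ (sq (even j))))
  e-sum = NU.theta (exp ∘ even) (sq ∘ even) ∣i∣≤1+sq-even

  o-sum : ∃ (ΣU.HasSum (λ j → exp (odd j) U.* Tᵁ (sq (odd j))))
  o-sum = NU.theta (exp ∘ odd) (sq ∘ odd) ∣i∣≤1+sq-odd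

  c-sum : ∃ (ΣU.HasSum (λ r → exp (+ 1 ℤ.+ (r ℤ.+ r)) U.* (SU.sg r U.* Tᵁ (quad r))))
  c-sum = let s , hs = NU.theta (λ r → exp (+ 1 ℤ.+ (r ℤ.+ r)) U.* SU.sg r) quad ∣i∣≤1+quad in
    s , ΣU.HasSum-cong (λ r → U.*-assoc (exp (+ 1 ℤ.+ (r ℤ.+ r))) (SU.sg r) (Tᵁ (quad r))) hs

  eᵁ oᵁ cᵁ : U.Carrier
  eᵁ = proj₁ e-sum
  oᵁ = proj₁ o-sum
  cᵁ = proj₁ c-sum

  private
    module K = Kronecker W-ring hᵂ hᵂ+hᵂ
  module P = K.Product 𝓣ᵂ E E-+

  private
    i₂exp0 : i₂ (exp (+ 0)) W.≈ W.1#
    i₂exp0 = W.trans (i₂-cong (λ k _ → exp-0 k)) i₂-1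

    i₁exp0 : i₁ (exp (+ 0)) W.≈ W.1#
    i₁exp0 = i₁-cong (λ k _ → exp-0 k)

    first : ∀ n k → i₁ (exp n U.* Tᵁ k) W.≈ E n (+ 0) W.* Tᵂ k
    first n k = W.trans (i₁-* (exp n) (Tᵁ k)) (W.*-congʳ {Tᵂ k} (W.trans (W.sym (W.*-identityʳ (i₁ (exp n))))
      (W.*-congˡ {i₁ (exp n)} (W.sym i₂exp0))))

    second : ∀ n k → i₂ (exp n U.* Tᵁ k) W.≈ E (+ 0) n W.* Tᵂ k
    second n k = W.trans (i₂-* (exp n) (Tᵁ k)) (W.*-cong (W.trans (W.sym (W.*-identityˡ (i₂ (exp n))))
      (W.*-congʳ {i₂ (exp n)} (W.sym i₁exp0))) (W.sym (scalar₁₂ (T k))))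

    e₁ : ΣW.HasSum P.e₁ (i₁ eᵁ)
    e₁ = ΣW.HasSum-cong (λ j → first (even j) (sq (even j))) (C₁.⟦⟧-HasSum (proj₂ e-sum))
    e₂ : ΣW.HasSum P.e₂ (i₂ eᵁ)
    e₂ = ΣW.HasSum-cong (λ j → second (even j) (sq (even j))) (C₂.⟦⟧-HasSum (proj₂ e-sum))
    o₁ : ΣW.HasSum P.o₁ (i₁ oᵁ)
    o₁ = ΣW.HasSum-cong (λ j → first (odd j) (sq (odd j))) (C₁.⟦⟧-HasSum (proj₂ o-sum))
    o₂ : ΣW.HasSum P.o₂ (i₂ oᵁ)
    o₂ = ΣW.HasSum-cong (λ j → second (odd j) (sq (odd j))) (C₂.⟦⟧-HasSum (proj₂ o-sum))

    cᵂ : ΣW.HasSum (λ r → E (+ 1 ℤ.+ (r ℤ.+ r)) (+ 0) W.* (SW.sg r W.* Tᵂ (quad r))) (i₁ cᵁ)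
    cᵂ = ΣW.HasSum-cong pt (C₁.⟦⟧-HasSum (proj₂ c-sum))
      where
      pt : ∀ r → i₁ (exp (+ 1 ℤ.+ (r ℤ.+ r)) U.* (SU.sg r U.* Tᵁ (quad r))) W.≈ E (+ 1 ℤ.+ (r ℤ.+ r)) (+ 0) W.* (SW.sg r W.* Tᵂ (quad r))
      pt r = W.trans (i₁-* (exp (+ 1 ℤ.+ (r ℤ.+ r))) (SU.sg r U.* Tᵁ (quad r))) (W.*-cong
        (W.trans (W.sym (W.*-identityʳ (i₁ (exp (+ 1 ℤ.+ (r ℤ.+ r)))))) (W.*-congˡ {i₁ (exp (+ 1 ℤ.+ (r ℤ.+ r)))} (W.sym i₂exp0)))
        (W.trans (i₁-* (SU.sg r) (Tᵁ (quad r))) (W.*-congʳ {Tᵂ (quad r)} (C₁.⟦⟧-sg r))))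

  Kronecker-series : ∀ {g c′} → ΣW.HasSum P.G g → Summation.HasSum R (λ p → RingTools.fromℤ R p * (Signs.sg R p * T (quad p))) c′ →
    g W.* (i₁ eᵁ W.* i₂ eᵁ W.- i₁ oᵁ W.* i₂ oᵁ) W.≈ i₁ (cᵁ U.* C₀.⟦ T 1 * c′ ⟧)
  Kronecker-series {g} {c′} hg hc′ = W.trans (P.Kronecker hc′ᵂ hg (P.theta-product e₁ e₂ o₁ o₂) cᵂ)
    (W.trans (W.*-congˡ {i₁ cᵁ} (W.trans (W.sym (i₁-* (Tᵁ 1) C₀.⟦ c′ ⟧)) (i₁-cong (U.sym (C₀.⟦⟧-* (T 1) c′)))))
             (W.sym (i₁-* cᵁ C₀.⟦ T 1 * c′ ⟧)))
    where
    hc′ᵂ : ΣW.HasSum (λ p → RW.fromℤ p W.* (SW.sg p W.* Tᵂ (quad p))) (i₁ C₀.⟦ c′ ⟧)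
    hc′ᵂ = ΣW.HasSum-cong (λ p → W.trans (C₁.⟦⟧-cong (C₀.⟦⟧-* _ _)) (W.trans (i₁-* C₀.⟦ RingTools.fromℤ R p ⟧ C₀.⟦ Signs.sg R p * T (quad p) ⟧)
      (W.*-cong (W.trans (C₁.⟦⟧-cong (C₀.⟦⟧-fromℤ p)) (C₁.⟦⟧-fromℤ p))
        (W.trans (C₁.⟦⟧-cong (C₀.⟦⟧-* (Signs.sg R p) (T (quad p)))) (W.trans (i₁-* C₀.⟦ Signs.sg R p ⟧ (Tᵁ (quad p)))
          (W.*-congʳ {Tᵂ (quad p)} (W.trans (C₁.⟦⟧-cong (C₀.⟦⟧-sg p)) (C₁.⟦⟧-sg p))))))))
      (C₁.⟦⟧-HasSum (C₀.⟦⟧-HasSum hc′))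

-- Two bounds on the powers of t are kept. The form B + 3 allows the two substitutions t ↦ t² behind
-- `c′≈`; the bound `K` fixes the box of summation, so that it can be matched with the box of `rhs`.
module MomentMatrix (R : CommutativeRing 0ℓ 0ℓ) (h : CommutativeRing.Carrier R)
    (h+h : CommutativeRing._≈_ R (CommutativeRing._+_ R h h) (CommutativeRing.1# R))
    (inv : ℕ → CommutativeRing.Carrier R)
    (inverse : ∀ k → CommutativeRing._≈_ R (CommutativeRing._*_ R (inv k) (RingTools.fromℕ′ R (suc k))) (CommutativeRing.1# R))
    (D : ℕ) (2≤D : 2 ℕ.≤ D) {B : ℕ} (𝓣 : Theta.Nome R h h+h (suc (suc (suc B))))
    (K : ℕ) (T-null : ∀ k → K ℕ.≤ k → CommutativeRing._≈_ R (Theta.Nome.T 𝓣 k) (CommutativeRing.0# R)) where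
  open CommutativeRing R
  open RingTools R
  open Summation R
  open Signs R
  open Theta R h h+h
  open Nome 𝓣 hiding (T-null)
  open Moments R h h+h
  open Wronskian 𝓣
  open Alternating R
  open Characters R h h+h inv inverse D 𝓣
  open Algebra.Properties.Ring ring using (-‿distribˡ-*; -‿distribʳ-*; -0#≈0#)
  open import Relation.Binary.Reasoning.Setoid setoid
  private
    module S₁ = Series D R
    module S₂ = Series D U-ring
    module ΣU = Summation U-ring
    module ΣW = Summation W-ring
    module SU = Signs U-ring
    module SW = Signs W-ring

  size : ℕ × ℕ → ℕ
  size (a , b) = suc (a ℕ.+ a) ℕ.* suc (b ℕ.+ b)

  boxℕ : List (ℕ × ℕ)
  boxℕ = cartesianProduct (upTo K) (upTo K)

  private
    ∉boxℕ : ∀ {a b} → (a , b) ∉ boxℕ → K ℕ.≤ size (a , b)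
    ∉boxℕ {a} {b} ab∉ with ℕₚ.<-≤-connex a K | ℕₚ.<-≤-connex b K
    ... | inj₁ a<K | inj₁ b<K = ⊥-elim (ab∉ (∈ₚ.∈-cartesianProduct⁺ (∈ₚ.∈-upTo⁺ a<K) (∈ₚ.∈-upTo⁺ b<K)))
    ... | inj₂ K≤a | _        = ℕₚ.≤-trans K≤a (ℕₚ.≤-trans (ℕₚ.m≤n⇒m≤1+n (ℕₚ.m≤m+n a a)) (ℕₚ.m≤m*n (suc (a ℕ.+ a)) (suc (b ℕ.+ b))))
    ... | inj₁ _   | inj₂ K≤b = ℕₚ.≤-trans K≤b (ℕₚ.≤-trans (ℕₚ.m≤n⇒m≤1+n (ℕₚ.m≤m+n b b)) (ℕₚ.m≤n*m (suc (b ℕ.+ b)) (suc (a ℕ.+ a))))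

    quadrant : (ℕ × ℕ) ⊎ (ℕ × ℕ) → ℤ × ℤ
    quadrant (inj₁ (a , b)) = + a , + b
    quadrant (inj₂ (a , b)) = -[1+ a ] , -[1+ b ]

    quadrant-injective : ∀ {x y} → quadrant x ≡ quadrant y → x ≡ y
    quadrant-injective {inj₁ (a , b)} {inj₁ (.a , .b)} ≡.refl = ≡.refl
    quadrant-injective {inj₁ (a , b)} {inj₂ (c , d)} ()
    quadrant-injective {inj₂ (a , b)} {inj₁ (c , d)} ()
    quadrant-injective {inj₂ (a , b)} {inj₂ (.a , .b)} ≡.refl = ≡.refl

    G₁ G₂ : ℕ × ℕ → W.Carrier
    G₁ ab = P.G (quadrant (inj₁ ab))
    G₂ ab = P.G (quadrant (inj₂ ab))

    Tᵂ-null : ∀ k → K ℕ.≤ k → Tᵂ k W.≈ W.0#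
    Tᵂ-null k K≤k = W.trans (C₁.⟦⟧-cong (U.trans (C₀.⟦⟧-cong (T-null k K≤k)) C₀.⟦⟧-0)) C₁.⟦⟧-0

    finite : (F : ℕ × ℕ → W.Carrier) → (∀ ab → K ℕ.≤ size ab → F ab W.≈ W.0#) → ΣW.HasSum F (ΣW.ΣL F boxℕ)
    finite F null = ΣW.hasSum boxℕ (Uₚ.cartesianProduct⁺ (Uₚ.upTo⁺ K) (Uₚ.upTo⁺ K))
      (λ ab ab∉ → null ab (∉boxℕ ab∉)) W.refl

    g : W.Carrier
    g = ΣW.ΣL G₁ boxℕ W.+ ΣW.ΣL G₂ boxℕ

    hg : ΣW.HasSum P.G g
    hg = ΣW.HasSum-push quadrant quadrant-injective image (ΣW.HasSum-⊎
      (finite G₁ (λ (a , b) K≤ → W.trans (W.*-congˡ {W.1# W.* E (+ 1 ℤ.+ (+ a ℤ.+ + b)) (+ a ℤ.- + b)} (Tᵂ-null _ K≤)) (W.zeroʳ _)))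
      (finite G₂ (λ (a , b) K≤ → W.trans (W.*-congˡ {(W.- W.1#) W.* E (+ 1 ℤ.+ (-[1+ a ] ℤ.+ -[1+ b ])) (-[1+ a ] ℤ.- -[1+ b ])} (Tᵂ-null _ K≤)) (W.zeroʳ _))))
      where
      image : ∀ ab → (∃ λ x → ab ≡ quadrant x) ⊎ (P.G ab W.≈ W.0#)
      image (+ a , + b)           = inj₁ (inj₁ (a , b) , ≡.refl)
      image (-[1+ a ] , -[1+ b ]) = inj₁ (inj₂ (a , b) , ≡.refl)
      image (+ a , -[1+ b ])      = inj₂ (W.trans (W.*-congʳ {Tᵂ _} (W.zeroˡ _)) (W.zeroˡ _))
      image (-[1+ a ] , + b)      = inj₂ (W.trans (W.*-congʳ {Tᵂ _} (W.zeroˡ _)) (W.zeroˡ _))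

    coeff-E : ∀ s d n {i j} → i ℕ.≤ D → j ℕ.≤ D → (E s d W.* Tᵂ n) j i ≈ exp s i * exp d j * T n
    coeff-E s d n {i} {j} i≤D j≤D = begin
      (E s d W.* Tᵂ n) j i
        ≈⟨ W.trans (solve 3 (λ a b c → (a :* b) :* c := (a :* c) :* b) W.refl (i₁ (exp s)) (i₂ (exp d)) (Tᵂ n))
             (W.*-congʳ {i₂ (exp d)} (W.sym (i₁-* (exp s) (Tᵁ n)))) j j≤D i i≤D ⟩
      (i₁ (exp s U.* Tᵁ n) W.* i₂ (exp d)) j i ≈⟨ coeff-i₁i₂ (exp s U.* Tᵁ n) (exp d) j i i≤D ⟩
      (exp s U.* Tᵁ n) i * exp d j ≈⟨ *-congʳ (coeff-scalar (exp s) (T n) i) ⟩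
      exp s i * T n * exp d j     ≈⟨ Solver.solve 3 (λ a b c → a :*′ b :*′ c :=′ a :*′ c :*′ b) refl (exp s i) (T n) (exp d j) ⟩
      exp s i * exp d j * T n ∎
      where
      open RingTools.Solver W-ring using (solve; _:*_; _:=_)
      open Solver using () renaming (_:*_ to _:*′_; _:=_ to _:=′_)

  sum diff : ℕ × ℕ → ℤ
  sum  (a , b) = + suc (a ℕ.+ b)
  diff (a , b) = + a ℤ.- + b

  module _ (i j : ℕ) (i≤D : suc (i ℕ.* 2) ℕ.≤ D) (j≤D : j ℕ.* 2 ℕ.≤ D) where
    private
      I J : ℕ
      I = suc (i ℕ.* 2)
      J = j ℕ.* 2

      F : ℕ × ℕ → Carrier
      F ab = exp (sum ab) I * exp (diff ab) J * T (size ab)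

      G₁-coeff : ∀ ab → G₁ ab J I ≈ F ab
      G₁-coeff (a , b) = trans (W.*-congʳ {Tᵂ (size (a , b))} (W.*-identityˡ (E (sum (a , b)) (diff (a , b)))) J j≤D I i≤D)
        (coeff-E (sum (a , b)) (diff (a , b)) (size (a , b)) i≤D j≤D)

      G₂-coeff : ∀ ab → G₂ ab J I ≈ F ab
      G₂-coeff (a , b) = begin
        G₂ (a , b) J I
          ≈⟨ W.trans (solve 2 (λ e t → ((:- con (+ 1)) :* e) :* t := :- (e :* t)) W.refl (E s′ d′) (Tᵂ (size (a , b)))) (W.refl {W.- (E s′ d′ W.* Tᵂ (size (a , b)))}) J j≤D I i≤D ⟩
        - (E s′ d′ W.* Tᵂ (size (a , b))) J I   ≈⟨ -‿cong (coeff-E s′ d′ (size (a , b)) i≤D j≤D) ⟩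
        - (exp s′ I * exp d′ J * T (size (a , b)))
          ≡⟨ ≡.cong₂ (λ s d → - (exp s I * exp d J * T (size (a , b)))) (lem₁ (+ a) (+ b)) (lem₂ (+ a) (+ b)) ⟩
        - (exp (ℤ.- sum (a , b)) I * exp (ℤ.- diff (a , b)) J * T (size (a , b)))
          ≈⟨ -‿cong (*-congʳ (*-cong (proj₂ (exp-neg (sum (a , b)) i)) (proj₁ (exp-neg (diff (a , b)) j)))) ⟩
        - (- exp (sum (a , b)) I * exp (diff (a , b)) J * T (size (a , b)))
          ≈⟨ Solver.solve 3 (λ x y t → :-′ ((:-′ x) :*′ y :*′ t) :=′ x :*′ y :*′ t) refl _ _ _ ⟩
        F (a , b) ∎
        where
        open RingTools.Solver W-ring using (solve; con; :-_; _:*_; _:=_)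
        open Solver using () renaming (_:*_ to _:*′_; _:=_ to _:=′_; :-_ to :-′_)
        s′ = + 1 ℤ.+ (-[1+ a ] ℤ.+ -[1+ b ])
        d′ = -[1+ a ] ℤ.- -[1+ b ]
        lem₁ : ∀ a b → + 1 ℤ.+ (ℤ.- (+ 1 ℤ.+ a) ℤ.+ ℤ.- (+ 1 ℤ.+ b)) ≡ ℤ.- (+ 1 ℤ.+ (a ℤ.+ b))
        lem₁ = solve-∀
        lem₂ : ∀ a b → ℤ.- (+ 1 ℤ.+ a) ℤ.- (ℤ.- (+ 1 ℤ.+ b)) ≡ ℤ.- (a ℤ.- b)
        lem₂ = solve-∀

    -- Passing to the quadrant a, b < 0 negates s and d. As I is odd and J even this changes the
    -- sign once, against the sign of `ε`, so both quadrants contribute equally.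
    g-coeff : g J I ≈ ΣL F boxℕ + ΣL F boxℕ
    g-coeff = +-cong (coefficient G₁ G₁-coeff) (coefficient G₂ G₂-coeff)
      where
      coefficient : ∀ H → (∀ ab → H ab J I ≈ F ab) → ΣW.ΣL H boxℕ J I ≈ ΣL F boxℕ
      coefficient H eq = trans (S₂.coeff-ΣL H boxℕ J I i≤D) (trans (S₁.coeff-ΣL (λ ab → H ab J) boxℕ I) (ΣL-cong boxℕ eq))

    -- The factorials turn the coefficients of exp back into powers, and h undoes the doubling in
    -- `g-coeff`.
    pairing-g : pairing (T ∘ size) boxℕ (λ ab → pow (fromℤ (sum ab)) I) (λ ab → pow (fromℤ (diff ab)) J)
                ≈ (factorialℕ I * factorialℕ J) * (h * g J I)
    pairing-g = begin
      ΣL (λ ab → T (size ab) * (pow (fromℤ (sum ab)) I * pow (fromℤ (diff ab)) J)) boxℕ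
        ≈⟨ ΣL-cong boxℕ (λ ab → trans (*-congˡ (*-cong (sym (exp-pow (sum ab) I)) (sym (exp-pow (diff ab) J))))
             (solve 5 (λ t f x f′ y → t :* ((f :* x) :* (f′ :* y)) := (f :* f′) :* (x :* y :* t)) refl (T (size ab)) _ _ _ _)) ⟩
      ΣL (λ ab → (factorialℕ I * factorialℕ J) * F ab) boxℕ ≈⟨ ΣL-*ˡ _ F boxℕ ⟩
      (factorialℕ I * factorialℕ J) * ΣL F boxℕ
        ≈⟨ *-congˡ (trans (sym (*-identityˡ _)) (trans (*-congʳ (sym h+h)) (solve 2 (λ h s → (h :+ h) :* s := h :* (s :+ s)) refl h (ΣL F boxℕ)))) ⟩
      (factorialℕ I * factorialℕ J) * (h * (ΣL F boxℕ + ΣL F boxℕ)) ≈⟨ *-congˡ (*-congˡ g-coeff) ⟨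
      (factorialℕ I * factorialℕ J) * (h * g J I) ∎
      where open Solver

  module _ {p p⁻¹ δ : Carrier} (hp : HasSum (λ n → sg n * T (sq n ℕ.+ sq n)) p) (unit : p⁻¹ * p ≈ 1#)
           (hδ : HasSum (λ n → 1# * T (tri n ℕ.+ tri n)) (δ + δ)) where
    private
      e₀ o₀ : Carrier
      e₀ = eᵁ 0
      o₀ = oᵁ 0

      coeff-sum : ∀ {f : ℤ → U.Carrier} {n : ℤ → ℕ} {s} → ΣU.HasSum (λ j → f j U.* Tᵁ (n j)) s → ∀ k → k ℕ.≤ D → HasSum (λ j → f j k * T (n j)) (s k)
      coeff-sum {f} {n} hs k k≤D = HasSum-cong (λ j → coeff-scalar (f j) (T (n j)) k) (S₁.coeff-HasSum hs k k≤D)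

      1≤D : 1 ℕ.≤ D
      1≤D = ℕₚ.≤-trans (s≤s z≤n) 2≤D

      inv0≈1 : inv 0 ≈ 1#
      inv0≈1 = trans (sym (*-identityʳ _)) (inverse 0)

      inv1≈h : inv 1 ≈ h
      inv1≈h = begin
        inv 1                     ≈⟨ trans (sym (*-identityʳ _)) (*-congˡ (sym h+h)) ⟩
        inv 1 * (h + h)           ≈⟨ solve 2 (λ i h → i :* (h :+ h) := (i :* con (+ 2)) :* h) refl (inv 1) h ⟩
        (inv 1 * (1# + 1#)) * h   ≈⟨ *-congʳ (inverse 1) ⟩
        1# * h                    ≈⟨ *-identityˡ h ⟩
        h                         ∎
        where open Solver

      exp-1 : ∀ n → exp n 1 ≈ fromℤ n
      exp-1 n = trans (*-cong inv0≈1 (*-identityʳ _)) (*-identityˡ _)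

      exp-2 : ∀ n → exp n 2 ≈ h * square² n
      exp-2 n = *-cong inv1≈h (*-congˡ (exp-1 n))

      he₀ : HasSum (weighted one even) e₀
      he₀ = coeff-sum (proj₂ e-sum) 0 z≤n
      ho₀ : HasSum (weighted one odd) o₀
      ho₀ = coeff-sum (proj₂ o-sum) 0 z≤n

      -- The even part e(u) is an even function of u, because j ↦ -j negates 2 j. For o(u), with
      -- frequencies 2 j - 1, the corresponding symmetry is j ↦ 1 - j.
      e₁≈0 : eᵁ 1 ≈ 0#
      e₁≈0 = odd-sum ℤ.-_ ℤₚ.neg-involutive pt (coeff-sum (proj₂ e-sum) 1 1≤D)
        where
        lem : ∀ j → (ℤ.- j) ℤ.+ (ℤ.- j) ≡ ℤ.- (j ℤ.+ j)
        lem = solve-∀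
        lem² : ∀ x → (ℤ.- x) ℤ.* (ℤ.- x) ≡ x ℤ.* x
        lem² = solve-∀
        pt : ∀ j → exp (even (ℤ.- j)) 1 * T (sq (even (ℤ.- j))) ≈ - (exp (even j) 1 * T (sq (even j)))
        pt j = trans (*-cong (trans (reflexive (≡.cong (λ n → exp n 1) (lem j))) (proj₂ (exp-neg (even j) 0)))
          (reflexive (≡.cong T (≡.trans (≡.cong sq (lem j)) (≡.cong ∣_∣ (lem² (even j))))))) (sym (-‿distribˡ-* _ _))

      o₁≈0 : oᵁ 1 ≈ 0#
      o₁≈0 = odd-sum (λ j → + 1 ℤ.- j) invol pt (coeff-sum (proj₂ o-sum) 1 1≤D)
        where
        invol : ∀ j → + 1 ℤ.- (+ 1 ℤ.- j) ≡ j
        invol = solve-∀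
        lem : ∀ j → (+ 1 ℤ.- j) ℤ.+ (+ 1 ℤ.- j) ℤ.- + 1 ≡ ℤ.- (j ℤ.+ j ℤ.- + 1)
        lem = solve-∀
        lem² : ∀ x → (ℤ.- x) ℤ.* (ℤ.- x) ≡ x ℤ.* x
        lem² = solve-∀
        pt : ∀ j → exp (odd (+ 1 ℤ.- j)) 1 * T (sq (odd (+ 1 ℤ.- j))) ≈ - (exp (odd j) 1 * T (sq (odd j)))
        pt j = trans (*-cong (trans (reflexive (≡.cong (λ n → exp n 1) (lem j))) (proj₂ (exp-neg (odd j) 0)))
          (reflexive (≡.cong T (≡.trans (≡.cong sq (lem j)) (≡.cong ∣_∣ (lem² (odd j))))))) (sym (-‿distribˡ-* _ _))

      second-moment : ∀ {f : ℤ → ℤ} {s s₂} → HasSum (λ j → exp (f j) 2 * T (sq (f j))) s → HasSum (weighted square² f) s₂ → s ≈ h * s₂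
      second-moment {f} hs hs₂ = HasSum-unique hs (HasSum-cong (λ j → trans (sym (*-assoc _ _ _)) (*-congʳ (sym (exp-2 (f j))))) (HasSum-*ˡ h hs₂))

      he₂ = theta (square² ∘ even) (sq ∘ even) ∣i∣≤1+sq-even
      ho₂ = theta (square² ∘ odd) (sq ∘ odd) ∣i∣≤1+sq-odd
      hk  = theta (λ n → sg n * fromℤ (+ 1 ℤ.+ (n ℤ.+ n))) quad ∣i∣≤1+quad
      k   = proj₁ hk
      c′  = proj₁ c′-sum

      c-family : ∀ n → n ℕ.≤ D → HasSum (λ r → exp (+ 1 ℤ.+ (r ℤ.+ r)) n * (sg r * T (quad r))) (cᵁ n)
      c-family n n≤D = HasSum-cong (λ r → coeff-scalar (exp (+ 1 ℤ.+ (r ℤ.+ r))) (sg r * T (quad r)) n)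
        (S₁.coeff-HasSum (ΣU.HasSum-cong (λ r → U.*-congˡ {exp (+ 1 ℤ.+ (r ℤ.+ r))} (U.sym (U.trans (C₀.⟦⟧-* (sg r) (T (quad r)))
          (U.*-congʳ {Tᵁ (quad r)} (C₀.⟦⟧-sg r))))) (proj₂ c-sum)) n n≤D)

      c₀≈0 : cᵁ 0 ≈ 0#
      c₀≈0 = quad-sum≈0 𝓣 (HasSum-cong (λ r → *-identityˡ _) (c-family 0 z≤n))

      c₁≈k : cᵁ 1 ≈ k
      c₁≈k = HasSum-unique (HasSum-cong (λ r → trans (*-congʳ (exp-1 (+ 1 ℤ.+ (r ℤ.+ r))))
        (solve 3 (λ x s t → x :* (s :* t) := s :* x :* t) refl _ (sg r) (T (quad r)))) (c-family 1 1≤D)) (proj₂ hk)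
        where open Solver

      κ : Carrier
      κ = e₀ * e₀ - o₀ * o₀

      κ≈pp : κ ≈ p * p
      κ≈pp = theta-square hp he₀ ho₀

      -- The pair (e, o) is transformed by the symmetric matrix with entries e₀ and - o₀, which
      -- multiplies the form e(u) e(v) - o(u) o(v) by κ = e₀² - o₀². Hence the factor κ in `c`. The
      -- choice makes a(0) = κ and b(0) = 0.
      a b c : U.Carrier
      a = C₀.⟦ e₀ ⟧ U.* eᵁ U.- C₀.⟦ o₀ ⟧ U.* oᵁ
      b = C₀.⟦ e₀ ⟧ U.* oᵁ U.- C₀.⟦ o₀ ⟧ U.* eᵁ
      c = C₀.⟦ κ ⟧ U.* (cᵁ U.* C₀.⟦ T 1 * c′ ⟧)

      combo : ∀ x y f g n → (C₀.⟦ x ⟧ U.* f U.- C₀.⟦ y ⟧ U.* g) n ≈ x * f n - y * g n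
      combo x y f g n = +-cong (S₁.conv-const x f n) (-‿cong (S₁.conv-const y g n))

      c-coeff : ∀ n → c n ≈ κ * (cᵁ n * (T 1 * c′))
      c-coeff n = trans (S₁.conv-const κ _ n) (*-congˡ (coeff-scalar cᵁ (T 1 * c′) n))

      equation : g W.* (i₁ a W.* i₂ a W.- i₁ b W.* i₂ b) W.≈ i₁ c
      equation = begin-W
        where
        open RingTools.Solver W-ring
        ε ω : W.Carrier
        ε = i₁ C₀.⟦ e₀ ⟧
        ω = i₁ C₀.⟦ o₀ ⟧
        expand₁ : ∀ x y f g → i₁ (C₀.⟦ x ⟧ U.* f U.- C₀.⟦ y ⟧ U.* g) W.≈ i₁ C₀.⟦ x ⟧ W.* i₁ f W.- i₁ C₀.⟦ y ⟧ W.* i₁ g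
        expand₁ x y f g = W.trans (i₁-- (C₀.⟦ x ⟧ U.* f) (C₀.⟦ y ⟧ U.* g)) (W.+-cong (i₁-* C₀.⟦ x ⟧ f) (W.-‿cong (i₁-* C₀.⟦ y ⟧ g)))
        expand₂ : ∀ x y f g → i₂ (C₀.⟦ x ⟧ U.* f U.- C₀.⟦ y ⟧ U.* g) W.≈ i₁ C₀.⟦ x ⟧ W.* i₂ f W.- i₁ C₀.⟦ y ⟧ W.* i₂ g
        expand₂ x y f g = W.trans (i₂-- (C₀.⟦ x ⟧ U.* f) (C₀.⟦ y ⟧ U.* g)) (W.+-cong
          (W.trans (i₂-* C₀.⟦ x ⟧ f) (W.*-congʳ {i₂ f} (W.sym (scalar₁₂ x))))
          (W.-‿cong (W.trans (i₂-* C₀.⟦ y ⟧ g) (W.*-congʳ {i₂ g} (W.sym (scalar₁₂ y))))))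
        κᵂ : i₁ C₀.⟦ κ ⟧ W.≈ ε W.* ε W.- ω W.* ω
        κᵂ = W.trans (i₁-cong (U.trans (C₀.⟦⟧-+ (e₀ * e₀) (- (o₀ * o₀))) (U.+-cong (C₀.⟦⟧-* e₀ e₀) (U.trans (C₀.⟦⟧-neg (o₀ * o₀)) (U.-‿cong (C₀.⟦⟧-* o₀ o₀))))))
          (W.trans (i₁-- (C₀.⟦ e₀ ⟧ U.* C₀.⟦ e₀ ⟧) (C₀.⟦ o₀ ⟧ U.* C₀.⟦ o₀ ⟧)) (W.+-cong (i₁-* C₀.⟦ e₀ ⟧ C₀.⟦ e₀ ⟧) (W.-‿cong (i₁-* C₀.⟦ o₀ ⟧ C₀.⟦ o₀ ⟧))))
        begin-W : g W.* (i₁ a W.* i₂ a W.- i₁ b W.* i₂ b) W.≈ i₁ c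
        begin-W = W.trans (W.*-congˡ {g} (W.+-cong (W.*-cong (expand₁ e₀ o₀ eᵁ oᵁ) (expand₂ e₀ o₀ eᵁ oᵁ))
                                                  (W.-‿cong (W.*-cong (expand₁ e₀ o₀ oᵁ eᵁ) (expand₂ e₀ o₀ oᵁ eᵁ)))))
          (W.trans (solve 7 (λ g ε ω x y u v → g :* ((ε :* x :- ω :* u) :* (ε :* y :- ω :* v) :- (ε :* u :- ω :* x) :* (ε :* v :- ω :* y))
                       := (ε :* ε :- ω :* ω) :* (g :* (x :* y :- u :* v))) W.refl g ε ω (i₁ eᵁ) (i₂ eᵁ) (i₁ oᵁ) (i₂ oᵁ))
          (W.trans (W.*-cong (W.sym κᵂ) (Kronecker-series hg (proj₂ c′-sum))) (W.sym (i₁-* C₀.⟦ κ ⟧ (cᵁ U.* C₀.⟦ T 1 * c′ ⟧)))))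

      α⁻¹ : Carrier
      α⁻¹ = p⁻¹ * p⁻¹

      a-unit : α⁻¹ * a 0 ≈ 1#
      a-unit = begin
        α⁻¹ * a 0                     ≈⟨ *-congˡ (trans (combo e₀ o₀ eᵁ oᵁ 0) κ≈pp) ⟩
        (p⁻¹ * p⁻¹) * (p * p)         ≈⟨ solve 2 (λ q p → (q :* q) :* (p :* p) := (q :* p) :* (q :* p)) refl p⁻¹ p ⟩
        (p⁻¹ * p) * (p⁻¹ * p)         ≈⟨ trans (*-cong unit unit) (*-identityˡ _) ⟩
        1#                            ∎
        where open Solver

      ord-b : S₁.Ord 2 b
      ord-b zero          _ _ = trans (combo e₀ o₀ oᵁ eᵁ 0) (trans (+-congʳ (*-comm e₀ o₀)) (-‿inverseʳ _))
      ord-b (suc zero)    _ _ = trans (combo e₀ o₀ oᵁ eᵁ 1) (trans (+-cong (trans (*-congˡ o₁≈0) (zeroʳ _)) (-‿cong (trans (*-congˡ e₁≈0) (zeroʳ _)))) (-‿inverseʳ 0#))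
      ord-b (suc (suc n)) (s≤s (s≤s ())) _

      ord-c : S₁.Ord 1 c
      ord-c zero    _ _ = trans (c-coeff 0) (trans (*-congˡ (trans (*-congʳ c₀≈0) (zeroˡ _))) (zeroʳ _))
      ord-c (suc n) (s≤s ()) _

      k≈2c′ : k ≈ c′ + c′
      k≈2c′ = η₄-half (proj₂ hk) (proj₂ c′-sum)

      -- Jacobi's formula at the nome t² reads 2 η(t⁴) = φ⁻(t²) ψ(t²)². Here η(t⁴) = 2 c′ and ψ(t²)
      -- = 2 δ, so both sides carry a factor 4.
      c′≈ : c′ ≈ p * (δ * δ)
      c′≈ = double-cancel (double-cancel (trans (sym (+-cong k≈2c′ k≈2c′)) (trans
        (Jacobi-derivative₂ (square 𝓣) hp hδ (proj₂ hk))
        (solve 2 (λ p d → p :* ((d :+ d) :* (d :+ d)) := (p :* (d :* d) :+ p :* (d :* d)) :+ (p :* (d :* d) :+ p :* (d :* d))) refl p δ))))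
        where open Solver

      -- The 1/2 in exp, the 2 in `wronskian` and k² = 4 c′² cancel.
      b₂≈ : b 2 ≈ T 1 * (c′ * c′)
      b₂≈ = begin
        b 2                         ≈⟨ combo e₀ o₀ oᵁ eᵁ 2 ⟩
        e₀ * oᵁ 2 - o₀ * eᵁ 2       ≈⟨ +-cong (*-congˡ (second-moment {odd} (coeff-sum (proj₂ o-sum) 2 2≤D) (proj₂ ho₂)))
                                              (-‿cong (*-congˡ (second-moment {even} (coeff-sum (proj₂ e-sum) 2 2≤D) (proj₂ he₂)))) ⟩
        e₀ * (h * o₂) - o₀ * (h * e₂)  ≈⟨ trans (sym (*-identityˡ _)) (*-congʳ (sym h+h)) ⟩
        (h + h) * (e₀ * (h * o₂) - o₀ * (h * e₂))
          ≈⟨ solve 5 (λ h e o e₂ o₂ → (h :+ h) :* (e :* (h :* o₂) :- o :* (h :* e₂)) := (h :* h) :* ((o₂ :* e :- o :* e₂) :+ (o₂ :* e :- o :* e₂))) refl h e₀ o₀ e₂ o₂ ⟩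
        (h * h) * ((o₂ * e₀ - o₀ * e₂) + (o₂ * e₀ - o₀ * e₂)) ≈⟨ *-congˡ (wronskian (proj₂ hk) he₀ (proj₂ he₂) ho₀ (proj₂ ho₂)) ⟨
        (h * h) * (T 1 * (k * k))   ≈⟨ *-congˡ (*-congˡ (*-cong k≈2c′ k≈2c′)) ⟩
        (h * h) * (T 1 * ((c′ + c′) * (c′ + c′)))
          ≈⟨ solve 3 (λ h t c → (h :* h) :* (t :* ((c :+ c) :* (c :+ c))) := ((h :+ h) :* (h :+ h)) :* (t :* (c :* c))) refl h (T 1) c′ ⟩
        ((h + h) * (h + h)) * (T 1 * (c′ * c′)) ≈⟨ trans (*-congʳ (trans (*-cong h+h h+h) (*-identityˡ _))) (*-identityˡ _) ⟩
        T 1 * (c′ * c′) ∎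
        where
        open Solver
        e₂ = proj₁ he₂
        o₂ = proj₁ ho₂

    -- t Δ⁴
    y : Carrier
    y = T 1 * ((δ * δ) * (δ * δ))

    private
      b₂α⁻¹ : b 2 * α⁻¹ ≈ y
      b₂α⁻¹ = begin
        b 2 * α⁻¹                        ≈⟨ *-congʳ (trans b₂≈ (*-congˡ (*-cong c′≈ c′≈))) ⟩
        T 1 * ((p * (δ * δ)) * (p * (δ * δ))) * (p⁻¹ * p⁻¹)
          ≈⟨ solve 4 (λ t p q d → t :* ((p :* (d :* d)) :* (p :* (d :* d))) :* (q :* q) := ((q :* p) :* (q :* p)) :* (t :* ((d :* d) :* (d :* d)))) refl (T 1) p p⁻¹ δ ⟩
        ((p⁻¹ * p) * (p⁻¹ * p)) * y      ≈⟨ trans (*-congʳ (trans (*-cong unit unit) (*-identityˡ _))) (*-identityˡ _) ⟩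
        y                                ∎
        where open Solver

      -- The coefficient c₁ is p² times 2 p δ² times t p δ², so every power of p cancels and only t
      -- δ⁴ is left.
      c₁α⁻² : (c 1 * α⁻¹) * α⁻¹ ≈ y + y
      c₁α⁻² = begin
        (c 1 * α⁻¹) * α⁻¹   ≈⟨ *-congʳ (*-congʳ (trans (c-coeff 1) (*-cong κ≈pp (*-cong (trans c₁≈k (trans k≈2c′ (+-cong c′≈ c′≈))) (*-congˡ c′≈))))) ⟩
        (((p * p) * ((p * (δ * δ) + p * (δ * δ)) * (T 1 * (p * (δ * δ))))) * (p⁻¹ * p⁻¹)) * (p⁻¹ * p⁻¹)
          ≈⟨ solve 4 (λ t p q d → (((p :* p) :* ((p :* (d :* d) :+ p :* (d :* d)) :* (t :* (p :* (d :* d))))) :* (q :* q)) :* (q :* q)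
               := (((q :* p) :* (q :* p)) :* ((q :* p) :* (q :* p))) :* (t :* ((d :* d) :* (d :* d)) :+ t :* ((d :* d) :* (d :* d)))) refl (T 1) p p⁻¹ δ ⟩
        (((p⁻¹ * p) * (p⁻¹ * p)) * ((p⁻¹ * p) * (p⁻¹ * p))) * (y + y)
          ≈⟨ trans (*-congʳ (trans (*-cong (trans (*-cong unit unit) (*-identityˡ _)) (trans (*-cong unit unit) (*-identityˡ _))) (*-identityˡ _))) (*-identityˡ _) ⟩
        y + y ∎
        where open Solver

      module Φ = Factorisation {a} {b} {c} {g} {α⁻¹} a-unit ord-b ord-c equation

      -- `integral-det-LU` asks for triangular matrices at all indices, whereas the orders of `Φ.L`
      -- and `Φ.U′` yield zeros only up to degree `D`. So the entries are cut off here, which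
      -- changes nothing for indices below m. The factor 1/2 of `pairing-g` is put into `L`.
      L Υ : ℕ → ℕ → Carrier
      L i k = pick (k ℕ.≤? i) ((h * factorialℕ (suc (i ℕ.* 2))) * Φ.L k (suc (i ℕ.* 2)))
      Υ k j = pick (k ℕ.≤? j) (factorialℕ (j ℕ.* 2) * Φ.U′ k (j ℕ.* 2))

    double-factorials : ℕ → Carrier
    double-factorials k = factorialℕ (suc (k ℕ.* 2)) * factorialℕ (k ℕ.* 2)

    moment-determinant : ∀ m → m ℕ.* 2 ℕ.≤ D →
      integral (T ∘ size) boxℕ m (λ zs → det zs (seg (λ i ab → pow (fromℤ (sum ab)) (suc (i ℕ.* 2))) 0 m)
                                       * det zs (seg (λ j ab → pow (fromℤ (diff ab)) (j ℕ.* 2)) 0 m))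
      ≈ prodFrom (λ k → double-factorials k * pow y (suc (k ℕ.* 2))) 0 m * factorial m
    moment-determinant m m≤D = trans
      (integral-det-LU (T ∘ size) boxℕ _ _ L Υ m
        (λ i k i<k → pick-no (k ℕ.≤? i) (ℕₚ.<⇒≱ i<k)) (λ k j j<k → pick-no (k ℕ.≤? j) (ℕₚ.<⇒≱ j<k)) matrix)
      (*-congʳ (prod-cong 0 m ℕₚ.≤-refl))
      where
      i-bound : ∀ {i} → i ℕ.< m → suc (i ℕ.* 2) ℕ.≤ D
      i-bound {i} i<m = ℕₚ.≤-trans (ℕₚ.n≤1+n _) (ℕₚ.≤-trans (ℕₚ.*-monoˡ-≤ 2 i<m) m≤D)
      j-bound : ∀ {j} → j ℕ.< m → j ℕ.* 2 ℕ.≤ D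
      j-bound j<m = ℕₚ.≤-trans (ℕₚ.n≤1+n _) (i-bound j<m)
      L-value : ∀ i k → i ℕ.< m → L i k ≈ (h * factorialℕ (suc (i ℕ.* 2))) * Φ.L k (suc (i ℕ.* 2))
      L-value i k i<m with k ℕ.≤? i
      ... | yes _  = refl
      ... | no k≰i = sym (trans (*-congˡ (Φ.ord-L k (suc (i ℕ.* 2)) (s≤s (ℕₚ.*-monoˡ-< 2 (ℕₚ.≰⇒> k≰i))) (i-bound i<m))) (zeroʳ _))
      Υ-value : ∀ k j → j ℕ.< m → Υ k j ≈ factorialℕ (j ℕ.* 2) * Φ.U′ k (j ℕ.* 2)
      Υ-value k j j<m with k ℕ.≤? j
      ... | yes _  = refl
      ... | no k≰j = sym (trans (*-congˡ (Φ.ord-U k (j ℕ.* 2) (ℕₚ.*-monoˡ-< 2 (ℕₚ.≰⇒> k≰j)) (j-bound j<m))) (zeroʳ _))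
      matrix : ∀ i j → i ℕ.< m → j ℕ.< m →
        pairing (T ∘ size) boxℕ (λ ab → pow (fromℤ (sum ab)) (suc (i ℕ.* 2))) (λ ab → pow (fromℤ (diff ab)) (j ℕ.* 2))
        ≈ ΣL (λ k → L i k * Υ k j) (seg id 0 m)
      matrix i j i<m j<m = begin
        _ ≈⟨ pairing-g i j (i-bound i<m) (j-bound j<m) ⟩
        (factorialℕ (suc (i ℕ.* 2)) * factorialℕ (j ℕ.* 2)) * (h * g (j ℕ.* 2) (suc (i ℕ.* 2)))
          ≈⟨ *-congˡ (*-congˡ (Φ.factorisation m (i-bound i<m) (j-bound j<m) (ℕₚ.*-monoˡ-< 2 j<m))) ⟩
        (factorialℕ (suc (i ℕ.* 2)) * factorialℕ (j ℕ.* 2)) * (h * ΣL (λ k → Φ.L k (suc (i ℕ.* 2)) * Φ.U′ k (j ℕ.* 2)) (seg id 0 m))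
          ≈⟨ trans (sym (*-assoc _ _ _)) (sym (ΣL-*ˡ _ _ (seg id 0 m))) ⟩
        ΣL (λ k → ((factorialℕ (suc (i ℕ.* 2)) * factorialℕ (j ℕ.* 2)) * h) * (Φ.L k (suc (i ℕ.* 2)) * Φ.U′ k (j ℕ.* 2))) (seg id 0 m)
          ≈⟨ ΣL-cong (seg id 0 m) (λ k → trans
               (solve 5 (λ f f′ h l u → ((f :* f′) :* h) :* (l :* u) := ((h :* f) :* l) :* (f′ :* u)) refl (factorialℕ (suc (i ℕ.* 2))) (factorialℕ (j ℕ.* 2)) h _ _)
               (sym (*-cong (L-value i k i<m) (Υ-value k j j<m)))) ⟩
        ΣL (λ k → L i k * Υ k j) (seg id 0 m) ∎
        where open Solver
      -- Up to the factorials the leading coefficients give y^(2k) c₁ α⁻² / 2, and c₁ α⁻² = 2 y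
      -- supplies the last factor y.
      diagonal : ∀ k → k ℕ.< m → L k k * Υ k k ≈ double-factorials k * pow y (suc (k ℕ.* 2))
      diagonal k k<m = begin
        L k k * Υ k k ≈⟨ *-cong (L-value k k k<m) (Υ-value k k k<m) ⟩
        ((h * F) * Φ.L k (suc (k ℕ.* 2))) * (F′ * Φ.U′ k (k ℕ.* 2))
          ≈⟨ *-cong (*-congˡ (trans (Φ.lead-L k (i-bound k<m)) (*-congˡ (pow-cong k b₂α⁻¹))))
                    (*-congˡ (trans (Φ.lead-U k (j-bound k<m)) (*-congˡ (pow-cong k b₂α⁻¹)))) ⟩
        ((h * F) * ((c 1 * α⁻¹) * pow y k)) * (F′ * (α⁻¹ * pow y k))
          ≈⟨ solve 6 (λ h f f′ c q y → ((h :* f) :* (c :* y)) :* (f′ :* (q :* y)) := (f :* f′) :* ((h :* (c :* q)) :* (y :* y))) refl h F F′ (c 1 * α⁻¹) α⁻¹ (pow y k) ⟩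
        (F * F′) * ((h * ((c 1 * α⁻¹) * α⁻¹)) * (pow y k * pow y k))
          ≈⟨ *-congˡ (*-cong (trans (*-congˡ c₁α⁻²) (trans (solve 2 (λ h y → h :* (y :+ y) := (h :+ h) :* y) refl h y) (trans (*-congʳ h+h) (*-identityˡ y))))
               (trans (sym (pow-+ y k k)) (reflexive (≡.cong (pow y) (twice k))))) ⟩
        (F * F′) * (y * pow y (k ℕ.* 2)) ∎
        where
        open Solver
        F  = factorialℕ (suc (k ℕ.* 2))
        F′ = factorialℕ (k ℕ.* 2)
        twice : ∀ k → k ℕ.+ k ≡ k ℕ.* 2
        twice k = ≡.trans (≡.cong (k ℕ.+_) (≡.sym (ℕₚ.+-identityʳ k))) (ℕₚ.*-comm 2 k)
      prod-cong : ∀ k n → k ℕ.+ n ℕ.≤ m → prodFrom (λ k → L k k * Υ k k) k n ≈ prodFrom (λ k → double-factorials k * pow y (suc (k ℕ.* 2))) k n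
      prod-cong k zero    _  = refl
      prod-cong k (suc n) le = *-cong (diagonal k (ℕₚ.≤-trans (s≤s (ℕₚ.m≤m+n k n)) le′)) (prod-cong (suc k) n le′)
        where le′ = ≡.subst (ℕ._≤ m) (ℕₚ.+-suc k n) le

-- Coefficients of the two sides

ℚ-ring : CommutativeRing 0ℓ 0ℓ
ℚ-ring = ℚₚ.+-*-commutativeRing

module RationalNumbers where
  open CommutativeRing ℚ-ring
  open RingTools ℚ-ring
  open ≡.≡-Reasoning

  private
    toℚᵘ-/1 : ∀ n → ℚ.toℚᵘ (fromℕ n) ℚᵘ.≃ mkℚᵘ (+ n) 0
    toℚᵘ-/1 n = ℚₚ.toℚᵘ-fromℚᵘ (mkℚᵘ (+ n) 0)

  fromℕ-suc : ∀ n → fromℕ (suc n) ≡ 1ℚ ℚ.+ fromℕ n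
  fromℕ-suc n = ℚₚ.toℚᵘ-injective (ℚᵘₚ.≃-trans (toℚᵘ-/1 (suc n)) (ℚᵘₚ.≃-sym (ℚᵘₚ.≃-trans (ℚₚ.toℚᵘ-homo-+ 1ℚ (fromℕ n))
    (ℚᵘₚ.≃-trans (ℚᵘₚ.+-congʳ (ℚ.toℚᵘ 1ℚ) (toℚᵘ-/1 n)) (*≡* (lem (+ n)))))))
    where
    lem : ∀ n → (+ 1 ℤ.* + 1 ℤ.+ n ℤ.* + 1) ℤ.* + 1 ≡ (+ 1 ℤ.+ n) ℤ.* + 1
    lem = solve-∀

  fromℕ≡fromℕ′ : ∀ n → fromℕ n ≡ fromℕ′ n
  fromℕ≡fromℕ′ zero    = ≡.refl
  fromℕ≡fromℕ′ (suc n) = ≡.trans (fromℕ-suc n) (≡.trans (≡.cong (λ q → 1ℚ ℚ.+ q) (fromℕ≡fromℕ′ n)) (≡.sym (fromℕ′-suc n)))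

  fromℕ-injective : ∀ m n → fromℕ m ≡ fromℕ n → m ≡ n
  fromℕ-injective m n eq with ℚᵘₚ.≃-trans (ℚᵘₚ.≃-sym (toℚᵘ-/1 m)) (ℚᵘₚ.≃-trans (ℚᵘₚ.≃-reflexive (≡.cong ℚ.toℚᵘ eq)) (toℚᵘ-/1 n))
  ... | *≡* p = ℤₚ.+-injective (≡.trans (≡.sym (ℤₚ.*-identityʳ (+ m))) (≡.trans p (ℤₚ.*-identityʳ (+ n))))

  /-inverse : ∀ a d c .{{_ : NonZero d}} → a ℕ.* c ≡ d → ((+ a) ℚ./ d) ℚ.* fromℕ c ≡ 1ℚ
  /-inverse a (suc d) c eq = ℚₚ.toℚᵘ-injective (ℚᵘₚ.≃-trans (ℚₚ.toℚᵘ-homo-* ((+ a) ℚ./ suc d) (fromℕ c))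
    (ℚᵘₚ.≃-trans (ℚᵘₚ.*-cong (ℚₚ.toℚᵘ-fromℚᵘ (mkℚᵘ (+ a) d)) (toℚᵘ-/1 c))
      (*≡* (≡.trans (ℤₚ.*-identityʳ _) (≡.trans (≡.sym (ℤₚ.pos-* a c)) (≡.trans (≡.cong +_ eq)
        (≡.sym (≡.trans (ℤₚ.*-identityˡ _) (≡.cong +_ (ℕₚ.*-identityʳ (suc d)))))))))))

  inv-ℚ : ℕ → ℚ
  inv-ℚ k = (+ 1) ℚ./ suc k

  inv-ℚ-inverse : ∀ k → inv-ℚ k ℚ.* fromℕ′ (suc k) ≡ 1ℚ
  inv-ℚ-inverse k = ≡.trans (≡.cong (inv-ℚ k ℚ.*_) (≡.sym (fromℕ≡fromℕ′ (suc k)))) (/-inverse 1 (suc k) (suc k) (ℕₚ.*-identityˡ (suc k)))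

  half-sum : ∀ a b → half a ℚ.+ half b ≡ fromℤ (+ suc (a ℕ.+ b))
  half-sum a b = begin
    (fromℕ a ℚ.+ ½) ℚ.+ (fromℕ b ℚ.+ ½)     ≡⟨ ≡.cong₂ (λ x y → (x ℚ.+ ½) ℚ.+ (y ℚ.+ ½)) (fromℕ≡fromℕ′ a) (fromℕ≡fromℕ′ b) ⟩
    (fromℕ′ a ℚ.+ ½) ℚ.+ (fromℕ′ b ℚ.+ ½)   ≡⟨ solve 3 (λ a b h → (a :+ h) :+ (b :+ h) := (h :+ h) :+ (a :+ b)) ≡.refl (fromℕ′ a) (fromℕ′ b) ½ ⟩
    1ℚ ℚ.+ (fromℕ′ a ℚ.+ fromℕ′ b)          ≡⟨ ≡.cong (λ s → 1ℚ ℚ.+ s) (≡.sym (fromℕ′-+ a b)) ⟩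
    1ℚ ℚ.+ fromℕ′ (a ℕ.+ b)                 ≡⟨ fromℕ′-suc (a ℕ.+ b) ⟨
    fromℕ′ (suc (a ℕ.+ b))                  ∎
    where open Solver using (solve; _:+_; _:=_)

  half-difference : ∀ a b → half a ℚ.- half b ≡ fromℤ (+ a ℤ.- + b)
  half-difference a b = begin
    (fromℕ a ℚ.+ ½) ℚ.- (fromℕ b ℚ.+ ½)     ≡⟨ ≡.cong₂ (λ x y → (x ℚ.+ ½) ℚ.- (y ℚ.+ ½)) (fromℕ≡fromℕ′ a) (fromℕ≡fromℕ′ b) ⟩
    (fromℕ′ a ℚ.+ ½) ℚ.- (fromℕ′ b ℚ.+ ½)   ≡⟨ solve 3 (λ a b h → (a :+ h) :- (b :+ h) := a :- b) ≡.refl (fromℕ′ a) (fromℕ′ b) ½ ⟩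
    fromℕ′ a ℚ.- fromℕ′ b                   ≡⟨ ≡.cong (λ s → fromℕ′ a ℚ.+ s) (≡.sym (fromℤ-neg (+ b))) ⟩
    fromℤ (+ a) ℚ.+ fromℤ (ℤ.- + b)         ≡⟨ fromℤ-+ (+ a) (ℤ.- + b) ⟨
    fromℤ (+ a ℤ.- + b)                     ∎
    where open Solver using (solve; _:+_; _:-_; _:=_)

  half-product : ∀ a b → fromℕ 4 ℚ.* (half a ℚ.* half b) ≡ fromℕ′ (suc (a ℕ.+ a) ℕ.* suc (b ℕ.+ b))
  half-product a b = begin
    fromℕ 4 ℚ.* ((fromℕ a ℚ.+ ½) ℚ.* (fromℕ b ℚ.+ ½))
      ≡⟨ ≡.cong₂ (λ x y → fromℕ 4 ℚ.* ((x ℚ.+ ½) ℚ.* (y ℚ.+ ½))) (fromℕ≡fromℕ′ a) (fromℕ≡fromℕ′ b) ⟩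
    fromℕ 4 ℚ.* ((fromℕ′ a ℚ.+ ½) ℚ.* (fromℕ′ b ℚ.+ ½))
      ≡⟨ solve 3 (λ a b h → con (+ 4) :* ((a :+ h) :* (b :+ h)) := ((h :+ h) :+ (a :+ a)) :* ((h :+ h) :+ (b :+ b))) ≡.refl (fromℕ′ a) (fromℕ′ b) ½ ⟩
    (1ℚ ℚ.+ (fromℕ′ a ℚ.+ fromℕ′ a)) ℚ.* (1ℚ ℚ.+ (fromℕ′ b ℚ.+ fromℕ′ b))
      ≡⟨ ≡.cong₂ ℚ._*_ (fold a) (fold b) ⟩
    fromℕ′ (suc (a ℕ.+ a)) ℚ.* fromℕ′ (suc (b ℕ.+ b))   ≡⟨ fromℕ′-* (suc (a ℕ.+ a)) (suc (b ℕ.+ b)) ⟨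
    fromℕ′ (suc (a ℕ.+ a) ℕ.* suc (b ℕ.+ b))            ∎
    where
    open Solver using (solve; con; _:+_; _:*_; _:=_)
    fold : ∀ a → 1ℚ ℚ.+ (fromℕ′ a ℚ.+ fromℕ′ a) ≡ fromℕ′ (suc (a ℕ.+ a))
    fold a = ≡.trans (≡.cong (λ s → 1ℚ ℚ.+ s) (≡.sym (fromℕ′-+ a a))) (≡.sym (fromℕ′-suc (a ℕ.+ a)))

open RationalNumbers public

module BoxSums (N : ℕ) where
  open CommutativeRing ℚ-ring using (+-assoc; +-comm)
  open RingTools ℚ-ring
  open Summation ℚ-ring
  open Alternating ℚ-ring
  open ≡.≡-Reasoning

  sumTo≡ΣL : ∀ n (f : ℕ → ℚ) → sumTo n f ≡ ΣL f (upTo (suc n))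
  sumTo≡ΣL zero    f = ≡.sym (ℚₚ.+-identityʳ (f 0))
  sumTo≡ΣL (suc n) f = begin
    sumTo n f ℚ.+ f (suc n)                        ≡⟨ ≡.cong₂ ℚ._+_ (sumTo≡ΣL n f) (≡.sym (ℚₚ.+-identityʳ (f (suc n)))) ⟩
    ΣL f (upTo (suc n)) ℚ.+ ΣL f (suc n ∷ [])      ≡⟨ ΣL-++ f (upTo (suc n)) (suc n ∷ []) ⟨
    ΣL f (upTo (suc n) ++ suc n ∷ [])              ≡⟨ ≡.cong (ΣL f) (Lₚ.upTo-∷ʳ (suc n)) ⟩
    ΣL f (upTo (suc (suc n)))                      ∎

  private
    range : List ℕ
    range = upTo (suc N)

  box : List (ℕ × ℕ)
  box = cartesianProduct range range

  unit-weight : ℕ × ℕ → ℚ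
  unit-weight _ = 1ℚ

  sumBox-cong : ∀ m {f g : Vec ℕ m → ℚ} → (∀ v → f v ≡ g v) → sumBox m N f ≡ sumBox m N g
  sumBox-cong zero    f≡g = f≡g []
  sumBox-cong (suc m) f≡g = ≡.trans (sumTo≡ΣL N _) (≡.trans (ΣL-cong range (λ a → sumBox-cong m (λ v → f≡g (a ∷ v)))) (≡.sym (sumTo≡ΣL N _)))

  sumBox-ΣL : ∀ m {I : Set} (f : Vec ℕ m → I → ℚ) (xs : List I) →
              sumBox m N (λ v → ΣL (f v) xs) ≡ ΣL (λ i → sumBox m N (λ v → f v i)) xs
  sumBox-ΣL zero    f xs = ≡.refl
  sumBox-ΣL (suc m) f xs = begin
    sumTo N (λ a → sumBox m N (λ v → ΣL (f (a ∷ v)) xs))          ≡⟨ sumTo≡ΣL N _ ⟩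
    ΣL (λ a → sumBox m N (λ v → ΣL (f (a ∷ v)) xs)) range         ≡⟨ ΣL-cong range (λ a → sumBox-ΣL m (λ v → f (a ∷ v)) xs) ⟩
    ΣL (λ a → ΣL (λ i → sumBox m N (λ v → f (a ∷ v) i)) xs) range ≡⟨ ΣL-swap _ range xs ⟩
    ΣL (λ i → ΣL (λ a → sumBox m N (λ v → f (a ∷ v) i)) range) xs ≡⟨ ΣL-cong xs (λ i → ≡.sym (sumTo≡ΣL N _)) ⟩
    ΣL (λ i → sumTo N (λ a → sumBox m N (λ v → f (a ∷ v) i))) xs  ∎

  zipL : ∀ {m} → Vec ℕ m → Vec ℕ m → List (ℕ × ℕ)
  zipL []       []       = []
  zipL (a ∷ as) (b ∷ bs) = (a , b) ∷ zipL as bs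

  -- The sums over all x_j and then all y_j are interleaved into sums over the pairs (x_j, y_j),
  -- which are the points at which the determinants are evaluated.
  sumBox-integral : ∀ m (F : List (ℕ × ℕ) → ℚ) →
    sumBox m N (λ a → sumBox m N (λ b → F (zipL a b))) ≡ integral unit-weight box m F
  sumBox-integral zero    F = ≡.refl
  sumBox-integral (suc m) F = begin
    sumTo N (λ a → sumBox m N (λ as → sumTo N (λ b → sumBox m N (λ bs → F ((a , b) ∷ zipL as bs)))))
      ≡⟨ sumTo≡ΣL N _ ⟩
    ΣL (λ a → sumBox m N (λ as → sumTo N (λ b → sumBox m N (λ bs → F ((a , b) ∷ zipL as bs))))) range
      ≡⟨ ΣL-cong range (λ a → ≡.trans (sumBox-cong m (λ as → sumTo≡ΣL N _)) (sumBox-ΣL m _ range)) ⟩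
    ΣL (λ a → ΣL (λ b → sumBox m N (λ as → sumBox m N (λ bs → F ((a , b) ∷ zipL as bs)))) range) range
      ≡⟨ ΣL-cong range (λ a → ΣL-cong range (λ b → ≡.trans (sumBox-integral m (λ zs → F ((a , b) ∷ zs))) (≡.sym (ℚₚ.*-identityˡ _)))) ⟩
    ΣL (λ a → ΣL (λ b → 1ℚ ℚ.* integral unit-weight box m (λ zs → F ((a , b) ∷ zs))) range) range
      ≡⟨ ΣL-× (λ z → 1ℚ ℚ.* integral unit-weight box m (λ zs → F (z ∷ zs))) range range ⟨
    integral unit-weight box (suc m) F ∎

  size : ℕ × ℕ → ℕ
  size (a , b) = suc (a ℕ.+ a) ℕ.* suc (b ℕ.+ b)

  energy : List (ℕ × ℕ) → ℕ
  energy []       = 0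
  energy (z ∷ zs) = size z ℕ.+ energy zs

  private
    module J = IsLinear
    open Series N ℚ-ring using (shiftₛ)

    shift-pick : ∀ n (F : List (ℕ × ℕ) → ℚ) (e : ℕ) (E : List (ℕ × ℕ) → ℕ) (G : ℕ → ℚ) →
      (∀ k → G k ≡ integral unit-weight box n (λ zs → pick (E zs == k) (F zs))) →
      ∀ k → shiftₛ e G k ≡ integral unit-weight box n (λ zs → pick (e ℕ.+ E zs == k) (F zs))
    shift-pick n F zero    E G eq k       = eq k
    shift-pick n F (suc e) E G eq zero    = ≡.sym (≡.trans (J.Φ-cong (integral-isLinear unit-weight box n) (λ zs → ≡.refl)) (J.Φ-0 (integral-isLinear unit-weight box n)))
    shift-pick n F (suc e) E G eq (suc k) = ≡.trans (shift-pick n F e E G eq k)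
      (J.Φ-cong (integral-isLinear unit-weight box n) (λ zs → pick-⇔ (e ℕ.+ E zs == k) (suc (e ℕ.+ E zs) == suc k)
        (≡.cong suc) ℕₚ.suc-injective (λ _ → ≡.refl)))

  series-ring : CommutativeRing 0ℓ 0ℓ
  series-ring = Series.seriesRing N ℚ-ring

  private
    module A = Alternating series-ring
    module S = Series N ℚ-ring

  -- Giving each point z the weight t^(size z) turns the constraint on the total energy into the
  -- extraction of a coefficient of t.
  integral-coeff : ∀ m (F : List (ℕ × ℕ) → ℚ) k →
    A.integral (S.mono ∘ size) box m (λ zs → S.const′ (F zs)) k ≡ integral unit-weight box m (λ zs → pick (energy zs == k) (F zs))
  integral-coeff zero    F zero    = ≡.refl
  integral-coeff zero    F (suc k) = ≡.refl
  integral-coeff (suc m) F k       = ≡.trans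
    (S.coeff-ΣL (λ z → S.conv (S.mono (size z)) (A.integral (S.mono ∘ size) box m (λ zs → S.const′ (F (z ∷ zs))))) box k) (ΣL-cong box (λ z → ≡.trans
    (S.conv-mono (size z) _ k) (≡.trans
    (shift-pick m (λ zs → F (z ∷ zs)) (size z) energy (A.integral (S.mono ∘ size) box m (λ zs → S.const′ (F (z ∷ zs))))
      (integral-coeff m (λ zs → F (z ∷ zs))) k)
    (≡.sym (ℚₚ.*-identityˡ _)))))

  sumℚ diffℚ : ℕ × ℕ → ℚ
  sumℚ  (a , b) = fromℤ (+ suc (a ℕ.+ b))
  diffℚ (a , b) = fromℤ (+ a ℤ.- + b)

  squareℚ : (ℕ × ℕ → ℚ) → ℕ × ℕ → ℚ
  squareℚ f z = f z ℚ.* f z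

  -- The trivial product of ones gives both factors the shape of a weighted Vandermonde determinant:
  -- weight x + y with powers of (x + y)², and weight 1 with powers of (x - y)².
  summand : List (ℕ × ℕ) → ℚ
  summand zs = (prodL sumℚ zs ℚ.* vandermonde (squareℚ sumℚ) zs) ℚ.* (prodL (λ _ → 1ℚ) zs ℚ.* vandermonde (squareℚ diffℚ) zs)

  private
    prodFin-cong : ∀ m {f g : Fin m → ℚ} → (∀ i → f i ≡ g i) → prodFin m f ≡ prodFin m g
    prodFin-cong zero    f≡g = ≡.refl
    prodFin-cong (suc m) f≡g = ≡.cong₂ ℚ._*_ (f≡g Fin.zero) (prodFin-cong m (f≡g ∘ Fin.suc))

    X Y : ∀ {m} → Vec ℕ m → Fin m → ℚ
    X a j = half (lookup a j)
    Y b j = half (lookup b j)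

    prodFin-zip : ∀ {m} (a b : Vec ℕ m) (f : ℚ → ℚ → ℚ) (g : ℕ × ℕ → ℚ) → (∀ i j → f (half i) (half j) ≡ g (i , j)) →
                  prodFin m (λ j → f (X a j) (Y b j)) ≡ prodL g (zipL a b)
    prodFin-zip []      []      f g eq = ≡.refl
    prodFin-zip (i ∷ a) (j ∷ b) f g eq = ≡.cong₂ ℚ._*_ (eq i j) (prodFin-zip a b f g eq)

    prodL-* : ∀ (f g : ℕ × ℕ → ℚ) zs → prodL (λ z → f z ℚ.* g z) zs ≡ prodL f zs ℚ.* prodL g zs
    prodL-* f g []       = ≡.refl
    prodL-* f g (z ∷ zs) = ≡.trans (≡.cong (f z ℚ.* g z ℚ.*_) (prodL-* f g zs))
      (solve 4 (λ a b c d → (a :* b) :* (c :* d) := (a :* c) :* (b :* d)) ≡.refl (f z) (g z) (prodL f zs) (prodL g zs))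
      where open Solver

    prodL-1 : ∀ (zs : List (ℕ × ℕ)) → prodL (λ _ → 1ℚ) zs ≡ 1ℚ
    prodL-1 []       = ≡.refl
    prodL-1 (z ∷ zs) = ≡.trans (ℚₚ.*-identityˡ _) (prodL-1 zs)

    factor : ℚ → ℚ → ℚ → ℚ → ℚ
    factor x y x′ y′ = ((x ℚ.- y) ℚ.* (x ℚ.- y) ℚ.- (x′ ℚ.- y′) ℚ.* (x′ ℚ.- y′)) ℚ.* ((x ℚ.+ y) ℚ.* (x ℚ.+ y) ℚ.- (x′ ℚ.+ y′) ℚ.* (x′ ℚ.+ y′))

    -- `vandermonde` subtracts the earlier point from the later one, opposite to the order in f; the
    -- two sign changes cancel.
    factor-half : ∀ a b a′ b′ → factor (half a) (half b) (half a′) (half b′)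
      ≡ (squareℚ sumℚ (a′ , b′) ℚ.- squareℚ sumℚ (a , b)) ℚ.* (squareℚ diffℚ (a′ , b′) ℚ.- squareℚ diffℚ (a , b))
    factor-half a b a′ b′ = ≡.trans (≡.cong₂ (λ d d′ → (d ℚ.* d ℚ.- d′ ℚ.* d′) ℚ.* ((half a ℚ.+ half b) ℚ.* (half a ℚ.+ half b) ℚ.- (half a′ ℚ.+ half b′) ℚ.* (half a′ ℚ.+ half b′))) (half-difference a b) (half-difference a′ b′))
      (≡.trans (≡.cong₂ (λ s s′ → (diffℚ (a , b) ℚ.* diffℚ (a , b) ℚ.- diffℚ (a′ , b′) ℚ.* diffℚ (a′ , b′)) ℚ.* (s ℚ.* s ℚ.- s′ ℚ.* s′)) (half-sum a b) (half-sum a′ b′))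
        (solve 4 (λ d d′ s s′ → (d :* d :- d′ :* d′) :* (s :* s :- s′ :* s′) := (s′ :* s′ :- s :* s) :* (d′ :* d′ :- d :* d)) ≡.refl
          (diffℚ (a , b)) (diffℚ (a′ , b′)) (sumℚ (a , b)) (sumℚ (a′ , b′))))
      where open Solver

    prodPairs : ∀ m → (Fin m → ℚ) → (Fin m → ℚ) → ℚ
    prodPairs m x y = prodFin m (λ i → prodFin m (λ j → if toℕ i ℕ.<ᵇ toℕ j then factor (x i) (y i) (x j) (y j) else 1ℚ))

    prodPairs-vandermonde : ∀ {m} (a b : Vec ℕ m) →
      prodPairs m (X a) (Y b) ≡ vandermonde (squareℚ sumℚ) (zipL a b) ℚ.* vandermonde (squareℚ diffℚ) (zipL a b)
    prodPairs-vandermonde []      []      = ≡.refl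
    prodPairs-vandermonde {suc m} (i ∷ a) (j ∷ b) = begin
      (1ℚ ℚ.* prodFin m (λ k → factor (half i) (half j) (X a k) (Y b k))) ℚ.*
        prodFin m (λ k → 1ℚ ℚ.* prodFin m (λ l → if toℕ k ℕ.<ᵇ toℕ l then factor (X a k) (Y b k) (X a l) (Y b l) else 1ℚ))
        ≡⟨ ≡.cong₂ ℚ._*_ (≡.trans (ℚₚ.*-identityˡ _) (≡.trans (prodFin-zip a b (factor (half i) (half j)) _ (factor-half i j)) (prodL-* _ _ (zipL a b))))
             (≡.trans (prodFin-cong m (λ k → ℚₚ.*-identityˡ _)) (prodPairs-vandermonde a b)) ⟩
      (prodL (λ z → S z ℚ.- S (i , j)) zs ℚ.* prodL (λ z → D z ℚ.- D (i , j)) zs) ℚ.* (vandermonde S zs ℚ.* vandermonde D zs)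
        ≡⟨ solve 4 (λ a b c d → (a :* b) :* (c :* d) := (a :* c) :* (b :* d)) ≡.refl
             (prodL (λ z → S z ℚ.- S (i , j)) zs) (prodL (λ z → D z ℚ.- D (i , j)) zs) (vandermonde S zs) (vandermonde D zs) ⟩
      (prodL (λ z → S z ℚ.- S (i , j)) zs ℚ.* vandermonde S zs) ℚ.* (prodL (λ z → D z ℚ.- D (i , j)) zs ℚ.* vandermonde D zs) ∎
      where
      open Solver
      S = squareℚ sumℚ
      D = squareℚ diffℚ
      zs = zipL a b

  fpoly-summand : ∀ {m} (a b : Vec ℕ m) → fpoly m (λ j → half (lookup a j)) (λ j → half (lookup b j)) ≡ summand (zipL a b)
  fpoly-summand {m} a b = begin
    prodFin m (λ j → X a j ℚ.+ Y b j) ℚ.* prodPairs m (X a) (Y b)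
      ≡⟨ ≡.cong₂ ℚ._*_ (prodFin-zip a b ℚ._+_ sumℚ half-sum) (prodPairs-vandermonde a b) ⟩
    prodL sumℚ zs ℚ.* (vandermonde (squareℚ sumℚ) zs ℚ.* vandermonde (squareℚ diffℚ) zs)
      ≡⟨ ℚₚ.*-assoc (prodL sumℚ zs) _ _ ⟨
    (prodL sumℚ zs ℚ.* vandermonde (squareℚ sumℚ) zs) ℚ.* vandermonde (squareℚ diffℚ) zs
      ≡⟨ ≡.cong (prodL sumℚ zs ℚ.* vandermonde (squareℚ sumℚ) zs ℚ.*_) (≡.sym (≡.trans (≡.cong (ℚ._* vandermonde (squareℚ diffℚ) zs) (prodL-1 zs)) (ℚₚ.*-identityˡ _))) ⟩
    summand zs ∎
    where zs = zipL a b

  dot-energy : ∀ {m} (a b : Vec ℕ m) → fromℕ 4 ℚ.* dot m (λ j → half (lookup a j)) (λ j → half (lookup b j)) ≡ fromℕ (energy (zipL a b))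
  dot-energy []      []      = ≡.refl
  dot-energy {suc m} (i ∷ a) (j ∷ b) = begin
    fromℕ 4 ℚ.* (half i ℚ.* half j ℚ.+ dot m (X a) (Y b))                 ≡⟨ ℚₚ.*-distribˡ-+ (fromℕ 4) (half i ℚ.* half j) (dot m (X a) (Y b)) ⟩
    fromℕ 4 ℚ.* (half i ℚ.* half j) ℚ.+ fromℕ 4 ℚ.* dot m (X a) (Y b)     ≡⟨ ≡.cong₂ ℚ._+_ (half-product i j) (≡.trans (dot-energy a b) (fromℕ≡fromℕ′ (energy (zipL a b)))) ⟩
    fromℕ′ (size (i , j)) ℚ.+ fromℕ′ (energy (zipL a b))                  ≡⟨ fromℕ′-+ (size (i , j)) (energy (zipL a b)) ⟨
    fromℕ′ (energy (zipL (i ∷ a) (j ∷ b)))                                ≡⟨ fromℕ≡fromℕ′ (energy (zipL (i ∷ a) (j ∷ b))) ⟨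
    fromℕ (energy (zipL (i ∷ a) (j ∷ b)))                                 ∎

  rhs-integral : ∀ m → rhs m N ≡ const m ℚ.* A.integral (S.mono ∘ size) box m (λ zs → S.const′ (summand zs)) N
  rhs-integral m = ≡.cong (const m ℚ.*_) (≡.trans (sumBox-cong m (λ a → sumBox-cong m (λ b → pt a b)))
    (≡.trans (sumBox-integral m (λ zs → pick (energy zs == N) (summand zs))) (≡.sym (integral-coeff m summand N))))
    where
    by : ∀ {P Q : Set} (d : Dec P) (e : Dec Q) {x y : ℚ} → (P → Q) → (Q → P) → x ≡ y → (if does d then x else 0ℚ) ≡ pick e y
    by (yes p) (yes q) pq qp x≡y = x≡y
    by (yes p) (no ¬q) pq qp x≡y = ⊥-elim (¬q (pq p))
    by (no ¬p) (yes q) pq qp x≡y = ⊥-elim (¬p (qp q))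
    by (no ¬p) (no ¬q) pq qp x≡y = ≡.refl
    pt : ∀ (a b : Vec ℕ m) → _ ≡ pick (energy (zipL a b) == N) (summand (zipL a b))
    pt a b = by (fromℕ 4 ℚ.* dot m (X a) (Y b) ℚ.≟ fromℕ N) (energy (zipL a b) == N)
      (λ eq → fromℕ-injective _ _ (≡.trans (≡.sym (dot-energy a b)) eq))
      (λ eq → ≡.trans (dot-energy a b) (≡.cong fromℕ eq)) (fpoly-summand a b)

-- Weighted Vandermonde determinants and their images

module VandermondeMinors (R : CommutativeRing 0ℓ 0ℓ) where
  open CommutativeRing R
  open RingTools R
  open Alternating R
  open import Relation.Binary.Reasoning.Setoid setoid

  private
    length = Data.List.length

  det-cong : {Z : Set} (φ ψ : ℕ → Z → Carrier) → (∀ i ζ → φ i ζ ≈ ψ i ζ) → ∀ zs is → det zs (map φ is) ≈ det zs (map ψ is)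
  det-cong φ ψ eq []       []      = refl
  det-cong φ ψ eq []       (_ ∷ _) = refl
  det-cong φ ψ eq (z ∷ zs) is      = begin
    det (z ∷ zs) (map φ is)                          ≡⟨ lap-map φ _ is ⟩
    lap (λ i is′ → φ i z * det zs (map φ is′)) is    ≈⟨ lap-cong is (λ i is′ → *-cong (eq i z) (det-cong φ ψ eq zs is′)) ⟩
    lap (λ i is′ → ψ i z * det zs (map ψ is′)) is    ≡⟨ lap-map ψ _ is ⟨
    det (z ∷ zs) (map ψ is)                          ∎

  det-weighted-vandermonde : {Z : Set} (w S : Z → Carrier) (f : ℕ → Z → Carrier) → (∀ i ζ → f i ζ ≈ w ζ * pow (S ζ) i) →
    ∀ zs → det zs (seg f 0 (length zs)) ≈ prodL w zs * vandermonde S zs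
  det-weighted-vandermonde w S f eq zs = begin
    det zs (seg f 0 n)                        ≡⟨ ≡.cong (det zs) (seg-map f id 0 n) ⟩
    det zs (map f (seg id 0 n))               ≈⟨ det-cong f (λ i ζ → w ζ * pow (S ζ) i) eq zs (seg id 0 n) ⟩
    det zs (map (λ i ζ → w ζ * pow (S ζ) i) (seg id 0 n))
      ≡⟨ ≡.cong (det zs) (≡.trans (≡.sym (seg-map (λ i ζ → w ζ * pow (S ζ) i) id 0 n)) (seg-map (λ x ζ → w ζ * x ζ) (λ i ζ → pow (S ζ) i) 0 n)) ⟩
    det zs (map (λ x ζ → w ζ * x ζ) (seg (λ i ζ → pow (S ζ) i) 0 n)) ≈⟨ det-scale w zs _ ⟩
    prodL w zs * det zs (seg (λ i ζ → pow (S ζ) i) 0 n)   ≈⟨ *-congˡ (det-vandermonde S zs) ⟩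
    prodL w zs * vandermonde S zs             ∎
    where n = length zs

  -- The length of `zs` is made available because a Vandermonde determinant has as many columns as
  -- points.
  integral-cong : {Z : Set} (μ : Z → Carrier) (dom : List Z) → ∀ n {f g : List Z → Carrier} →
    (∀ zs → length zs ≡ n → f zs ≈ g zs) → integral μ dom n f ≈ integral μ dom n g
  integral-cong μ dom zero    eq = eq [] ≡.refl
  integral-cong μ dom (suc n) eq = Summation.ΣL-cong R dom (λ z → *-congˡ (integral-cong μ dom n (λ zs len → eq (z ∷ zs) (≡.cong suc len))))

  pow-even : ∀ x i → pow x (i ℕ.* 2) ≈ 1# * pow (x * x) i
  pow-even x zero    = sym (*-identityˡ _)
  pow-even x (suc i) = trans (*-congˡ (*-congˡ (pow-even x i)))
    (solve 2 (λ x p → x :* (x :* (con (+ 1) :* p)) := con (+ 1) :* ((x :* x) :* p)) refl x _)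
    where open Solver

  pow-odd : ∀ x i → pow x (suc (i ℕ.* 2)) ≈ x * pow (x * x) i
  pow-odd x i = *-congˡ (trans (pow-even x i) (*-identityˡ _))

  pow-fourth : ∀ x n → pow ((x * x) * (x * x)) n ≈ pow x (n ℕ.* 4)
  pow-fourth x zero    = refl
  pow-fourth x (suc n) = trans (*-congˡ (pow-fourth x n))
    (solve 2 (λ x p → ((x :* x) :* (x :* x)) :* p := x :* (x :* (x :* (x :* p)))) refl x _)
    where open Solver

  prodFrom-snoc : ∀ c k n → prodFrom c k (suc n) ≈ prodFrom c k n * c (k ℕ.+ n)
  prodFrom-snoc c k zero    = trans (*-comm _ _) (*-congˡ (reflexive (≡.cong c (≡.sym (ℕₚ.+-identityʳ k)))))
  prodFrom-snoc c k (suc n) = trans (*-congˡ (prodFrom-snoc c (suc k) n)) (trans (sym (*-assoc _ _ _))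
    (*-congˡ (reflexive (≡.cong c (≡.sym (ℕₚ.+-suc k n))))))

module _ {R R′ : CommutativeRing 0ℓ 0ℓ} (ι : RingHom R R′) {Z : Set} where
  private
    module R  = CommutativeRing R
    module R′ = CommutativeRing R′
    module A  = Alternating R
    module A′ = Alternating R′
  open RingHom ι

  ⟦⟧-prodL : (f : Z → R.Carrier) (zs : List Z) → ⟦ A.prodL f zs ⟧ R′.≈ A′.prodL (λ z → ⟦ f z ⟧) zs
  ⟦⟧-prodL f []       = ⟦⟧-1
  ⟦⟧-prodL f (z ∷ zs) = R′.trans (⟦⟧-* _ _) (R′.*-congˡ (⟦⟧-prodL f zs))

  private
    prodL-cong : {f g : Z → R′.Carrier} → (∀ z → f z R′.≈ g z) → ∀ zs → A′.prodL f zs R′.≈ A′.prodL g zs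
    prodL-cong eq []       = R′.refl
    prodL-cong eq (z ∷ zs) = R′.*-cong (eq z) (prodL-cong eq zs)

  image-prodL : (f : Z → R.Carrier) {g : Z → R′.Carrier} → (∀ z → ⟦ f z ⟧ R′.≈ g z) → ∀ zs → ⟦ A.prodL f zs ⟧ R′.≈ A′.prodL g zs
  image-prodL f eq zs = R′.trans (⟦⟧-prodL f zs) (prodL-cong eq zs)

  image-vandermonde : (f : Z → R.Carrier) {g : Z → R′.Carrier} → (∀ z → ⟦ f z ⟧ R′.≈ g z) → ∀ zs → ⟦ A.vandermonde f zs ⟧ R′.≈ A′.vandermonde g zs
  image-vandermonde f eq []       = ⟦⟧-1
  image-vandermonde f eq (z ∷ zs) = R′.trans (⟦⟧-* _ _) (R′.*-cong
    (image-prodL _ (λ ζ → R′.trans (⟦⟧-+ _ _) (R′.+-cong (eq ζ) (R′.trans (⟦⟧-neg _) (R′.-‿cong (eq z))))) zs)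
    (image-vandermonde f eq zs))

-- The constant of the theorem

weight : ℕ → ℕ
weight zero    = 1
weight (suc m) = weight m ℕ.* (suc (m ℕ.* 2) ! ℕ.* (m ℕ.* 2) !)

-- From m to m + 1 the left side gains 2 (2m + 2) (2m + 1) (2m + 1)! (2m)! (m + 1). The factors 2
-- and m + 1 form a second 2m + 2, which completes (2m + 2)!².
weight-denom : ∀ m → (2 ℕ.^ m ℕ.* (2 ℕ.* m) !) ℕ.* (weight m ℕ.* m !) ≡ denom m
weight-denom zero    = ≡.refl
weight-denom (suc m) rewrite ℕₚ.*-comm m 2 | ℕₚ.+-suc m (m ℕ.+ 0) = ≡.trans
  (lem m (2 ℕ.^ m) ((2 ℕ.* m) !) (weight m) (m !))
  (≡.cong (((2 ℕ.+ 2 ℕ.* m) ℕ.* ((1 ℕ.+ 2 ℕ.* m) ℕ.* (2 ℕ.* m) !)) ℕ.* ((2 ℕ.+ 2 ℕ.* m) ℕ.* ((1 ℕ.+ 2 ℕ.* m) ℕ.* (2 ℕ.* m) !)) ℕ.*_) (weight-denom m))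
  where
  lem : ∀ m p F w f → (2 ℕ.* p ℕ.* ((2 ℕ.+ 2 ℕ.* m) ℕ.* ((1 ℕ.+ 2 ℕ.* m) ℕ.* F))) ℕ.* (w ℕ.* (((1 ℕ.+ 2 ℕ.* m) ℕ.* F) ℕ.* F) ℕ.* ((1 ℕ.+ m) ℕ.* f))
        ≡ ((2 ℕ.+ 2 ℕ.* m) ℕ.* ((1 ℕ.+ 2 ℕ.* m) ℕ.* F)) ℕ.* ((2 ℕ.+ 2 ℕ.* m) ℕ.* ((1 ℕ.+ 2 ℕ.* m) ℕ.* F)) ℕ.* ((p ℕ.* F) ℕ.* (w ℕ.* f))
  lem = Data.Nat.Tactic.RingSolver.solve-∀

-- Specialisation to rational power series modulo t^(N+1)

module PowerSeriesOverℚ (N : ℕ) where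
  open BoxSums N using (series-ring)
  open CommutativeRing series-ring
  open RingTools series-ring using (pow)
  private
    module S = Series N ℚ-ring
  open ≡.≡-Reasoning

  sumTo-suc : ∀ n (f : ℕ → ℚ) → sumTo (suc n) f ≡ f 0 ℚ.+ sumTo n (f ∘ suc)
  sumTo-suc zero    f = ≡.refl
  sumTo-suc (suc n) f = ≡.trans (≡.cong (ℚ._+ f (suc (suc n))) (sumTo-suc n f)) (ℚₚ.+-assoc (f 0) _ _)

  ⊛≡conv : ∀ f g n → (f ⊛ g) n ≡ S.conv f g n
  ⊛≡conv f g zero    = ≡.refl
  ⊛≡conv f g (suc n) = ≡.trans (sumTo-suc n _) (≡.cong (λ s → f 0 ℚ.* g (suc n) ℚ.+ s) (⊛≡conv (f ∘ suc) g n))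

  ^ₚ≡pow : ∀ f e n → (f ^ₚ e) n ≡ pow f e n
  ^ₚ≡pow f zero    zero    = ≡.refl
  ^ₚ≡pow f zero    (suc n) = ≡.refl
  ^ₚ≡pow f (suc e) n       = ≡.trans (⊛≡conv f (f ^ₚ e) n) (S.conv-cong n (λ _ _ → ≡.refl) (λ k _ → ^ₚ≡pow f e k))

  shift≡shiftₛ : ∀ s f n → shift s f n ≡ S.shiftₛ s f n
  shift≡shiftₛ zero    f n       = ≡.refl
  shift≡shiftₛ (suc s) f zero    = ≡.refl
  shift≡shiftₛ (suc s) f (suc n) = shift≡shiftₛ s f n

  lhs≡ : ∀ m n → lhs m n ≡ (S.mono (m ℕ.* m) * pow triangle (4 ℕ.* (m ℕ.* m))) n
  lhs≡ m n = begin
    shift (m ℕ.* m) (triangle ^ₚ (4 ℕ.* (m ℕ.* m))) n         ≡⟨ shift≡shiftₛ (m ℕ.* m) _ n ⟩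
    S.shiftₛ (m ℕ.* m) (triangle ^ₚ (4 ℕ.* (m ℕ.* m))) n      ≡⟨ S.shiftₛ-cong (m ℕ.* m) n (^ₚ≡pow triangle (4 ℕ.* (m ℕ.* m))) ⟩
    S.shiftₛ (m ℕ.* m) (pow triangle (4 ℕ.* (m ℕ.* m))) n     ≡⟨ S.conv-mono (m ℕ.* m) _ n ⟨
    (S.mono (m ℕ.* m) * pow triangle (4 ℕ.* (m ℕ.* m))) n     ∎

  mono-coeff : ∀ j k → S.mono j k ≡ (if j ℕ.≡ᵇ k then 1ℚ else 0ℚ)
  mono-coeff zero    zero    = ≡.refl
  mono-coeff zero    (suc k) = ≡.refl
  mono-coeff (suc j) zero    = ≡.refl
  mono-coeff (suc j) (suc k) = mono-coeff j k

  mono-null : ∀ k → suc N ℕ.≤ k → S.mono k ≈ 0#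
  mono-null k N<k j j≤N = S.shiftₛ-< k _ j (ℕₚ.<-≤-trans (s≤s j≤N) N<k)

  private
    h : Carrier
    h = S.const′ ½

    h+h : h + h ≈ 1#
    h+h zero    _ = ≡.refl
    h+h (suc k) _ = ≡.refl

    ι : RingHom ℚ-ring series-ring
    ι = constHom N ℚ-ring
    module ι = RingHom ι

    inv : ℕ → Carrier
    inv k = S.const′ (inv-ℚ k)

    inverse : ∀ k → inv k * RingTools.fromℕ′ series-ring (suc k) ≈ 1#
    inverse k = trans (*-congˡ {inv k} (sym (ι.⟦⟧-fromℕ′ (suc k)))) (trans (sym (ι.⟦⟧-* (inv-ℚ k) _)) (ι.⟦⟧-cong (inv-ℚ-inverse k)))

    -- The powers of t vanish from N + 1 on; the weaker bound N + 3 has the form required by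
    -- `MomentMatrix`.
    𝓣 : Theta.Nome series-ring h h+h (suc (suc (suc N)))
    𝓣 = record
      { T = S.mono
      ; T-0 = λ k _ → ≡.refl
      ; T-+ = λ m n k _ → S.mono-+ m n k
      ; T-null = λ k N<k → mono-null k (ℕₚ.≤-trans (ℕₚ.m≤n+m (suc N) 2) N<k) }

    open Summation series-ring
    open Signs series-ring using (sg)
    open Theta series-ring h h+h using (module Nome; square)
    module 𝓠 = Nome (square 𝓣)

    triangular-double : ∀ n → triangular n ℕ.+ triangular n ≡ n ℕ.* suc n
    triangular-double n = ℤₚ.+-injective (≡.trans (tri-double (+ n)) (≡.trans (lem (+ n)) (≡.sym (ℤₚ.pos-* n (suc n)))))
      where
      lem : ∀ n → n ℤ.* n ℤ.+ n ≡ n ℤ.* (+ 1 ℤ.+ n)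
      lem = solve-∀

    n≤2triangular : ∀ n → n ℕ.≤ triangular n ℕ.+ triangular n
    n≤2triangular n = ℕₚ.≤-trans (n≤triangular n) (ℕₚ.m≤m+n _ _)

    ∉upTo : ∀ {n k} → k ∉ upTo n → n ℕ.≤ k
    ∉upTo {n} {k} k∉ with ℕₚ.<-≤-connex k n
    ... | inj₁ k<n = ⊥-elim (k∉ (∈ₚ.∈-upTo⁺ k<n))
    ... | inj₂ n≤k = n≤k

    triangle-ℕ : HasSum (λ n → S.mono (triangular n ℕ.+ triangular n)) triangle
    triangle-ℕ = hasSum (upTo (suc N)) (Uₚ.upTo⁺ (suc N)) (λ n n∉ → mono-null _ (ℕₚ.≤-trans (∉upTo n∉) (n≤2triangular n))) total
      where
      module Q = Summation ℚ-ring
      total : ΣL (λ n → S.mono (triangular n ℕ.+ triangular n)) (upTo (suc N)) ≈ triangle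
      total k k≤N = begin
        ΣL (λ n → S.mono (triangular n ℕ.+ triangular n)) (upTo (suc N)) k
          ≡⟨ S.coeff-ΣL (λ n → S.mono (triangular n ℕ.+ triangular n)) (upTo (suc N)) k ⟩
        Q.ΣL (λ n → S.mono (triangular n ℕ.+ triangular n) k) (upTo (suc N))
          ≡⟨ Q.ΣL-covering _ (upTo (suc N)) (upTo (suc k)) (Uₚ.upTo⁺ (suc N)) (Uₚ.upTo⁺ (suc k))
               (λ n n∉ → beyond n (ℕₚ.≤-trans (s≤s k≤N) (∉upTo n∉))) (λ n n∉ → beyond n (∉upTo n∉)) ⟩
        Q.ΣL (λ n → S.mono (triangular n ℕ.+ triangular n) k) (upTo (suc k))
          ≡⟨ Q.ΣL-cong (upTo (suc k)) (λ n → ≡.trans (mono-coeff (triangular n ℕ.+ triangular n) k)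
               (≡.cong (λ j → if j ℕ.≡ᵇ k then 1ℚ else 0ℚ) (triangular-double n))) ⟩
        Q.ΣL (λ n → if n ℕ.* suc n ℕ.≡ᵇ k then 1ℚ else 0ℚ) (upTo (suc k)) ≡⟨ BoxSums.sumTo≡ΣL N k _ ⟨
        triangle k ∎
        where
        beyond : ∀ n → suc k ℕ.≤ n → S.mono (triangular n ℕ.+ triangular n) k ≡ 0ℚ
        beyond n k<n = S.shiftₛ-< _ _ k (ℕₚ.≤-trans k<n (n≤2triangular n))

    -- Each exponent occurs twice over ℤ, at n and at -1 - n.
    triangle-ℤ : HasSum (λ n → 1# * S.mono (tri n ℕ.+ tri n)) (triangle + triangle)
    triangle-ℤ = HasSum-push halves injective image (HasSum-⊎
      (HasSum-cong (λ n → sym (*-identityˡ (S.mono (triangular n ℕ.+ triangular n)))) triangle-ℕ)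
      (HasSum-cong (λ n → sym (*-identityˡ (S.mono (triangular n ℕ.+ triangular n)))) triangle-ℕ))
      where
      halves : ℕ ⊎ ℕ → ℤ
      halves (inj₁ n) = + n
      halves (inj₂ n) = -[1+ n ]
      injective : ∀ {x y} → halves x ≡ halves y → x ≡ y
      injective {inj₁ n} {inj₁ .n} ≡.refl = ≡.refl
      injective {inj₂ n} {inj₂ .n} ≡.refl = ≡.refl
      injective {inj₁ n} {inj₂ m} ()
      injective {inj₂ n} {inj₁ m} ()
      image : ∀ j → (∃ λ x → j ≡ halves x) ⊎ _
      image (+ n)    = inj₁ (inj₁ n , ≡.refl)
      image -[1+ n ] = inj₁ (inj₂ n , ≡.refl)

    hp : ∃ (HasSum (λ n → sg n * S.mono (sq n ℕ.+ sq n)))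
    hp = 𝓠.theta sg sq (λ n → ℕₚ.m≤n⇒m≤1+n (∣i∣≤sq n))

    p : Carrier
    p = proj₁ hp

    p₀≡1 : p 0 ≡ 1ℚ
    p₀≡1 = Q.HasSum-unique (S.coeff-HasSum (proj₂ hp) 0 z≤n) (Q.hasSum (+ 0 ∷ []) ([] ∷ []) outside ≡.refl)
      where
      module Q = Summation ℚ-ring
      outside : ∀ n → n ∉ (+ 0 ∷ []) → (sg n * S.mono (sq n ℕ.+ sq n)) 0 ≡ 0ℚ
      outside n n∉ = ≡.trans (≡.cong (λ c → sg n 0 ℚ.* c) (S.shiftₛ-< (sq n ℕ.+ sq n) _ 0
        (ℕₚ.≤-trans (nonzero n n∉) (ℕₚ.≤-trans (∣i∣≤sq n) (ℕₚ.m≤m+n _ _))))) (ℚₚ.*-zeroʳ (sg n 0))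
        where
        nonzero : ∀ n → n ∉ (+ 0 ∷ []) → 1 ℕ.≤ ∣ n ∣
        nonzero (+ zero)  n∉ = ⊥-elim (n∉ (here ≡.refl))
        nonzero (+ suc n) n∉ = s≤s z≤n
        nonzero -[1+ n ]  n∉ = s≤s z≤n

    -- The constant term of Σ (-1)^n t^(2n²) is 1. A genuine inverse is required, since a(0) = p² is
    -- divided by in the geometric series.
    p-inverse : ∃ λ r → r * p ≈ 1#
    p-inverse = let r , eq = S.series-inverse {p} {1ℚ} (≡.trans (ℚₚ.*-identityˡ (p 0)) p₀≡1) in r , trans (*-comm r p) eq

  module Determinant (m : ℕ) where
    private
      -- The moments use degrees up to 2 m - 1 in u and 2 m - 2 in v. The 2 added guarantees D ≥ 2,
      -- where the coefficient `b 2` lives.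
      D : ℕ
      D = suc (suc (m ℕ.* 2))
    open MomentMatrix series-ring h h+h inv inverse D (s≤s (s≤s z≤n)) 𝓣 (suc N) mono-null
    open Alternating series-ring
    open VandermondeMinors series-ring
    open RingTools series-ring using (fromℕ′; fromℤ; fromℕ′-*; pow-+; pow-*; pow-cong; module Solver)
    open Exponential D series-ring inv inverse using (factorialℕ)
    private
      module B = BoxSums N
      module R = RingTools ℚ-ring

    integral-summand : integral (S.mono ∘ B.size) B.box m (λ zs → S.const′ (B.summand zs)) ≈
      integral (S.mono ∘ size) boxℕ m (λ zs → det zs (seg (λ i ab → pow (fromℤ (sum ab)) (suc (i ℕ.* 2))) 0 m)
                                            * det zs (seg (λ j ab → pow (fromℤ (diff ab)) (j ℕ.* 2)) 0 m))
    integral-summand = integral-cong (S.mono ∘ size) boxℕ m pt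
      where
      pt : ∀ zs → Data.List.length zs ≡ m → S.const′ (B.summand zs) ≈ _
      pt zs ≡.refl = trans (ι.⟦⟧-* _ _) (*-cong
        (trans (ι.⟦⟧-* _ _) (trans (*-cong (image-prodL ι B.sumℚ (λ z → ι.⟦⟧-fromℤ (sum z)) zs)
            (image-vandermonde ι (B.squareℚ B.sumℚ) (λ z → trans (ι.⟦⟧-* _ _) (*-cong (ι.⟦⟧-fromℤ (sum z)) (ι.⟦⟧-fromℤ (sum z)))) zs))
          (sym (det-weighted-vandermonde (fromℤ ∘ sum) _ _ (λ i z → pow-odd (fromℤ (sum z)) i) zs))))
        (trans (ι.⟦⟧-* _ _) (trans (*-cong (image-prodL ι (λ _ → 1ℚ) (λ z → ι.⟦⟧-1) zs)
            (image-vandermonde ι (B.squareℚ B.diffℚ) (λ z → trans (ι.⟦⟧-* _ _) (*-cong (ι.⟦⟧-fromℤ (diff z)) (ι.⟦⟧-fromℤ (diff z)))) zs))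
          (sym (det-weighted-vandermonde (λ _ → 1#) _ _ (λ i z → pow-even (fromℤ (diff z)) i) zs)))))

    private
      tΔ⁴ : Carrier
      tΔ⁴ = S.mono 1 * ((triangle * triangle) * (triangle * triangle))

      factorialℕ≈ : ∀ k → factorialℕ k ≈ fromℕ′ (k !)
      factorialℕ≈ zero    = refl
      factorialℕ≈ (suc k) = trans (*-congˡ {fromℕ′ (suc k)} (factorialℕ≈ k)) (sym (fromℕ′-* (suc k) (k !)))

      factorial≈ : ∀ k → factorial k ≈ fromℕ′ (k !)
      factorial≈ zero    = refl
      factorial≈ (suc k) = trans (*-congˡ {fromℕ′ (suc k)} (factorial≈ k)) (sym (fromℕ′-* (suc k) (k !)))

      entry : ℕ → Carrier
      entry k = (factorialℕ (suc (k ℕ.* 2)) * factorialℕ (k ℕ.* 2)) * pow tΔ⁴ (suc (k ℕ.* 2))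

      -- The exponents 2 k + 1 for k < n add up to n², the source of q^(m²/2) and of the power 4 m².
      product : ∀ n → prodFrom entry 0 n ≈ fromℕ′ (weight n) * pow tΔ⁴ (n ℕ.* n)
      product zero    = sym (*-identityˡ 1#)
      product (suc n) = trans (prodFrom-snoc entry 0 n) (trans (*-cong (product n)
          (*-congʳ {pow tΔ⁴ (suc (n ℕ.* 2))} (trans (*-cong (factorialℕ≈ (suc (n ℕ.* 2))) (factorialℕ≈ (n ℕ.* 2))) (sym (fromℕ′-* (suc (n ℕ.* 2) !) ((n ℕ.* 2) !))))))
        (trans (solve 4 (λ a b c d → (a :* b) :* (c :* d) := (a :* c) :* (b :* d)) refl (fromℕ′ (weight n)) (pow tΔ⁴ (n ℕ.* n)) (fromℕ′ (suc (n ℕ.* 2) ! ℕ.* (n ℕ.* 2) !)) (pow tΔ⁴ (suc (n ℕ.* 2))))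
          (*-cong (sym (fromℕ′-* (weight n) _)) (trans (sym (pow-+ tΔ⁴ (n ℕ.* n) (suc (n ℕ.* 2)))) (reflexive (≡.cong (pow tΔ⁴) (lem n)))))))
        where
        open Solver
        lem : ∀ n → n ℕ.* n ℕ.+ suc (n ℕ.* 2) ≡ suc n ℕ.* suc n
        lem = Data.Nat.Tactic.RingSolver.solve-∀

      mono-pow : ∀ n → pow (S.mono 1) n ≈ S.mono n
      mono-pow zero    = λ k _ → ≡.refl
      mono-pow (suc n) = trans (*-congˡ {S.mono 1} (mono-pow n)) (λ k _ → ≡.sym (S.mono-+ 1 n k))

      tΔ⁴-pow : ∀ n → pow tΔ⁴ n ≈ S.mono n * pow triangle (4 ℕ.* n)
      tΔ⁴-pow n = trans (pow-* (S.mono 1) ((triangle * triangle) * (triangle * triangle)) n)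
        (*-cong (mono-pow n) (trans (pow-fourth triangle n) (reflexive (≡.cong (pow triangle) (ℕₚ.*-comm n 4)))))

    integral-value : integral (S.mono ∘ B.size) B.box m (λ zs → S.const′ (B.summand zs)) ≈
                     S.const′ (R.fromℕ′ (weight m ℕ.* m !)) * (S.mono (m ℕ.* m) * pow triangle (4 ℕ.* (m ℕ.* m)))
    integral-value = trans integral-summand (trans
      (moment-determinant {p} {proj₁ p-inverse} {triangle} (proj₂ hp) (proj₂ p-inverse) triangle-ℤ m (ℕₚ.m≤n+m (m ℕ.* 2) 2))
      (trans (*-cong (product m) (factorial≈ m))
      (trans (solve 3 (λ w y f → (w :* y) :* f := (w :* f) :* y) refl (fromℕ′ (weight m)) (pow tΔ⁴ (m ℕ.* m)) (fromℕ′ (m !)))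
        (*-cong (trans (sym (fromℕ′-* (weight m) (m !))) (sym (ι.⟦⟧-fromℕ′ (weight m ℕ.* m !)))) (tΔ⁴-pow (m ℕ.* m))))))
      where open Solver

theorem1p2 : (m : ℕ) → 1 ≤ m → (N : ℕ) → lhs m N ≡ rhs m N
theorem1p2 m _ N = begin
  lhs m N                                                     ≡⟨ ℚₚ.*-identityˡ (lhs m N) ⟨
  1ℚ ℚ.* lhs m N
    -- `const m` is the reciprocal of c = `weight m` m!, the constant produced by the determinant.
    ≡⟨ ≡.cong (ℚ._* lhs m N) (/-inverse (2 ℕ.^ m ℕ.* (2 ℕ.* m) !) (denom m) (weight m ℕ.* m !) {{denom≢0 m}} (weight-denom m)) ⟨
  const m ℚ.* fromℕ c ℚ.* lhs m N                             ≡⟨ ℚₚ.*-assoc (const m) (fromℕ c) (lhs m N) ⟩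
  const m ℚ.* (fromℕ c ℚ.* lhs m N)
    ≡⟨ ≡.cong (const m ℚ.*_) (≡.cong₂ ℚ._*_ (fromℕ≡fromℕ′ c) (lhs≡ m N)) ⟩
  const m ℚ.* (RingTools.fromℕ′ ℚ-ring c ℚ.* series N)        ≡⟨ ≡.cong (const m ℚ.*_) (S.conv-const (RingTools.fromℕ′ ℚ-ring c) series N) ⟨
  const m ℚ.* S.conv (S.const′ (RingTools.fromℕ′ ℚ-ring c)) series N
    -- The identity is known up to degree N, and precisely the coefficient at N is read off.
    ≡⟨ ≡.cong (const m ℚ.*_) (integral-value N ℕₚ.≤-refl) ⟨
  const m ℚ.* Alternating.integral B.series-ring (S.mono ∘ B.size) B.box m (λ zs → S.const′ (B.summand zs)) N
    ≡⟨ B.rhs-integral m ⟨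
  rhs m N ∎
  where
  open ≡.≡-Reasoning
  open PowerSeriesOverℚ N
  open Determinant m
  module S = Series N ℚ-ring
  module B = BoxSums N
  c = weight m ℕ.* m !
  series = S.conv (S.mono (m ℕ.* m)) (RingTools.pow B.series-ring triangle (4 ℕ.* (m ℕ.* m)))
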